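{- Let $X(q)=\dfrac{(q;q^{12})_\infty(q^{11};q^{12})_\infty(q^{12};q^{12})_\infty}{(q;q)_\infty}$ and $Y(q)=\dfrac{(q^5;q^{12})_\infty(q^7;q^{12})_\infty(q^{12};q^{12})_\infty}{(q;q)_\infty}$. For integers $k\ge1$ and $m>1$ define power series (sums over $n\ge0$) \[ \sum\xi_{1,k}(n)q^n=\frac{Y^k(q)}{X^k(q)},\qquad \sum\xi_{m,k}(n)q^n=\frac{X^k(q)Y^k(q^m)}{Y^k(q)X^k(q^m)}\ (m>1),\qquad \sum\xi_4(n)q^n=\frac{Y(q)Y(q^2)}{X(q)X(q^2)}, \] and denote by a prime the coefficient of $q^n$ in the reciprocal of the corresponding series. Then for all $n\ge0$: (i) $\xi_{1,1}(2n+3)=-\xi'_{1,1}(2n+1)$; (ii) $\xi_{1,1}(4n+2)=\xi'_{1,1}(4n)$; (iii) $\xi_{1,1}(6n+2)=\xi'_{1,1}(6n)$; (iv) $\xi_{1,2}(12n+7)=\xi'_{1,2}(12n+3)$; (v) $\xi_{1,2}(24n+12)=\xi'_{1,2}(24n+8)$; (vi) $\xi_{2,1}(2n+3)=-\xi'_{2,1}(2n+1)$; (vii) $\xi_{2,1}(4n+2)=\xi'_{2,1}(4n)$; (viii) $\xi_{2,1}(12n+8)=\xi'_{2,1}(12n+6)$; (ix) $\xi_{2,2}(12n+7)=\xi'_{2,2}(12n+3)$; (x) $\xi_{2,2}(24n+12)=\xi'_{2,2}(24n+8)$; (xi) $\xi_{3,1}(3n+5)=\xi'_{3,1}(3n+1)$;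 (xii) $\xi_{3,1}(6n+8)=-\xi'_{3,1}(6n+4)$; (xiii) $\xi_{3,1}(6n+4)=-\xi'_{3,1}(6n)$; (xiv) $\xi_{3,1}(12n+7)=\xi'_{3,1}(12n+3)$; (xv) $\xi_{3,2}(24n+14)=\xi'_{3,2}(24n+6)$; (xvi) $\xi_{3,2}(36n+25)=\xi'_{3,2}(36n+17)$; (xvii) $\xi_4(12n+15)=-\xi'_4(12n+9)$; (xviii) $\xi_4(12n+7)=-\xi'_4(12n+1)$; (xix) $\xi_4(12n+10)=\xi'_4(12n+4)$; (xx) $\xi_4(12n+11)=-\xi'_4(12n+5)$; (xxi) $\xi_4(24n+13)=\xi'_4(24n+7)$; (xxii) $\xi_4(36n+24)=\xi'_4(36n+18)$.
   Context: $(a;q)_\infty=\prod_{j\ge0}(1-aq^j)$, $q$ a formal variable (or complex with $|q|<1$). $X(q),Y(q)$ are Rogers–Ramanujan type functions with constant term $1$, so all series above and their reciprocals are power series in $q$. -}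

module Defs where

open import Data.Nat using (ℕ; zero; suc; _∸_; _≡ᵇ_; NonZero) renaming (_+_ to _+ℕ_; _*_ to _*ℕ_)
open import Data.Nat.DivMod using (_%_; _/_)
open import Data.Integer using (ℤ; _+_; _*_; -_; _-_; 0ℤ; 1ℤ)
open import Data.Bool using (if_then_else_)

-- Formal power series over ℤ, represented by their coefficient sequences:
-- f n = coefficient of q^n.
PS : Set
PS = ℕ → ℤ

sumTo : ℕ → (ℕ → ℤ) → ℤ
sumTo zero    f = 0ℤ
sumTo (suc n) f = sumTo n f + f n

infixl 7 _⊛_
_⊛_ : PS → PS → PS
(f ⊛ g) n = sumTo (suc n) (λ i → f i * g (n ∸ i))

oneS : PS
oneS zero    = 1ℤ
oneS (suc _) = 0ℤ

oneMinusQ : ℕ → PS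
oneMinusQ e n = oneS n - (if n ≡ᵇ e then 1ℤ else 0ℤ)

prodTo : ℕ → (ℕ → PS) → PS
prodTo zero    F = oneS
prodTo (suc n) F = prodTo n F ⊛ F n

powS : ℕ → PS → PS
powS zero    f = oneS
powS (suc k) f = powS k f ⊛ f

-- (q^a ; q^b)_∞ = Π_{j≥0} (1 - q^{a+bj}), used with a ≥ 1, b ≥ 1.
-- Its coefficient of q^n is that of the partial product over j < n+1,
-- since every factor with j ≥ n+1 has exponent a+bj > n and is ≡ 1 mod q^{n+1}.
poch : ℕ → ℕ → PS
poch a b n = prodTo (suc n) (λ j → oneMinusQ (a +ℕ b *ℕ j)) n

-- Reciprocal of a power series with constant term 1:
-- g 0 = 1, g n = - Σ_{i=1}^{n} f i * g (n-i).
-- invUpTo f n agrees with the reciprocal on coefficients 0..n.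
invUpTo : PS → ℕ → PS
invUpTo f zero    k = oneS k
invUpTo f (suc n) k =
  if k ≡ᵇ suc n
  then - sumTo (suc n) (λ i → f (suc i) * invUpTo f n (n ∸ i))
  else invUpTo f n k

inv : PS → PS
inv f n = invUpTo f n n

dil : (m : ℕ) → .{{NonZero m}} → PS → PS
dil m f n = if n % m ≡ᵇ 0 then f (n / m) else 0ℤ

qq : PS
qq = poch 1 1

X : PS
X = poch 1 12 ⊛ poch 11 12 ⊛ poch 12 12 ⊛ inv qq

Y : PS
Y = poch 5 12 ⊛ poch 7 12 ⊛ poch 12 12 ⊛ inv qq

ξ₁ : ℕ → PS
ξ₁ k = powS k Y ⊛ inv (powS k X)

ξ : (m : ℕ) → .{{NonZero m}} → ℕ → PS
ξ m k = powS k X ⊛ powS k (dil m Y) ⊛ inv (powS k Y ⊛ powS k (dil m X))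

ξ₄ : PS
ξ₄ = Y ⊛ dil 2 Y ⊛ inv (X ⊛ dil 2 X)

_′ : PS → PS
f ′ = inv f

{-# OPTIONS --safe #-}

-- Write f_d = (q^d ; q^d)_∞ and x = q X/Y. Each claim says that, for w one of x(q), x(q)/x(q²),
-- x(q)/x(q³), x(q) x(q²) or a square of these, the coefficients of 1/w + w or of 1/w - w vanish
-- along an arithmetic progression. By the Jacobi triple product, f_1 Y and f_1 X are theta series,
-- and they are the two parities of the terms of the theta series of (-q, q²) and (q, -q²), which
-- gives 1/x + x = t + 1 with t = ψ(q²)²/(q ψ(q⁶)²), and 1/x - x = ψ(q) ψ(q³)/(q ψ(q⁶)²). Moreover
-- x(q²) = -x(q) x(-q), which settles x(q)/x(q²), and the remaining functions 1/w ± w are bilinear in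
-- the values of 1/x + x and 1/x - x at q and at q² or q³. So each claim concerns an explicit
-- combination of eta quotients, and follows by dissecting it modulo 2 and 3 until a series in q² or
-- q³ appears. All dissections used are consequences of those of single theta series.
module Submission where

open import Defs
open import Algebra.Bundles using (CommutativeRing)
open import Algebra.Solver.Ring.AlmostCommutativeRing using (AlmostCommutativeRing; fromCommutativeRing; _-Raw-AlmostCommutative⟶_)
open import Algebra.Structures using (IsCommutativeMonoid; IsCommutativeRing)
open import Data.Bool using (Bool; true; false; if_then_else_; T; _∧_; not)
open import Data.Bool.Properties using (T-∧)
open import Data.Empty using (⊥-elim)
open import Data.Integer using (ℤ; -_; -[1+_]; 0ℤ; 1ℤ; -1ℤ)
import Data.Integer as ℤ
import Data.Integer.Properties as ℤₚ
import Data.Integer.Tactic.RingSolver as ℤR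
open import Data.List using (List; []; _∷_; _++_; map)
open import Data.Maybe as Maybe using (Maybe)
open import Data.Nat using (ℕ; zero; suc; _+_; _*_; _∸_; _≤_; _<_; z≤n; s≤s; NonZero; _≡ᵇ_; _<ᵇ_)
import Data.Nat as ℕ
open import Data.Nat.Divisibility using (divides)
open import Data.Nat.DivMod using (_%_; _/_; m≡m%n+[m/n]*n; m%n<n; [m+kn]%n≡m%n; m<n⇒m%n≡m; m*n/n≡m; m/n≤m; m<n⇒m/n≡0; +-distrib-/-∣ʳ)
import Data.Nat.Properties as ℕₚ
import Data.Nat.Tactic.RingSolver as ℕR
open import Data.Product using (_×_; _,_; proj₁; proj₂)
open import Data.Sum using (inj₁; inj₂)
open import Data.Unit using (tt)
open import Function using (_∘_)
open import Function.Bundles using (module Equivalence)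
open import Level using (0ℓ)
open import Relation.Binary using (IsEquivalence)
open import Relation.Binary.PropositionalEquality using (_≡_; refl; sym; trans; cong; cong₂; subst; module ≡-Reasoning)
open import Relation.Nullary using (¬_; yes; no)
open import Relation.Nullary.Decidable.Core using (dec⇒maybe)

-- Identities between eta quotients are certified by computation, not by bounds on orders of
-- vanishing. An expression is a `Poly` in q and formal symbols; a new identity is given as an
-- explicit combination, with cofactors, of polynomials already known to be null, and `linear`
-- compares normal forms. Replacing f g by f' g' therefore shows up as the cofactors g and f' of f -
-- f' and g - g'. The normal form treats distinct symbols as independent, so all relations between
-- them enter through the triple product, the splitting of a symbol into residue classes, and the
-- operations q ↦ -q, q ↦ q^m and extraction of a progression. To avoid poles, 1/w ± w is multiplied
-- by the power of q that makes it a power series. The gaps 2, 4, 6 and 8 between paired indices in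
-- the claims are the resulting exponents c in l ± q^c / l.

sumTo-cong : ∀ n {f g : ℕ → ℤ} → (∀ i → i < n → f i ≡ g i) → sumTo n f ≡ sumTo n g
sumTo-cong zero    h = refl
sumTo-cong (suc n) h = cong₂ ℤ._+_ (sumTo-cong n (λ i i<n → h i (ℕₚ.m<n⇒m<1+n i<n))) (h n ℕₚ.≤-refl)

sumTo-zero : ∀ n {f : ℕ → ℤ} → (∀ i → i < n → f i ≡ 0ℤ) → sumTo n f ≡ 0ℤ
sumTo-zero zero    h = refl
sumTo-zero (suc n) h = cong₂ ℤ._+_ (sumTo-zero n (λ i i<n → h i (ℕₚ.m<n⇒m<1+n i<n))) (h n ℕₚ.≤-refl)

sumTo-+ : ∀ n (f g : ℕ → ℤ) → sumTo n (λ i → f i ℤ.+ g i) ≡ sumTo n f ℤ.+ sumTo n g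
sumTo-+ zero    f g = refl
sumTo-+ (suc n) f g rewrite sumTo-+ n f g = interchange (sumTo n f) (sumTo n g) (f n) (g n)
  where
  interchange : ∀ a b c d → (a ℤ.+ b) ℤ.+ (c ℤ.+ d) ≡ (a ℤ.+ c) ℤ.+ (b ℤ.+ d)
  interchange = ℤR.solve-∀

sumTo-* : ∀ n c (f : ℕ → ℤ) → sumTo n (λ i → c ℤ.* f i) ≡ c ℤ.* sumTo n f
sumTo-* zero    c f = sym (ℤₚ.*-zeroʳ c)
sumTo-* (suc n) c f rewrite sumTo-* n c f = sym (ℤₚ.*-distribˡ-+ c (sumTo n f) (f n))

sumTo-head : ∀ n (f : ℕ → ℤ) → sumTo (suc n) f ≡ f 0 ℤ.+ sumTo n (f ∘ suc)
sumTo-head zero    f = ℤₚ.+-comm 0ℤ (f 0)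
sumTo-head (suc n) f rewrite sumTo-head n f = ℤₚ.+-assoc (f 0) (sumTo n (f ∘ suc)) (f (suc n))

sumTo-split : ∀ m n (f : ℕ → ℤ) → sumTo (m + n) f ≡ sumTo m f ℤ.+ sumTo n (λ i → f (m + i))
sumTo-split m zero    f rewrite ℕₚ.+-identityʳ m = sym (ℤₚ.+-identityʳ _)
sumTo-split m (suc n) f rewrite ℕₚ.+-suc m n | sumTo-split m n f = ℤₚ.+-assoc (sumTo m f) _ _

-- The commutative ring of formal power series

infix 4 _≈_
-- A record, so that unification can recover both series from the type of a proof; a bare pointwise
-- equality would unfold.
record _≈_ (f g : PS) : Set where
  constructor coeffwise
  field at : ∀ n → f n ≡ g n
open _≈_ public

infixl 6 _+ₚ_
_+ₚ_ : PS → PS → PS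
(f +ₚ g) n = f n ℤ.+ g n

-ₚ_ : PS → PS
(-ₚ f) n = - f n

zeroS : PS
zeroS _ = 0ℤ

tail : PS → PS
tail f n = f (suc n)

⊛-cong : ∀ {f f' g g'} → f ≈ f' → g ≈ g' → f ⊛ g ≈ f' ⊛ g'
⊛-cong p q = coeffwise λ n → sumTo-cong (suc n) (λ i _ → cong₂ ℤ._*_ (at p i) (at q (n ∸ i)))

-- Recursion on the constant term of the left factor: it turns commutativity and associativity into
-- inductions on the coefficient index, without reindexing double sums.
⊛-step : ∀ f g n → (f ⊛ g) (suc n) ≡ f 0 ℤ.* g (suc n) ℤ.+ (tail f ⊛ g) n
⊛-step f g n = sumTo-head (suc n) (λ i → f i ℤ.* g (suc n ∸ i))

⊛-stepʳ : ∀ f g n → (f ⊛ g) (suc n) ≡ (f ⊛ tail g) n ℤ.+ f (suc n) ℤ.* g 0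
⊛-stepʳ f g n = cong₂ ℤ._+_
  (sumTo-cong (suc n) (λ { i (s≤s i≤n) → cong (λ k → f i ℤ.* g k) (ℕₚ.+-∸-assoc 1 i≤n) }))
  (cong (λ k → f (suc n) ℤ.* g k) (ℕₚ.n∸n≡0 (suc n)))

⊛-comm-at : ∀ n f g → (f ⊛ g) n ≡ (g ⊛ f) n
⊛-comm-at zero f g = cong (λ x → 0ℤ ℤ.+ x) (ℤₚ.*-comm (f 0) (g 0))
⊛-comm-at (suc n) f g = begin
  (f ⊛ g) (suc n)                             ≡⟨ ⊛-step f g n ⟩
  f 0 ℤ.* g (suc n) ℤ.+ (tail f ⊛ g) n        ≡⟨ cong₂ ℤ._+_ (ℤₚ.*-comm (f 0) (g (suc n))) (⊛-comm-at n (tail f) g) ⟩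
  g (suc n) ℤ.* f 0 ℤ.+ (g ⊛ tail f) n        ≡⟨ ℤₚ.+-comm (g (suc n) ℤ.* f 0) _ ⟩
  (g ⊛ tail f) n ℤ.+ g (suc n) ℤ.* f 0        ≡⟨ ⊛-stepʳ g f n ⟨
  (g ⊛ f) (suc n)                             ∎
  where open ≡-Reasoning

⊛-distribʳ-at : ∀ n f g h → ((f +ₚ g) ⊛ h) n ≡ (f ⊛ h) n ℤ.+ (g ⊛ h) n
⊛-distribʳ-at n f g h = trans
  (sumTo-cong (suc n) (λ i _ → ℤₚ.*-distribʳ-+ (h (n ∸ i)) (f i) (g i)))
  (sumTo-+ (suc n) _ _)

infixr 8 _·ₚ_
_·ₚ_ : ℤ → PS → PS
(c ·ₚ f) n = c ℤ.* f n

·ₚ-⊛-at : ∀ n c f g → ((c ·ₚ f) ⊛ g) n ≡ c ℤ.* (f ⊛ g) n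
·ₚ-⊛-at n c f g = trans
  (sumTo-cong (suc n) (λ i _ → ℤₚ.*-assoc c (f i) (g (n ∸ i))))
  (sumTo-* (suc n) c _)

-- The tail of `f ⊛ g` is `f 0` times the tail of g plus `tail f ⊛ g`, so the inductive step passes
-- to `tail f` at index n.
⊛-assoc-at : ∀ n f g h → ((f ⊛ g) ⊛ h) n ≡ (f ⊛ (g ⊛ h)) n
⊛-assoc-at zero f g h = lemma (f 0) (g 0) (h 0)
  where
  lemma : ∀ a b c → 0ℤ ℤ.+ (0ℤ ℤ.+ a ℤ.* b) ℤ.* c ≡ 0ℤ ℤ.+ a ℤ.* (0ℤ ℤ.+ b ℤ.* c)
  lemma = ℤR.solve-∀
⊛-assoc-at (suc n) f g h = begin
  ((f ⊛ g) ⊛ h) (suc n)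
    ≡⟨ ⊛-step (f ⊛ g) h n ⟩
  (0ℤ ℤ.+ f 0 ℤ.* g 0) ℤ.* h (suc n) ℤ.+ (tail (f ⊛ g) ⊛ h) n
    ≡⟨ cong (λ x → (0ℤ ℤ.+ f 0 ℤ.* g 0) ℤ.* h (suc n) ℤ.+ x)
        (at (⊛-cong {g = h} (coeffwise {tail (f ⊛ g)} {f 0 ·ₚ tail g +ₚ tail f ⊛ g} (⊛-step f g)) (coeffwise λ _ → refl)) n) ⟩
  (0ℤ ℤ.+ f 0 ℤ.* g 0) ℤ.* h (suc n) ℤ.+ ((f 0 ·ₚ tail g +ₚ tail f ⊛ g) ⊛ h) n
    ≡⟨ cong (λ x → (0ℤ ℤ.+ f 0 ℤ.* g 0) ℤ.* h (suc n) ℤ.+ x)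
        (trans (⊛-distribʳ-at n (f 0 ·ₚ tail g) (tail f ⊛ g) h)
          (cong₂ ℤ._+_ (·ₚ-⊛-at n (f 0) (tail g) h) (⊛-assoc-at n (tail f) g h))) ⟩
  (0ℤ ℤ.+ f 0 ℤ.* g 0) ℤ.* h (suc n) ℤ.+ (f 0 ℤ.* (tail g ⊛ h) n ℤ.+ (tail f ⊛ (g ⊛ h)) n)
    ≡⟨ lemma (f 0) (g 0) (h (suc n)) ((tail g ⊛ h) n) ((tail f ⊛ (g ⊛ h)) n) ⟩
  f 0 ℤ.* (g 0 ℤ.* h (suc n) ℤ.+ (tail g ⊛ h) n) ℤ.+ (tail f ⊛ (g ⊛ h)) n
    ≡⟨ cong (λ x → f 0 ℤ.* x ℤ.+ (tail f ⊛ (g ⊛ h)) n) (⊛-step g h n) ⟨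
  f 0 ℤ.* (g ⊛ h) (suc n) ℤ.+ (tail f ⊛ (g ⊛ h)) n
    ≡⟨ ⊛-step f (g ⊛ h) n ⟨
  (f ⊛ (g ⊛ h)) (suc n) ∎
  where
  open ≡-Reasoning
  lemma : ∀ a b c d e → (0ℤ ℤ.+ a ℤ.* b) ℤ.* c ℤ.+ (a ℤ.* d ℤ.+ e) ≡ a ℤ.* (b ℤ.* c ℤ.+ d) ℤ.+ e
  lemma = ℤR.solve-∀

⊛-identityˡ-at : ∀ n f → (oneS ⊛ f) n ≡ f n
⊛-identityˡ-at n f = trans (sumTo-head n (λ i → oneS i ℤ.* f (n ∸ i)))
  (trans (cong₂ ℤ._+_ (ℤₚ.*-identityˡ (f n)) (sumTo-zero n (λ _ _ → refl))) (ℤₚ.+-identityʳ (f n)))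

≈-isEquivalence : IsEquivalence _≈_
≈-isEquivalence = record
  { refl = coeffwise λ _ → refl
  ; sym = λ p → coeffwise λ n → sym (at p n)
  ; trans = λ p q → coeffwise λ n → trans (at p n) (at q n) }

open IsEquivalence ≈-isEquivalence public using () renaming (refl to ≈-refl; sym to ≈-sym; trans to ≈-trans)

⊛-ring : CommutativeRing 0ℓ 0ℓ
⊛-ring = record
  { Carrier = PS ; _≈_ = _≈_ ; _+_ = _+ₚ_ ; _*_ = _⊛_ ; -_ = -ₚ_ ; 0# = zeroS ; 1# = oneS
  ; isCommutativeRing = record
    { isRing = record
      { +-isAbelianGroup = record
        { isGroup = record
          { isMonoid = record
            { isSemigroup = record
              { isMagma = record
                { isEquivalence = ≈-isEquivalence
                ; ∙-cong = λ p q → coeffwise λ n → cong₂ ℤ._+_ (at p n) (at q n) }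
              ; assoc = λ f g h → coeffwise λ n → ℤₚ.+-assoc (f n) (g n) (h n) }
            ; identity = (λ f → coeffwise λ n → ℤₚ.+-identityˡ (f n)) , (λ f → coeffwise λ n → ℤₚ.+-identityʳ (f n)) }
          ; inverse = (λ f → coeffwise λ n → ℤₚ.+-inverseˡ (f n)) , (λ f → coeffwise λ n → ℤₚ.+-inverseʳ (f n))
          ; ⁻¹-cong = λ p → coeffwise λ n → cong -_ (at p n) }
        ; comm = λ f g → coeffwise λ n → ℤₚ.+-comm (f n) (g n) }
      ; *-cong = ⊛-cong
      ; *-assoc = λ f g h → coeffwise λ n → ⊛-assoc-at n f g h
      ; *-identity = idˡ , λ f → ≈-trans (comm f oneS) (idˡ f)
      ; distrib = (λ f g h → ≈-trans (comm f (g +ₚ h)) (≈-trans (distʳ f g h)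
                     (coeffwise λ n → cong₂ ℤ._+_ (⊛-comm-at n g f) (⊛-comm-at n h f)))) , distʳ }
    ; *-comm = comm } }
  where
  comm : ∀ f g → f ⊛ g ≈ g ⊛ f
  comm f g = coeffwise λ n → ⊛-comm-at n f g
  idˡ : ∀ f → oneS ⊛ f ≈ f
  idˡ f = coeffwise λ n → ⊛-identityˡ-at n f
  distʳ : ∀ f g h → (g +ₚ h) ⊛ f ≈ g ⊛ f +ₚ h ⊛ f
  distʳ f g h = coeffwise λ n → ⊛-distribʳ-at n g h f

-- Series are functions, so the conversion checker compares them by η-expansion;
-- keeping the operations abstract stops it from unfolding sums of coefficients.
infixl 7 _⊗_
infixl 6 _⊕_
infix  8 ⊖_
infixr 8 _·_

abstract
  _⊗_ _⊕_ : PS → PS → PS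
  _⊗_ = _⊛_
  _⊕_ = _+ₚ_

  ⊖_ : PS → PS
  ⊖_ = -ₚ_

  _·_ : ℤ → PS → PS
  _·_ = _·ₚ_

  ⊗≈⊛ : ∀ f g → f ⊗ g ≈ f ⊛ g
  ⊗≈⊛ f g = ≈-refl

  ⊕-at : ∀ f g n → (f ⊕ g) n ≡ f n ℤ.+ g n
  ⊕-at f g n = refl

  ⊖-at : ∀ f n → (⊖ f) n ≡ - f n
  ⊖-at f n = refl

  ·-at : ∀ c f n → (c · f) n ≡ c ℤ.* f n
  ·-at c f n = refl

  ·-cong : ∀ c {f g} → f ≈ g → c · f ≈ c · g
  ·-cong c p = coeffwise λ n → cong (c ℤ.*_) (at p n)

  ·-⊗ : ∀ c f g → (c · f) ⊗ g ≈ c · (f ⊗ g)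
  ·-⊗ c f g = coeffwise λ n → ·ₚ-⊛-at n c f g

  ·-· : ∀ c d f → c · (d · f) ≈ (c ℤ.* d) · f
  ·-· c d f = coeffwise λ n → sym (ℤₚ.*-assoc c d (f n))

  ·-+ : ∀ c d f → (c ℤ.+ d) · f ≈ c · f ⊕ d · f
  ·-+ c d f = coeffwise λ n → ℤₚ.*-distribʳ-+ (f n) c d

  ·-⊖ : ∀ c f → (- c) · f ≈ ⊖ (c · f)
  ·-⊖ c f = coeffwise λ n → sym (ℤₚ.neg-distribˡ-* c (f n))

  ·-zeroS : ∀ c → c · zeroS ≈ zeroS
  ·-zeroS c = coeffwise λ n → ℤₚ.*-zeroʳ c

  0· : ∀ f → 0ℤ · f ≈ zeroS
  0· f = ≈-refl

  1· : ∀ f → 1ℤ · f ≈ f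
  1· f = coeffwise λ n → ℤₚ.*-identityˡ (f n)

  isCommutativeRing : IsCommutativeRing _≈_ _⊕_ _⊗_ ⊖_ zeroS oneS
  isCommutativeRing = CommutativeRing.isCommutativeRing ⊛-ring

PS-ring : CommutativeRing 0ℓ 0ℓ
PS-ring = record { isCommutativeRing = isCommutativeRing }

open CommutativeRing PS-ring public using (setoid; *-isCommutativeMonoid; +-isCommutativeMonoid)
  renaming ( *-cong to ⊗-cong; *-assoc to ⊗-assoc; *-comm to ⊗-comm; *-identityˡ to ⊗-identityˡ; *-identityʳ to ⊗-identityʳ
           ; distribˡ to ⊗-distribˡ; distribʳ to ⊗-distribʳ; zeroˡ to ⊗-zeroˡ; zeroʳ to ⊗-zeroʳ
           ; +-cong to ⊕-cong; -‿cong to ⊖-cong; -‿inverseʳ to ⊕-inverseʳ; +-identityˡ to ⊕-identityˡ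
           ; +-identityʳ to ⊕-identityʳ; +-assoc to ⊕-assoc; +-comm to ⊕-comm)

PS-acr : AlmostCommutativeRing 0ℓ 0ℓ
PS-acr = fromCommutativeRing PS-ring

ℤ-acr : AlmostCommutativeRing 0ℓ 0ℓ
ℤ-acr = fromCommutativeRing ℤₚ.+-*-commutativeRing

⊗-· : ∀ c f g → f ⊗ (c · g) ≈ c · (f ⊗ g)
⊗-· c f g = ≈-trans (⊗-comm f (c · g)) (≈-trans (·-⊗ c g f) (·-cong c (⊗-comm g f)))

-- The coefficients 0 and 1 of the solver must evaluate to zeroS and oneS on the nose.
constS : ℤ → PS
constS (ℤ.+ 0) = zeroS
constS (ℤ.+ 1) = oneS
constS c       = c · oneS

constS-· : ∀ c → constS c ≈ c · oneS
constS-· (ℤ.+ 0)             = ≈-sym (0· oneS)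
constS-· (ℤ.+ 1)             = ≈-sym (1· oneS)
constS-· (ℤ.+ (suc (suc _))) = ≈-refl
constS-· (-[1+ _ ])          = ≈-refl

PS-solver-coefficients : AlmostCommutativeRing.rawRing ℤ-acr -Raw-AlmostCommutative⟶ PS-acr
PS-solver-coefficients = record
  { ⟦_⟧    = constS
  ; +-homo = λ c d → via₂ c d (c ℤ.+ d) _⊕_ ⊕-cong (·-+ c d oneS)
  ; *-homo = λ c d → via₂ c d (c ℤ.* d) _⊗_ ⊗-cong (≈-trans (≈-sym (·-· c d oneS))
      (≈-trans (·-cong c (≈-sym (⊗-identityˡ (d · oneS)))) (≈-sym (·-⊗ c oneS (d · oneS)))))
  ; -‿homo = λ c → ≈-trans (constS-· (- c)) (≈-trans (·-⊖ c oneS) (⊖-cong (≈-sym (constS-· c))))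
  ; 0-homo = ≈-refl
  ; 1-homo = ≈-refl }
  where
  via₂ : ∀ c d e (_∙_ : PS → PS → PS) → (∀ {f f' g g'} → f ≈ f' → g ≈ g' → (f ∙ g) ≈ (f' ∙ g')) →
    (e · oneS) ≈ ((c · oneS) ∙ (d · oneS)) → constS e ≈ (constS c ∙ constS d)
  via₂ c d e _∙_ ∙-cong p = ≈-trans (constS-· e) (≈-trans p (∙-cong (≈-sym (constS-· c)) (≈-sym (constS-· d))))

constS-≟ : ∀ c d → Maybe (constS c ≈ constS d)
constS-≟ c d = Maybe.map (λ e → subst (λ x → constS c ≈ constS x) e ≈-refl) (dec⇒maybe (c ℤₚ.≟ d))

module ≈-Reasoning where
  open import Relation.Binary.Reasoning.Setoid setoid public

open import Algebra.Solver.Ring (AlmostCommutativeRing.rawRing ℤ-acr) PS-acr PS-solver-coefficients constS-≟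
  using (solve; _:=_; _:*_; _:+_; _:-_; :-_; con) public

-- Reciprocals

≡ᵇ-refl : ∀ n → (n ≡ᵇ n) ≡ true
≡ᵇ-refl zero    = refl
≡ᵇ-refl (suc n) = ≡ᵇ-refl n

≢⇒≡ᵇ-false : ∀ {k n} → ¬ k ≡ n → (k ≡ᵇ n) ≡ false
≢⇒≡ᵇ-false {zero}  {zero}  k≢n = ⊥-elim (k≢n refl)
≢⇒≡ᵇ-false {zero}  {suc n} k≢n = refl
≢⇒≡ᵇ-false {suc k} {zero}  k≢n = refl
≢⇒≡ᵇ-false {suc k} {suc n} k≢n = ≢⇒≡ᵇ-false (k≢n ∘ cong suc)

≡⇒≈ : ∀ {f g : PS} → f ≡ g → f ≈ g
≡⇒≈ refl = ≈-refl

invUpTo-stable : ∀ f n k → k ≤ n → invUpTo f n k ≡ inv f k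
invUpTo-stable f n k k≤n with ℕₚ.m≤n⇒m<n∨m≡n k≤n
invUpTo-stable f n k k≤n | inj₂ refl = refl
invUpTo-stable f (suc n) k _ | inj₁ k<n@(s≤s k≤n) rewrite ≢⇒≡ᵇ-false (ℕₚ.<⇒≢ k<n) = invUpTo-stable f n k k≤n

inv-suc : ∀ f n → inv f (suc n) ≡ - (tail f ⊛ inv f) n
inv-suc f n rewrite ≡ᵇ-refl n = cong -_ (sumTo-cong (suc n)
  (λ i _ → cong (f (suc i) ℤ.*_) (invUpTo-stable f n (n ∸ i) (ℕₚ.m∸n≤m n i))))

⊛-inv : ∀ {f} → f 0 ≡ 1ℤ → f ⊛ inv f ≈ oneS
⊛-inv {f} f0 = coeffwise go
  where
  open ≡-Reasoning
  lemma : ∀ a → 1ℤ ℤ.* - a ℤ.+ a ≡ 0ℤ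
  lemma = ℤR.solve-∀
  go : ∀ n → (f ⊛ inv f) n ≡ oneS n
  go zero    = cong (λ x → 0ℤ ℤ.+ x ℤ.* 1ℤ) f0
  go (suc n) = begin
    (f ⊛ inv f) (suc n)                                 ≡⟨ ⊛-step f (inv f) n ⟩
    f 0 ℤ.* inv f (suc n) ℤ.+ (tail f ⊛ inv f) n        ≡⟨ cong₂ (λ x y → x ℤ.* y ℤ.+ (tail f ⊛ inv f) n) f0 (inv-suc f n) ⟩
    1ℤ ℤ.* - (tail f ⊛ inv f) n ℤ.+ (tail f ⊛ inv f) n  ≡⟨ lemma ((tail f ⊛ inv f) n) ⟩
    0ℤ                                                  ∎

abstract
  recip : PS → PS
  recip = inv

  recip≈inv : ∀ f → recip f ≈ inv f
  recip≈inv f = ≈-refl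

  recip-0 : ∀ f → recip f 0 ≡ 1ℤ
  recip-0 f = refl

⊗-recip : ∀ {f} → f 0 ≡ 1ℤ → f ⊗ recip f ≈ oneS
⊗-recip {f} f0 = ≈-trans (⊗-cong (≈-refl {f}) (recip≈inv f)) (≈-trans (⊗≈⊛ f (inv f)) (⊛-inv {f} f0))

⊗-0 : ∀ f g → (f ⊗ g) 0 ≡ f 0 ℤ.* g 0
⊗-0 f g = trans (at (⊗≈⊛ f g) 0) (ℤₚ.+-identityˡ _)

⊗-unit : ∀ {f g} → f 0 ≡ 1ℤ → g 0 ≡ 1ℤ → (f ⊗ g) 0 ≡ 1ℤ
⊗-unit {f} {g} p q = trans (⊗-0 f g) (cong₂ ℤ._*_ p q)

⊗-cancelˡ : ∀ {u f g} → u 0 ≡ 1ℤ → u ⊗ f ≈ u ⊗ g → f ≈ g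
⊗-cancelˡ {u} {f} {g} u0 p = begin
  f                    ≈⟨ lemma f ⟩
  recip u ⊗ (u ⊗ f)    ≈⟨ ⊗-cong ≈-refl p ⟩
  recip u ⊗ (u ⊗ g)    ≈⟨ lemma g ⟨
  g                    ∎
  where
  open ≈-Reasoning
  lemma : ∀ h → h ≈ recip u ⊗ (u ⊗ h)
  lemma h = begin
    h                  ≈⟨ ⊗-identityˡ h ⟨
    oneS ⊗ h           ≈⟨ ⊗-cong (⊗-recip u0) ≈-refl ⟨
    u ⊗ recip u ⊗ h    ≈⟨ solve 3 (λ a b c → a :* b :* c := b :* (a :* c)) ≈-refl u (recip u) h ⟩
    recip u ⊗ (u ⊗ h)  ∎

recip-unique : ∀ {f g} → f 0 ≡ 1ℤ → f ⊗ g ≈ oneS → recip f ≈ g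
recip-unique f0 p = ⊗-cancelˡ f0 (≈-trans (⊗-recip f0) (≈-sym p))

recip-cong : ∀ {f g} → f 0 ≡ 1ℤ → f ≈ g → recip f ≈ recip g
recip-cong {f} {g} f0 p = recip-unique f0 (≈-trans (⊗-cong p ≈-refl) (⊗-recip (trans (sym (at p 0)) f0)))

-- Monomials

Q : ℕ → PS
Q zero    = oneS
Q (suc e) zero    = 0ℤ
Q (suc e) (suc n) = Q e n

Q-indicator : ∀ e n → Q e n ≡ (if n ≡ᵇ e then 1ℤ else 0ℤ)
Q-indicator zero    zero    = refl
Q-indicator zero    (suc n) = refl
Q-indicator (suc e) zero    = refl
Q-indicator (suc e) (suc n) = Q-indicator e n

Q-off-diag : ∀ e n → n < e → Q e n ≡ 0ℤ
Q-off-diag (suc e) zero    _       = refl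
Q-off-diag (suc e) (suc n) (s≤s p) = Q-off-diag e n p

Q-suc-⊛ : ∀ e f n → (Q (suc e) ⊛ f) (suc n) ≡ (Q e ⊛ f) n
Q-suc-⊛ e f n = trans (⊛-step (Q (suc e)) f n) (ℤₚ.+-identityˡ _)

abstract
  Q-⊗-+ : ∀ e f n → (Q e ⊗ f) (n + e) ≡ f n
  Q-⊗-+ e f n = trans (at (⊗≈⊛ (Q e) f) (n + e)) (go e n)
    where
    go : ∀ e n → (Q e ⊛ f) (n + e) ≡ f n
    go zero    n rewrite ℕₚ.+-identityʳ n = ⊛-identityˡ-at n f
    go (suc e) n rewrite ℕₚ.+-suc n e     = trans (Q-suc-⊛ e f (n + e)) (go e n)

  Q-+ : ∀ a b → Q (a + b) ≈ Q a ⊗ Q b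
  Q-+ a b = ≈-trans (coeffwise (go a)) (≈-sym (⊗≈⊛ (Q a) (Q b)))
    where
    go : ∀ a n → Q (a + b) n ≡ (Q a ⊛ Q b) n
    go zero    n       = sym (⊛-identityˡ-at n (Q b))
    go (suc a) zero    = refl
    go (suc a) (suc n) = trans (go a n) (sym (Q-suc-⊛ a (Q b) n))

Q-cancel : ∀ e {f g} → Q e ⊗ f ≈ Q e ⊗ g → f ≈ g
Q-cancel e {f} {g} p = coeffwise λ n → trans (sym (Q-⊗-+ e f n)) (trans (at p (n + e)) (Q-⊗-+ e g n))

-- Arithmetic progressions of coefficients, and dilation

residue : ∀ m .{{_ : NonZero m}} j {r} → r < m → (m * j + r) % m ≡ r
residue m j {r} r<m = trans (cong (_% m) (trans (ℕₚ.+-comm (m * j) r) (cong (r +_) (ℕₚ.*-comm m j))))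
  (trans ([m+kn]%n≡m%n r j m) (m<n⇒m%n≡m r<m))

quotient : ∀ m .{{_ : NonZero m}} j {r} → r < m → (m * j + r) / m ≡ j
quotient m j {r} r<m = begin
  (m * j + r) / m      ≡⟨ cong (_/ m) (trans (ℕₚ.+-comm (m * j) r) (cong (r +_) (ℕₚ.*-comm m j))) ⟩
  (r + j * m) / m      ≡⟨ +-distrib-/-∣ʳ r (divides j refl) ⟩
  r / m + j * m / m    ≡⟨ cong₂ _+_ (m<n⇒m/n≡0 r<m) (m*n/n≡m j m) ⟩
  j                    ∎
  where open ≡-Reasoning

abstract
  -- The operator U_k of modular forms with an offset: for r < k, the r-th component of a
  -- k-dissection.
  U : ℕ → ℕ → PS → PS
  U k r f n = f (k * n + r)

  U-at : ∀ k r f n → U k r f n ≡ f (k * n + r)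
  U-at k r f n = refl

  U-cong : ∀ k r {f g} → f ≈ g → U k r f ≈ U k r g
  U-cong k r p = coeffwise λ n → at p (k * n + r)

  U-⊕ : ∀ k r f g → U k r (f ⊕ g) ≈ U k r f ⊕ U k r g
  U-⊕ k r f g = coeffwise λ n → trans (⊕-at f g (k * n + r)) (sym (⊕-at (U k r f) (U k r g) n))

  U-· : ∀ k r c f → U k r (c · f) ≈ c · U k r f
  U-· k r c f = coeffwise λ n → trans (·-at c f (k * n + r)) (sym (·-at c (U k r f) n))

  U-zeroS : ∀ k r → U k r zeroS ≈ zeroS
  U-zeroS k r = ≈-refl

  dilate : (m : ℕ) → .{{NonZero m}} → PS → PS
  dilate m = dil m

  dilate≈dil : ∀ m .{{_ : NonZero m}} f → dilate m f ≈ dil m f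
  dilate≈dil m f = ≈-refl

  dilate-+ : ∀ m .{{_ : NonZero m}} f j {r} → r < m → dilate m f (m * j + r) ≡ (if r ≡ᵇ 0 then f j else 0ℤ)
  dilate-+ m f j r<m = cong₂ (λ x y → if x ≡ᵇ 0 then f y else 0ℤ) (residue m j r<m) (quotient m j r<m)

  U-dilate-0 : ∀ m .{{_ : NonZero m}} f → U m 0 (dilate m f) ≈ f
  U-dilate-0 m@(suc _) f = coeffwise λ n → dilate-+ m f n (s≤s z≤n)

  U-dilate-suc : ∀ m .{{_ : NonZero m}} f {r} → suc r < m → U m (suc r) (dilate m f) ≈ zeroS
  U-dilate-suc m f r<m = coeffwise λ n → dilate-+ m f n r<m

U-ext : ∀ m .{{_ : NonZero m}} {f g} → (∀ r → r < m → U m r f ≈ U m r g) → f ≈ g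
U-ext m {f} {g} h = coeffwise λ n → begin
  f n                     ≡⟨ cong f (n≡ n) ⟩
  f (m * (n / m) + n % m) ≡⟨ U-at m (n % m) f (n / m) ⟨
  U m (n % m) f (n / m)   ≡⟨ at (h (n % m) (m%n<n n m)) (n / m) ⟩
  U m (n % m) g (n / m)   ≡⟨ U-at m (n % m) g (n / m) ⟩
  g (m * (n / m) + n % m) ≡⟨ cong g (n≡ n) ⟨
  g n                     ∎
  where
  open ≡-Reasoning
  n≡ : ∀ n → n ≡ m * (n / m) + n % m
  n≡ n = trans (m≡m%n+[m/n]*n n m) (trans (ℕₚ.+-comm (n % m) _) (cong (_+ n % m) (ℕₚ.*-comm (n / m) m)))

module _ {m} {h : ℕ → ℤ} (h0 : ∀ j i → i < m → h (suc m * j + suc i) ≡ 0ℤ) where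

  sumTo-block : ∀ j {r} → r ≤ m → sumTo (suc r) (λ i → h (suc m * j + i)) ≡ h (suc m * j)
  sumTo-block j {r} r≤m = trans (sumTo-head r _)
    (trans (cong₂ ℤ._+_ (cong h (ℕₚ.+-identityʳ (suc m * j))) (sumTo-zero r (λ i i<r → h0 j i (ℕₚ.<-≤-trans i<r r≤m))))
      (ℤₚ.+-identityʳ _))

  sumTo-blocks : ∀ n → sumTo (suc m * n) h ≡ sumTo n (λ j → h (suc m * j))
  sumTo-blocks zero rewrite ℕₚ.*-zeroʳ m = refl
  sumTo-blocks (suc n) = begin
    sumTo (suc m * suc n) h
      ≡⟨ cong (λ k → sumTo k h) (trans (ℕₚ.*-suc (suc m) n) (ℕₚ.+-comm (suc m) (suc m * n))) ⟩
    sumTo (suc m * n + suc m) h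
      ≡⟨ sumTo-split (suc m * n) (suc m) h ⟩
    sumTo (suc m * n) h ℤ.+ sumTo (suc m) (λ i → h (suc m * n + i))
      ≡⟨ cong₂ ℤ._+_ (sumTo-blocks n) (sumTo-block n ℕₚ.≤-refl) ⟩
    sumTo n (λ j → h (suc m * j)) ℤ.+ h (suc m * n) ∎
    where open ≡-Reasoning

abstract
  -- Only indices divisible by m contribute to the Cauchy sum. Its range falls into n full blocks of
  -- length m and a last block of length r + 1, and each block keeps just its first term.
  U-dilate-⊗ : ∀ m .{{_ : NonZero m}} f g {r} → r < m → U m r (dilate m f ⊗ g) ≈ f ⊗ U m r g
  U-dilate-⊗ (suc m) f g {r} (s≤s r≤m) = coeffwise λ n → begin
    (dilate (suc m) f ⊗ g) (suc m * n + r)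
      ≡⟨ at (⊗≈⊛ (dilate (suc m) f) g) (suc m * n + r) ⟩
    sumTo (suc (suc m * n + r)) (h n)
      ≡⟨ cong (λ k → sumTo k (h n)) (ℕₚ.+-suc (suc m * n) r) ⟨
    sumTo (suc m * n + suc r) (h n)
      ≡⟨ sumTo-split (suc m * n) (suc r) (h n) ⟩
    sumTo (suc m * n) (h n) ℤ.+ sumTo (suc r) (λ i → h n (suc m * n + i))
      ≡⟨ cong₂ ℤ._+_ (sumTo-blocks {m} {h n} (h0 n) n) (sumTo-block {m} {h n} (h0 n) n r≤m) ⟩
    sumTo (suc n) (λ j → h n (suc m * j))
      ≡⟨ sumTo-cong (suc n) (λ { j (s≤s j≤n) → cong₂ ℤ._*_
           (trans (cong (dilate (suc m) f) (sym (ℕₚ.+-identityʳ (suc m * j)))) (dilate-+ (suc m) f j (s≤s z≤n)))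
           (cong g (index n j j≤n)) }) ⟩
    (f ⊛ U (suc m) r g) n
      ≡⟨ at (⊗≈⊛ f (U (suc m) r g)) n ⟨
    (f ⊗ U (suc m) r g) n ∎
    where
    open ≡-Reasoning
    h : ℕ → ℕ → ℤ
    h n i = dilate (suc m) f i ℤ.* g (suc m * n + r ∸ i)
    h0 : ∀ n j i → i < m → h n (suc m * j + suc i) ≡ 0ℤ
    h0 n j i i<m = cong (λ x → x ℤ.* g (suc m * n + r ∸ (suc m * j + suc i))) (dilate-+ (suc m) f j (s≤s i<m))
    index : ∀ n j → j ≤ n → suc m * n + r ∸ suc m * j ≡ suc m * (n ∸ j) + r
    index n j j≤n = trans (ℕₚ.+-∸-comm r (ℕₚ.*-monoʳ-≤ (suc m) j≤n)) (cong (_+ r) (sym (ℕₚ.*-distribˡ-∸ (suc m) n j)))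

module _ (m : ℕ) .{{_ : NonZero m}} where

  -- A dilation is determined by its components g, 0, ..., 0; the homomorphism properties below are
  -- checked on these, away from `_%_` and `_/_`.
  dilate-ext : ∀ {f g} → U m 0 f ≈ g → (∀ r → suc r < m → U m (suc r) f ≈ zeroS) → f ≈ dilate m g
  dilate-ext {f} {g} h₀ h₁ = U-ext m λ where
    zero    _ → ≈-trans h₀ (≈-sym (U-dilate-0 m g))
    (suc r) p → ≈-trans (h₁ r p) (≈-sym (U-dilate-suc m g p))

  dilate-cong : ∀ {f g} → f ≈ g → dilate m f ≈ dilate m g
  dilate-cong {f} p = dilate-ext (≈-trans (U-dilate-0 m f) p) (λ r → U-dilate-suc m f)

  dilate-⊗ : ∀ f g → dilate m (f ⊗ g) ≈ dilate m f ⊗ dilate m g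
  dilate-⊗ f g = ≈-sym (dilate-ext
    (≈-trans (U-dilate-⊗ m f (dilate m g) m>0) (⊗-cong ≈-refl (U-dilate-0 m g)))
    (λ r p → ≈-trans (U-dilate-⊗ m f (dilate m g) p)
      (≈-trans (⊗-cong ≈-refl (U-dilate-suc m g p)) (⊗-zeroʳ f))))
    where
    m>0 : 0 < m
    m>0 = ℕₚ.n≢0⇒n>0 (ℕ.≢-nonZero⁻¹ m)

  dilate-⊕ : ∀ f g → dilate m (f ⊕ g) ≈ dilate m f ⊕ dilate m g
  dilate-⊕ f g = ≈-sym (dilate-ext
    (≈-trans (U-⊕ m 0 (dilate m f) (dilate m g)) (⊕-cong (U-dilate-0 m f) (U-dilate-0 m g)))
    (λ r p → ≈-trans (U-⊕ m (suc r) (dilate m f) (dilate m g))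
      (≈-trans (⊕-cong (U-dilate-suc m f p) (U-dilate-suc m g p)) (⊕-identityˡ zeroS))))

  dilate-· : ∀ c f → dilate m (c · f) ≈ c · dilate m f
  dilate-· c f = ≈-sym (dilate-ext
    (≈-trans (U-· m 0 c (dilate m f)) (·-cong c (U-dilate-0 m f)))
    (λ r p → ≈-trans (U-· m (suc r) c (dilate m f)) (≈-trans (·-cong c (U-dilate-suc m f p)) (·-zeroS c))))

  dilate-zeroS : dilate m zeroS ≈ zeroS
  dilate-zeroS = ≈-sym (dilate-ext (U-zeroS m 0) (λ r _ → U-zeroS m (suc r)))

  dilate-Q : ∀ e → dilate m (Q e) ≈ Q (m * e)
  dilate-Q e = ≈-sym (dilate-ext
    (coeffwise λ n → trans (U-at m 0 (Q (m * e)) n) (trans (cong (Q (m * e)) (ℕₚ.+-identityʳ (m * n)))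
      (trans (Q-indicator (m * e) (m * n)) (trans (cong (λ b → if b then 1ℤ else 0ℤ) (cancel n)) (sym (Q-indicator e n))))))
    (λ r p → coeffwise λ n → trans (U-at m (suc r) (Q (m * e)) n)
      (trans (Q-indicator (m * e) (m * n + suc r)) (cong (λ b → if b then 1ℤ else 0ℤ) (off n p)))))
    where
    cancel : ∀ n → (m * n ≡ᵇ m * e) ≡ (n ≡ᵇ e)
    cancel n with n ℕₚ.≟ e
    ... | yes refl = trans (≡ᵇ-refl (m * n)) (sym (≡ᵇ-refl n))
    ... | no n≢e = trans (≢⇒≡ᵇ-false (n≢e ∘ ℕₚ.*-cancelˡ-≡ n e m)) (sym (≢⇒≡ᵇ-false n≢e))
    off : ∀ n {r} → suc r < m → (m * n + suc r ≡ᵇ m * e) ≡ false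
    off n {r} p = ≢⇒≡ᵇ-false λ eq → ℕₚ.1+n≢0 (trans (sym (residue m n p))
      (trans (cong (_% m) (trans eq (sym (ℕₚ.+-identityʳ (m * e))))) (residue m e (ℕₚ.<-trans (s≤s z≤n) p))))

  dilate-oneS : dilate m oneS ≈ oneS
  dilate-oneS = ≈-trans (dilate-Q 0) (≡⇒≈ (cong Q (ℕₚ.*-zeroʳ m)))

  dilate-0 : ∀ f → dilate m f 0 ≡ f 0
  dilate-0 f = trans (cong (dilate m f) (sym (trans (ℕₚ.+-identityʳ (m * 0)) (ℕₚ.*-zeroʳ m))))
    (dilate-+ m f 0 (ℕₚ.n≢0⇒n>0 (ℕ.≢-nonZero⁻¹ m)))

  dilate-recip : ∀ {f} → f 0 ≡ 1ℤ → dilate m (recip f) ≈ recip (dilate m f)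
  dilate-recip {f} f0 = ≈-sym (recip-unique (trans (dilate-0 f) f0)
    (≈-trans (≈-sym (dilate-⊗ f (recip f))) (≈-trans (dilate-cong (⊗-recip f0)) dilate-oneS)))

-- The substitution q ↦ -q

σ : ℕ → ℤ
σ zero    = 1ℤ
σ (suc n) = - σ n

σ-+ : ∀ a b → σ (a + b) ≡ σ a ℤ.* σ b
σ-+ zero    b = sym (ℤₚ.*-identityˡ (σ b))
σ-+ (suc a) b = trans (cong -_ (σ-+ a b)) (ℤₚ.neg-distribˡ-* (σ a) (σ b))

σ-even : ∀ m → σ m ≡ 1ℤ → ∀ n → σ (m * n) ≡ 1ℤ
σ-even m e zero    = cong σ (ℕₚ.*-zeroʳ m)
σ-even m e (suc n) = trans (cong σ (ℕₚ.*-suc m n)) (trans (σ-+ m (m * n)) (cong₂ ℤ._*_ e (σ-even m e n)))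

abstract
  sgn : PS → PS
  sgn f n = σ n ℤ.* f n

  sgn-at : ∀ f n → sgn f n ≡ σ n ℤ.* f n
  sgn-at f n = refl

  sgn-cong : ∀ {f g} → f ≈ g → sgn f ≈ sgn g
  sgn-cong p = coeffwise λ n → cong (σ n ℤ.*_) (at p n)

  sgn-⊕ : ∀ f g → sgn (f ⊕ g) ≈ sgn f ⊕ sgn g
  sgn-⊕ f g = coeffwise λ n → trans (cong (σ n ℤ.*_) (⊕-at f g n))
    (trans (ℤₚ.*-distribˡ-+ (σ n) (f n) (g n)) (sym (⊕-at (sgn f) (sgn g) n)))

  sgn-· : ∀ c f → sgn (c · f) ≈ c · sgn f
  sgn-· c f = coeffwise λ n → trans (cong (σ n ℤ.*_) (·-at c f n))
    (trans (lemma (σ n) c (f n)) (sym (·-at c (sgn f) n)))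
    where
    lemma : ∀ a b c → a ℤ.* (b ℤ.* c) ≡ b ℤ.* (a ℤ.* c)
    lemma = ℤR.solve-∀

  sgn-zeroS : sgn zeroS ≈ zeroS
  sgn-zeroS = coeffwise λ n → ℤₚ.*-zeroʳ (σ n)

  sgn-⊗ : ∀ f g → sgn (f ⊗ g) ≈ sgn f ⊗ sgn g
  sgn-⊗ f g = coeffwise λ n → begin
    σ n ℤ.* (f ⊗ g) n
      ≡⟨ cong (σ n ℤ.*_) (at (⊗≈⊛ f g) n) ⟩
    σ n ℤ.* (f ⊛ g) n
      ≡⟨ sumTo-* (suc n) (σ n) (λ i → f i ℤ.* g (n ∸ i)) ⟨
    sumTo (suc n) (λ i → σ n ℤ.* (f i ℤ.* g (n ∸ i)))
      ≡⟨ sumTo-cong (suc n) (λ { i (s≤s i≤n) → trans (cong (ℤ._* (f i ℤ.* g (n ∸ i))) (split n i i≤n))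
           (lemma (σ i) (σ (n ∸ i)) (f i) (g (n ∸ i))) }) ⟩
    (sgn f ⊛ sgn g) n
      ≡⟨ at (⊗≈⊛ (sgn f) (sgn g)) n ⟨
    (sgn f ⊗ sgn g) n ∎
    where
    open ≡-Reasoning
    split : ∀ n i → i ≤ n → σ n ≡ σ i ℤ.* σ (n ∸ i)
    split n i i≤n = trans (cong σ (sym (ℕₚ.m+[n∸m]≡n i≤n))) (σ-+ i (n ∸ i))
    lemma : ∀ a b c d → a ℤ.* b ℤ.* (c ℤ.* d) ≡ a ℤ.* c ℤ.* (b ℤ.* d)
    lemma = ℤR.solve-∀

sgn-Q : ∀ e → sgn (Q e) ≈ σ e · Q e
sgn-Q e = coeffwise λ n → trans (sgn-at (Q e) n) (trans (go n) (sym (·-at (σ e) (Q e) n)))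
  where
  go : ∀ n → σ n ℤ.* Q e n ≡ σ e ℤ.* Q e n
  go n with n ℕₚ.≟ e
  ... | yes refl = refl
  ... | no n≢e rewrite Q-indicator e n | ≢⇒≡ᵇ-false n≢e = trans (ℤₚ.*-zeroʳ (σ n)) (sym (ℤₚ.*-zeroʳ (σ e)))

sgn-oneS : sgn oneS ≈ oneS
sgn-oneS = ≈-trans (sgn-Q 0) (1· oneS)

sgn-0 : ∀ f → sgn f 0 ≡ f 0
sgn-0 f = trans (sgn-at f 0) (ℤₚ.*-identityˡ (f 0))

sgn-recip : ∀ {f} → f 0 ≡ 1ℤ → sgn (recip f) ≈ recip (sgn f)
sgn-recip {f} f0 = ≈-sym (recip-unique (trans (sgn-0 f) f0)
  (≈-trans (≈-sym (sgn-⊗ f (recip f))) (≈-trans (sgn-cong (⊗-recip f0)) sgn-oneS)))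

-- Congruence modulo powers of q

infix 4 _≡[_]_
_≡[_]_ : PS → ℕ → PS → Set
f ≡[ N ] g = ∀ i → i < N → f i ≡ g i

mod-refl : ∀ {N f} → f ≡[ N ] f
mod-refl _ _ = refl

mod-sym : ∀ {N f g} → f ≡[ N ] g → g ≡[ N ] f
mod-sym p i i<N = sym (p i i<N)

mod-trans : ∀ {N f g h} → f ≡[ N ] g → g ≡[ N ] h → f ≡[ N ] h
mod-trans p q i i<N = trans (p i i<N) (q i i<N)

≈⇒mod : ∀ {N f g} → f ≈ g → f ≡[ N ] g
≈⇒mod p i _ = at p i

mod-weaken : ∀ {M N f g} → M ≤ N → f ≡[ N ] g → f ≡[ M ] g
mod-weaken M≤N p i i<M = p i (ℕₚ.<-≤-trans i<M M≤N)

abstract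
  ⊗-mod : ∀ {N f f' g g'} → f ≡[ N ] f' → g ≡[ N ] g' → f ⊗ g ≡[ N ] f' ⊗ g'
  ⊗-mod {N} {f} {f'} {g} {g'} p q n n<N = trans (at (⊗≈⊛ f g) n) (trans
    (sumTo-cong (suc n) (λ { i (s≤s i≤n) → cong₂ ℤ._*_ (p i (ℕₚ.≤-<-trans i≤n n<N)) (q (n ∸ i) (ℕₚ.≤-<-trans (ℕₚ.m∸n≤m n i) n<N)) }))
    (sym (at (⊗≈⊛ f' g') n)))

  ⊗-order : ∀ {A B f g} → f ≡[ A ] zeroS → g ≡[ B ] zeroS → f ⊗ g ≡[ A + B ] zeroS
  ⊗-order {A} {B} {f} {g} p q n n<A+B = trans (at (⊗≈⊛ f g) n) (sumTo-zero (suc n) go)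
    where
    go : ∀ i → i < suc n → f i ℤ.* g (n ∸ i) ≡ 0ℤ
    go i (s≤s i≤n) with ℕₚ.<-≤-connex i A
    ... | inj₁ i<A = cong (ℤ._* g (n ∸ i)) (p i i<A)
    ... | inj₂ A≤i = trans (cong (f i ℤ.*_) (q (n ∸ i) (ℕₚ.+-cancelˡ-< i _ _ (subst (_< i + B) (sym (ℕₚ.m+[n∸m]≡n i≤n))
                       (ℕₚ.<-≤-trans n<A+B (ℕₚ.+-monoˡ-≤ B A≤i)))))) (ℤₚ.*-zeroʳ (f i))

dilate-mod : ∀ m .{{_ : NonZero m}} {N f g} → f ≡[ N ] g → dilate m f ≡[ N ] dilate m g
dilate-mod m {N} {f} {g} p i i<N = trans (at (dilate≈dil m f) i)
  (trans (cong (λ x → if i % m ≡ᵇ 0 then x else 0ℤ) (p (i / m) (ℕₚ.≤-<-trans (m/n≤m i m) i<N))) (sym (at (dilate≈dil m g) i)))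

sgn-mod : ∀ {N f g} → f ≡[ N ] g → sgn f ≡[ N ] sgn g
sgn-mod {N} {f} {g} p i i<N = trans (sgn-at f i) (trans (cong (σ i ℤ.*_) (p i i<N)) (sym (sgn-at g i)))

-- Infinite sums and products; the j-th entry of a family must be trivial modulo q^j.

module Iterated (_∙_ : PS → PS → PS) (ε : PS) (isCM : IsCommutativeMonoid _≈_ _∙_ ε)
  (∙-mod : ∀ {N f f' g g'} → f ≡[ N ] f' → g ≡[ N ] g' → (f ∙ g) ≡[ N ] (f' ∙ g')) where

  open IsCommutativeMonoid isCM using (∙-cong; assoc; comm; identityˡ; identityʳ)

  fold : ℕ → (ℕ → PS) → PS
  fold zero    F = ε
  fold (suc n) F = fold n F ∙ F n

  fold-cong : ∀ n {F G : ℕ → PS} → (∀ j → F j ≈ G j) → fold n F ≈ fold n G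
  fold-cong zero    p = ≈-refl
  fold-cong (suc n) p = ∙-cong (fold-cong n p) (p n)

  interchange : ∀ a b c d → ((a ∙ b) ∙ (c ∙ d)) ≈ ((a ∙ c) ∙ (b ∙ d))
  interchange a b c d = ≈-trans (assoc a b (c ∙ d)) (≈-trans (∙-cong ≈-refl (≈-trans (≈-sym (assoc b c d))
    (≈-trans (∙-cong (comm b c) ≈-refl) (assoc c b d)))) (≈-sym (assoc a c (b ∙ d))))

  fold-∙ : ∀ n F G → (fold n F ∙ fold n G) ≈ fold n (λ j → F j ∙ G j)
  fold-∙ zero    F G = identityˡ ε
  fold-∙ (suc n) F G = ≈-trans (interchange (fold n F) (F n) (fold n G) (G n)) (∙-cong (fold-∙ n F G) ≈-refl)

  fold-+ : ∀ m n F → fold (m + n) F ≈ (fold m F ∙ fold n (λ j → F (m + j)))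
  fold-+ m zero    F = ≈-trans (≡⇒≈ (cong (λ k → fold k F) (ℕₚ.+-identityʳ m))) (≈-sym (identityʳ (fold m F)))
  fold-+ m (suc n) F = ≈-trans (≡⇒≈ (cong (λ k → fold k F) (ℕₚ.+-suc m n)))
    (≈-trans (∙-cong (fold-+ m n F) ≈-refl) (assoc (fold m F) (fold n (λ j → F (m + j))) (F (m + n))))

  fold-head : ∀ n F → fold (suc n) F ≈ (F 0 ∙ fold n (F ∘ suc))
  fold-head n F = ≈-trans (fold-+ 1 n F) (∙-cong (identityˡ (F 0)) ≈-refl)

  fold-group : ∀ d n F → fold (d * n) F ≈ fold n (λ j → fold d (λ i → F (d * j + i)))
  fold-group d zero    F = ≡⇒≈ (cong (λ k → fold k F) (ℕₚ.*-zeroʳ d))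
  fold-group d (suc n) F = ≈-trans (≡⇒≈ (cong (λ k → fold k F) (trans (ℕₚ.*-suc d n) (ℕₚ.+-comm d (d * n)))))
    (≈-trans (fold-+ (d * n) d F) (∙-cong (fold-group d n F) ≈-refl))

  fold-hom : ∀ (φ : PS → PS) → φ ε ≈ ε → (∀ f g → φ (f ∙ g) ≈ (φ f ∙ φ g)) → ∀ n F → φ (fold n F) ≈ fold n (φ ∘ F)
  fold-hom φ φ-ε φ-∙ zero    F = φ-ε
  fold-hom φ φ-ε φ-∙ (suc n) F = ≈-trans (φ-∙ (fold n F) (F n)) (∙-cong (fold-hom φ φ-ε φ-∙ n F) ≈-refl)

  Convergent : (ℕ → PS) → Set
  Convergent F = ∀ j → F j ≡[ j ] ε

  fold-stable : ∀ {F} → Convergent F → ∀ n k → fold (n + k) F ≡[ n ] fold n F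
  fold-stable {F} u n zero    = ≈⇒mod (≡⇒≈ (cong (λ k → fold k F) (ℕₚ.+-identityʳ n)))
  fold-stable {F} u n (suc k) = mod-trans (≈⇒mod (≡⇒≈ (cong (λ k → fold k F) (ℕₚ.+-suc n k))))
    (mod-trans (∙-mod (fold-stable u n k) (mod-weaken (ℕₚ.m≤m+n n k) (u (n + k)))) (≈⇒mod (identityʳ (fold n F))))

  abstract
    -- For a convergent family the entries after the n-th are trivial modulo q^(n+1). The cut is the
    -- one made by `poch`, so `poch≈pochS` needs no limit.
    fold∞ : (ℕ → PS) → PS
    fold∞ F n = fold (suc n) F n

    fold∞-at : ∀ F n → fold∞ F n ≡ fold (suc n) F n
    fold∞-at F n = refl

  fold∞-mod : ∀ {F} → Convergent F → ∀ N → fold∞ F ≡[ N ] fold N F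
  fold∞-mod {F} u N i i<N with ℕₚ.m≤n⇒∃[o]m+o≡n i<N
  ... | o , refl = trans (fold∞-at F i) (sym (fold-stable u (suc i) o i ℕₚ.≤-refl))

  -- Limits are identified by comparison with partial results modulo q^N, which reduces the laws
  -- below to their finite versions.
  fold∞-unique : ∀ {F f} → Convergent F → (∀ N → f ≡[ N ] fold N F) → f ≈ fold∞ F
  fold∞-unique u p = coeffwise λ n → trans (p (suc n) n ℕₚ.≤-refl) (sym (fold∞-mod u (suc n) n ℕₚ.≤-refl))

  Convergent-∙ : ∀ {F G} → Convergent F → Convergent G → Convergent (λ j → F j ∙ G j)
  Convergent-∙ u v j = mod-trans (∙-mod (u j) (v j)) (≈⇒mod (identityˡ ε))

  Convergent-fold : ∀ d {G : ℕ → ℕ → PS} → (∀ i → Convergent (G i)) → Convergent (λ j → fold d (λ i → G i j))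
  Convergent-fold zero    u = λ _ → mod-refl
  Convergent-fold (suc d) u = Convergent-∙ (Convergent-fold d u) (u d)

  fold∞-cong : ∀ {F G} → (∀ j → F j ≈ G j) → fold∞ F ≈ fold∞ G
  fold∞-cong {F} {G} p = coeffwise λ n → trans (fold∞-at F n) (trans (at (fold-cong (suc n) p) n) (sym (fold∞-at G n)))

  fold∞-∙ : ∀ {F G} → Convergent F → Convergent G → (fold∞ F ∙ fold∞ G) ≈ fold∞ (λ j → F j ∙ G j)
  fold∞-∙ {F} {G} u v = fold∞-unique (Convergent-∙ u v) λ N →
    mod-trans (∙-mod (fold∞-mod u N) (fold∞-mod v N)) (≈⇒mod (fold-∙ N F G))

  fold∞-ε : fold∞ (λ _ → ε) ≈ ε
  fold∞-ε = ≈-sym (fold∞-unique (λ _ → mod-refl) λ N → ≈⇒mod (≈-sym (go N)))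
    where
    go : ∀ N → fold N (λ _ → ε) ≈ ε
    go zero    = ≈-refl
    go (suc N) = ≈-trans (identityʳ _) (go N)

  fold∞-fold : ∀ d {G : ℕ → ℕ → PS} → (∀ i → Convergent (G i)) → fold∞ (λ j → fold d (λ i → G i j)) ≈ fold d (λ i → fold∞ (G i))
  fold∞-fold zero    u = fold∞-ε
  fold∞-fold (suc d) u = ≈-trans (≈-sym (fold∞-∙ (Convergent-fold d u) (u d))) (∙-cong (fold∞-fold d u) ≈-refl)

  -- The partial result over d N entries is at least as precise as the one over N entries, and it
  -- regroups exactly into N blocks of d.
  fold∞-split : ∀ d .{{_ : NonZero d}} {F} → Convergent F → fold∞ F ≈ fold d (λ i → fold∞ (λ j → F (d * j + i)))
  fold∞-split d {F} u = ≈-trans (fold∞-unique (Convergent-fold d u') grouped) (fold∞-fold d u')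
    where
    u' : ∀ i → Convergent (λ j → F (d * j + i))
    u' i j = mod-weaken (ℕₚ.≤-trans (ℕₚ.m≤n*m j d) (ℕₚ.m≤m+n (d * j) i)) (u (d * j + i))
    grouped : ∀ N → fold∞ F ≡[ N ] fold N (λ j → fold d (λ i → F (d * j + i)))
    grouped N = mod-trans (mod-weaken (ℕₚ.m≤n*m N d) (fold∞-mod u (d * N))) (≈⇒mod (fold-group d N F))

  fold∞-hom : ∀ (φ : PS → PS) → φ ε ≈ ε → (∀ f g → φ (f ∙ g) ≈ (φ f ∙ φ g)) →
    (∀ {N f g} → f ≡[ N ] g → φ f ≡[ N ] φ g) → ∀ {F} → Convergent F → φ (fold∞ F) ≈ fold∞ (φ ∘ F)
  fold∞-hom φ φ-ε φ-∙ φ-mod {F} u = fold∞-unique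
    (λ j → mod-trans (φ-mod (u j)) (≈⇒mod φ-ε))
    λ N → mod-trans (φ-mod (fold∞-mod u N)) (≈⇒mod (fold-hom φ φ-ε φ-∙ N F))

⊕-mod : ∀ {N f f' g g'} → f ≡[ N ] f' → g ≡[ N ] g' → f ⊕ g ≡[ N ] f' ⊕ g'
⊕-mod {f = f} {f'} {g} {g'} p q i i<N = trans (⊕-at f g i) (trans (cong₂ ℤ._+_ (p i i<N) (q i i<N)) (sym (⊕-at f' g' i)))

module Product = Iterated _⊗_ oneS *-isCommutativeMonoid ⊗-mod
module Sum     = Iterated _⊕_ zeroS +-isCommutativeMonoid ⊕-mod

open Product using () renaming (fold to ∏; fold∞ to ∏∞; Convergent to Unital)
open Sum using () renaming (fold to ∑; fold∞ to ∑∞; Convergent to Summable)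

-- Signed q-Pochhammer symbols (-c q^a ; q^b)_∞

factor : ℤ → ℕ → PS
factor c e = oneS ⊕ c · Q e

factor-mod : ∀ c e → factor c e ≡[ e ] oneS
factor-mod c e i i<e = trans (⊕-at oneS (c · Q e) i) (trans (cong (λ x → oneS i ℤ.+ x)
  (trans (·-at c (Q e) i) (trans (cong (c ℤ.*_) (Q-off-diag e i i<e)) (ℤₚ.*-zeroʳ c)))) (ℤₚ.+-identityʳ (oneS i)))

pochS : ℤ → ℕ → ℕ → PS
pochS c a b = ∏∞ (λ j → factor c (a + b * j))

module _ (c : ℤ) (a b : ℕ) .{{_ : NonZero a}} .{{_ : NonZero b}} where

  Unital-factor : Unital (λ j → factor c (a + b * j))
  Unital-factor j = mod-weaken (ℕₚ.≤-trans (ℕₚ.m≤n*m j b) (ℕₚ.m≤n+m (b * j) a)) (factor-mod c (a + b * j))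

  pochS-0 : pochS c a b 0 ≡ 1ℤ
  pochS-0 = trans (Product.fold∞-mod Unital-factor 1 0 (s≤s z≤n)) (trans (at (⊗-identityˡ (factor c (a + b * 0))) 0) (factor-mod c (a + b * 0) 0 (ℕₚ.<-≤-trans (ℕₚ.n≢0⇒n>0 (ℕ.≢-nonZero⁻¹ a)) (ℕₚ.m≤m+n a (b * 0)))))

  pochS-split : ∀ d .{{_ : NonZero d}} → pochS c a b ≈ ∏ d (λ i → pochS c (a + b * i) (d * b))
  pochS-split d = ≈-trans (Product.fold∞-split d Unital-factor) (Product.fold-cong d λ i → Product.fold∞-cong λ j → ≡⇒≈ (cong (factor c) (lemma a b d i j)))
    where
    lemma : ∀ a b d i j → a + b * (d * j + i) ≡ a + b * i + d * b * j
    lemma = ℕR.solve-∀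

  dilate-pochS : ∀ m .{{_ : NonZero m}} → dilate m (pochS c a b) ≈ pochS c (m * a) (m * b)
  dilate-pochS m = ≈-trans
    (Product.fold∞-hom (dilate m) (dilate-oneS m) (dilate-⊗ m) (dilate-mod m) Unital-factor)
    (Product.fold∞-cong λ j → ≈-trans (dilate-⊕ m oneS (c · Q (a + b * j))) (⊕-cong (dilate-oneS m)
      (≈-trans (dilate-· m c (Q (a + b * j))) (·-cong c (≈-trans (dilate-Q m (a + b * j)) (≡⇒≈ (cong Q (lemma m a b j))))))))
    where
    lemma : ∀ m a b j → m * (a + b * j) ≡ m * a + m * b * j
    lemma = ℕR.solve-∀

  sgn-pochS : σ b ≡ 1ℤ → sgn (pochS c a b) ≈ pochS (c ℤ.* σ a) a b
  sgn-pochS e = ≈-trans (Product.fold∞-hom sgn sgn-oneS sgn-⊗ sgn-mod Unital-factor)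
    (Product.fold∞-cong λ j → ≈-trans (sgn-⊕ oneS (c · Q (a + b * j))) (⊕-cong sgn-oneS
      (≈-trans (sgn-· c (Q (a + b * j))) (≈-trans (·-cong c (≈-trans (sgn-Q (a + b * j)) (≡⇒≈ (cong (_· Q (a + b * j)) (sign j)))))
        (·-· c (σ a) (Q (a + b * j)))))))
    where
    sign : ∀ j → σ (a + b * j) ≡ σ a
    sign j = trans (σ-+ a (b * j)) (trans (cong (σ a ℤ.*_) (σ-even b e j)) (ℤₚ.*-identityʳ (σ a)))

-- Factor by factor this is (1 + x)(1 - x) = 1 - x². It is the means of eliminating products with
-- plus signs in favour of the symbols.
pochS-± : ∀ a b .{{_ : NonZero a}} .{{_ : NonZero b}} → pochS 1ℤ a b ⊗ pochS -1ℤ a b ≈ pochS -1ℤ (2 * a) (2 * b)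
pochS-± a b = ≈-trans (Product.fold∞-∙ (Unital-factor 1ℤ a b) (Unital-factor -1ℤ a b)) (Product.fold∞-cong λ j → begin
  factor 1ℤ (a + b * j) ⊗ factor -1ℤ (a + b * j)
    ≈⟨ ⊗-cong (⊕-cong ≈-refl (1· _)) (⊕-cong ≈-refl (≈-trans (·-⊖ 1ℤ _) (⊖-cong (1· _)))) ⟩
  (oneS ⊕ Q (a + b * j)) ⊗ (oneS ⊕ ⊖ Q (a + b * j))
    ≈⟨ solve 1 (λ x → (con 1ℤ :+ x) :* (con 1ℤ :+ :- x) := con 1ℤ :+ :- (x :* x)) ≈-refl (Q (a + b * j)) ⟩
  oneS ⊕ ⊖ (Q (a + b * j) ⊗ Q (a + b * j))
    ≈⟨ ⊕-cong ≈-refl (⊖-cong (Q-+ (a + b * j) (a + b * j))) ⟨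
  oneS ⊕ ⊖ Q (a + b * j + (a + b * j))
    ≈⟨ ⊕-cong ≈-refl (≈-trans (·-⊖ 1ℤ _) (⊖-cong (1· _))) ⟨
  factor -1ℤ (a + b * j + (a + b * j))
    ≈⟨ ≡⇒≈ (cong (factor -1ℤ) (lemma a b j)) ⟩
  factor -1ℤ (2 * a + 2 * b * j) ∎)
  where
  open ≈-Reasoning
  lemma : ∀ a b j → a + b * j + (a + b * j) ≡ 2 * a + 2 * b * j
  lemma = ℕR.solve-∀

prodTo≈∏ : ∀ n F → prodTo n F ≈ ∏ n F
prodTo≈∏ zero    F = ≈-refl
prodTo≈∏ (suc n) F = ≈-trans (≈-sym (⊗≈⊛ (prodTo n F) (F n))) (⊗-cong (prodTo≈∏ n F) ≈-refl)

oneMinusQ≈factor : ∀ e → oneMinusQ e ≈ factor -1ℤ e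
oneMinusQ≈factor e = coeffwise λ n → sym (trans (⊕-at oneS (-1ℤ · Q e) n) (cong (λ x → oneS n ℤ.+ x)
  (trans (·-at -1ℤ (Q e) n) (trans (cong (-1ℤ ℤ.*_) (Q-indicator e n)) (ℤₚ.-1*i≡-i _)))))

poch≈pochS : ∀ a b → poch a b ≈ pochS -1ℤ a b
poch≈pochS a b = coeffwise λ n → trans (at (prodTo≈∏ (suc n) (λ j → oneMinusQ (a + b * j))) n)
  (trans (at (Product.fold-cong (suc n) (λ j → oneMinusQ≈factor (a + b * j))) n) (sym (Product.fold∞-at (λ j → factor -1ℤ (a + b * j)) n)))

-- The Jacobi triple product

-- A sum over k + i = N. Carrying both lower indices of a Gaussian binomial avoids truncated
-- subtraction.
diagonal : ℕ → (ℕ → ℕ → PS) → PS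
diagonal zero    F = F 0 0
diagonal (suc N) F = F 0 (suc N) ⊕ diagonal N (λ k i → F (suc k) i)

diagonal-cong : ∀ N {F G} → (∀ k i → k + i ≡ N → F k i ≈ G k i) → diagonal N F ≈ diagonal N G
diagonal-cong zero    p = p 0 0 refl
diagonal-cong (suc N) p = ⊕-cong (p 0 (suc N) refl) (diagonal-cong N (λ k i e → p (suc k) i (cong suc e)))

diagonal-mod : ∀ {M} N {F G} → (∀ k i → k + i ≡ N → F k i ≡[ M ] G k i) → diagonal N F ≡[ M ] diagonal N G
diagonal-mod zero    p = p 0 0 refl
diagonal-mod (suc N) p = ⊕-mod (p 0 (suc N) refl) (diagonal-mod N (λ k i e → p (suc k) i (cong suc e)))

diagonal-⊕ : ∀ N F G → diagonal N (λ k i → F k i ⊕ G k i) ≈ diagonal N F ⊕ diagonal N G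
diagonal-⊕ zero    F G = ≈-refl
diagonal-⊕ (suc N) F G = ≈-trans (⊕-cong ≈-refl (diagonal-⊕ N (F ∘ suc) (G ∘ suc)))
  (Sum.interchange (F 0 (suc N)) (G 0 (suc N)) (diagonal N (F ∘ suc)) (diagonal N (G ∘ suc)))

diagonal-⊗ : ∀ N c F → c ⊗ diagonal N F ≈ diagonal N (λ k i → c ⊗ F k i)
diagonal-⊗ zero    c F = ≈-refl
diagonal-⊗ (suc N) c F = ≈-trans (⊗-distribˡ c (F 0 (suc N)) (diagonal N (F ∘ suc))) (⊕-cong ≈-refl (diagonal-⊗ N c (F ∘ suc)))

diagonal-const : ∀ N h → diagonal N (λ k _ → h k) ≈ ∑ (suc N) h
diagonal-const zero    h = ≈-sym (⊕-identityˡ (h 0))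
diagonal-const (suc N) h = ≈-trans (⊕-cong ≈-refl (diagonal-const N (h ∘ suc))) (≈-sym (Sum.fold-head (suc N) h))

shiftˡ shiftʳ : (ℕ → ℕ → PS) → ℕ → ℕ → PS
shiftˡ F zero    i = zeroS
shiftˡ F (suc k) i = F k i
shiftʳ F k zero    = zeroS
shiftʳ F k (suc i) = F k i

diagonal-shiftˡ : ∀ N F → diagonal (suc N) (shiftˡ F) ≈ diagonal N F
diagonal-shiftˡ N F = ⊕-identityˡ (diagonal N F)

diagonal-shiftʳ : ∀ N F → diagonal (suc N) (shiftʳ F) ≈ diagonal N F
diagonal-shiftʳ zero    F = ⊕-identityʳ (F 0 0)
diagonal-shiftʳ (suc N) F = ⊕-cong ≈-refl (≈-trans
  (diagonal-cong (suc N) {λ k i → shiftʳ F (suc k) i} {shiftʳ (F ∘ suc)} λ { k zero _ → ≈-refl ; k (suc i) _ → ≈-refl })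
  (diagonal-shiftʳ N (F ∘ suc)))

-- F is G shifted in i plus H shifted in k; at the two ends of the diagonal only one of the
-- neighbours exists.
diagonal-pascal : ∀ N {F G H} → F 0 (suc N) ≈ G 0 N → F (suc N) 0 ≈ H N 0 →
  (∀ k i → suc (k + i) ≡ N → F (suc k) (suc i) ≈ G (suc k) i ⊕ H k (suc i)) →
  diagonal (suc N) F ≈ diagonal N G ⊕ diagonal N H
diagonal-pascal N {F} {G} {H} left right inner = ≈-trans (diagonal-cong (suc N) split)
  (≈-trans (diagonal-⊕ (suc N) (shiftʳ G) (shiftˡ H)) (⊕-cong (diagonal-shiftʳ N G) (diagonal-shiftˡ N H)))
  where
  split : ∀ k i → k + i ≡ suc N → F k i ≈ shiftʳ G k i ⊕ shiftˡ H k i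
  split zero    (suc i) refl = ≈-trans left (≈-sym (⊕-identityʳ (G 0 i)))
  split (suc k) zero    e with trans (sym (ℕₚ.+-identityʳ k)) (ℕₚ.suc-injective e)
  ... | refl = ≈-trans right (≈-sym (⊕-identityˡ (H k 0)))
  split (suc k) (suc i) e = inner k i (trans (sym (ℕₚ.+-suc k i)) (ℕₚ.suc-injective e))

infixr 8 _^^_
_^^_ : PS → ℕ → PS
f ^^ zero  = oneS
f ^^ suc n = f ^^ n ⊗ f

^^-+ : ∀ f m n → f ^^ (m + n) ≈ f ^^ m ⊗ f ^^ n
^^-+ f m zero    = ≈-trans (≡⇒≈ (cong (f ^^_) (ℕₚ.+-identityʳ m))) (≈-sym (⊗-identityʳ (f ^^ m)))
^^-+ f m (suc n) = ≈-trans (≡⇒≈ (cong (f ^^_) (ℕₚ.+-suc m n)))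
  (≈-trans (⊗-cong (^^-+ f m n) ≈-refl) (⊗-assoc (f ^^ m) (f ^^ n) f))

≡0⇒1⊖-unit : ∀ {f} → f 0 ≡ 0ℤ → (oneS ⊕ ⊖ f) 0 ≡ 1ℤ
≡0⇒1⊖-unit {f} e = trans (⊕-at oneS (⊖ f) 0) (cong (λ x → 1ℤ ℤ.+ x) (trans (⊖-at f 0) (cong -_ e)))

-- Ramanujan's general theta function f(a, b). Since a b = p, the terms of negative index are
-- written with b, and no series of positive order has to be inverted.
module TripleProduct (a b p : PS) (ab≈p : a ⊗ b ≈ p) (a0 : a 0 ≡ 0ℤ) (b0 : b 0 ≡ 0ℤ) where

  p0 : p 0 ≡ 0ℤ
  p0 = trans (sym (at ab≈p 0)) (trans (⊗-0 a b) (cong (ℤ._* b 0) a0))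

  p-factor : ℕ → PS
  p-factor j = oneS ⊕ ⊖ (p ^^ suc j)

  P : ℕ → PS
  P n = ∏ n p-factor

  P-0 : ∀ n → P n 0 ≡ 1ℤ
  P-0 zero    = refl
  P-0 (suc n) = ⊗-unit {P n} (P-0 n) (≡0⇒1⊖-unit {p ^^ suc n}
    (trans (⊗-0 (p ^^ n) p) (trans (cong ((p ^^ n) 0 ℤ.*_) p0) (ℤₚ.*-zeroʳ ((p ^^ n) 0)))))

  PP-0 : ∀ k i → (P k ⊗ P i) 0 ≡ 1ℤ
  PP-0 k i = ⊗-unit {P k} (P-0 k) (P-0 i)

  -- The Gaussian binomial coefficient of k + i over k in base p.
  gauss : ℕ → ℕ → PS
  gauss k i = P (k + i) ⊗ recip (P k ⊗ P i)

  gauss-spec : ∀ k i → P k ⊗ P i ⊗ gauss k i ≈ P (k + i)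
  gauss-spec k i = ≈-trans (solve 3 (λ x y z → x :* (y :* z) := y :* (x :* z)) ≈-refl (P k ⊗ P i) (P (k + i)) (recip (P k ⊗ P i)))
    (≈-trans (⊗-cong ≈-refl (⊗-recip (PP-0 k i))) (⊗-identityʳ (P (k + i))))

  gauss-unique : ∀ k i {f} → P k ⊗ P i ⊗ f ≈ P (k + i) → gauss k i ≈ f
  gauss-unique k i e = ⊗-cancelˡ (PP-0 k i) (≈-trans (gauss-spec k i) (≈-sym e))

  gauss-0ˡ : ∀ i → gauss 0 i ≈ oneS
  gauss-0ˡ i = gauss-unique 0 i (solve 1 (λ x → con 1ℤ :* x :* con 1ℤ := x) ≈-refl (P i))

  gauss-sym : ∀ k i → gauss k i ≈ gauss i k
  gauss-sym k i = gauss-unique k i (≈-trans (⊗-cong (⊗-comm (P k) (P i)) ≈-refl)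
    (≈-trans (gauss-spec i k) (≡⇒≈ (cong P (ℕₚ.+-comm i k)))))

  gauss-0ʳ : ∀ k → gauss k 0 ≈ oneS
  gauss-0ʳ k = ≈-trans (gauss-sym k 0) (gauss-0ˡ k)

  -- With denominators cleared, it is (1 - y) + y (1 - x) = 1 - x y for x = p^(k+1) and y = p^(i+1).
  gauss-pascal : ∀ k i → gauss (suc k) (suc i) ≈ gauss (suc k) i ⊕ p ^^ suc i ⊗ gauss k (suc i)
  gauss-pascal k i = gauss-unique (suc k) (suc i) (begin
    P (suc k) ⊗ P (suc i) ⊗ (gauss (suc k) i ⊕ y ⊗ gauss k (suc i))
      ≈⟨ solve 7 (λ a x b y o g h → a :* (o :+ x) :* (b :* (o :+ :- y)) :* (g :+ y :* h)
           := (o :+ :- y) :* (a :* (o :+ x) :* b :* g) :+ y :* (o :+ x) :* (a :* (b :* (o :+ :- y)) :* h))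
         ≈-refl (P k) (⊖ x) (P i) y oneS (gauss (suc k) i) (gauss k (suc i)) ⟩
    (oneS ⊕ ⊖ y) ⊗ (P (suc k) ⊗ P i ⊗ gauss (suc k) i) ⊕ y ⊗ (oneS ⊕ ⊖ x) ⊗ (P k ⊗ P (suc i) ⊗ gauss k (suc i))
      ≈⟨ ⊕-cong (⊗-cong ≈-refl (≈-trans (gauss-spec (suc k) i) (≡⇒≈ (cong P (sym (ℕₚ.+-suc k i))))))
                (⊗-cong ≈-refl (gauss-spec k (suc i))) ⟩
    (oneS ⊕ ⊖ y) ⊗ Z ⊕ y ⊗ (oneS ⊕ ⊖ x) ⊗ Z
      ≈⟨ solve 3 (λ x y z → (con 1ℤ :+ :- y) :* z :+ y :* (con 1ℤ :+ :- x) :* z := z :* (con 1ℤ :+ :- (x :* y))) ≈-refl x y Z ⟩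
    Z ⊗ (oneS ⊕ ⊖ (x ⊗ y))
      ≈⟨ ⊗-cong ≈-refl (⊕-cong ≈-refl (⊖-cong (^^-+ p (suc k) (suc i)))) ⟨
    Z ⊗ (oneS ⊕ ⊖ (p ^^ suc (k + suc i))) ∎)
    where
    open ≈-Reasoning
    x y Z : PS
    x = p ^^ suc k
    y = p ^^ suc i
    Z = P (k + suc i)

  gauss-pascal′ : ∀ k i → gauss (suc k) (suc i) ≈ p ^^ suc k ⊗ gauss (suc k) i ⊕ gauss k (suc i)
  gauss-pascal′ k i = ≈-trans (gauss-sym (suc k) (suc i)) (≈-trans (gauss-pascal i k)
    (≈-trans (⊕-comm _ _) (⊕-cong (⊗-cong ≈-refl (gauss-sym i (suc k))) (gauss-sym (suc i) k))))

  -- x^k p^(k(k-1)/2)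
  power : PS → ℕ → PS
  power x zero    = oneS
  power x (suc k) = power x k ⊗ (x ⊗ p ^^ k)

  -- The term of index k - n of the bilateral theta series
  term : ℕ → ℕ → PS
  term zero    k       = power a k
  term (suc n) zero    = power b (suc n)
  term (suc n) (suc k) = term n k

  term-0 : ∀ n → term n 0 ≈ power b n
  term-0 zero    = ≈-refl
  term-0 (suc n) = ≈-refl

  -- Consecutive terms have ratio a p^(k-n), and k - n = m - i on the diagonal. Multiplying by p^i
  -- keeps every exponent natural.
  term-a : ∀ m n k i → k + i ≡ m + n → term n k ⊗ (a ⊗ p ^^ m) ≈ p ^^ i ⊗ term n (suc k)
  term-a m zero    k i e = ≈-trans (⊗-cong ≈-refl (⊗-cong ≈-refl
      (≈-trans (≡⇒≈ (cong (p ^^_) (trans (sym (ℕₚ.+-identityʳ m)) (trans (sym e) (ℕₚ.+-comm k i))))) (^^-+ p i k))))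
    (solve 4 (λ v a x y → v :* (a :* (x :* y)) := x :* (v :* (a :* y))) ≈-refl (power a k) a (p ^^ i) (p ^^ k))
  term-a m (suc n) (suc k) i e = term-a m n k i (ℕₚ.suc-injective (trans e (ℕₚ.+-suc m n)))
  term-a m (suc n) zero    i refl = begin
    power b n ⊗ (b ⊗ p ^^ n) ⊗ (a ⊗ p ^^ m)
      ≈⟨ solve 5 (λ v b x a y → v :* (b :* x) :* (a :* y) := y :* (x :* (a :* b)) :* v) ≈-refl (power b n) b (p ^^ n) a (p ^^ m) ⟩
    p ^^ m ⊗ (p ^^ n ⊗ (a ⊗ b)) ⊗ power b n
      ≈⟨ ⊗-cong (⊗-cong ≈-refl (⊗-cong ≈-refl ab≈p)) (≈-sym (term-0 n)) ⟩
    p ^^ m ⊗ p ^^ suc n ⊗ term n 0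
      ≈⟨ ⊗-cong (^^-+ p m (suc n)) ≈-refl ⟨
    p ^^ (m + suc n) ⊗ term n 0 ∎
    where open ≈-Reasoning

  term-b : ∀ n k i → suc (k + i) ≡ n → term n (suc k) ⊗ (b ⊗ p ^^ n) ≈ p ^^ suc k ⊗ term n k
  term-b (suc n) zero    i e = ≈-trans (⊗-cong (term-0 n) ≈-refl)
    (solve 4 (λ v b x y → v :* (b :* (x :* y)) := con 1ℤ :* y :* (v :* (b :* x))) ≈-refl (power b n) b (p ^^ n) p)
  term-b (suc n) (suc k) i e = ≈-trans
    (solve 4 (λ v b x y → v :* (b :* (x :* y)) := v :* (b :* x) :* y) ≈-refl (term n (suc k)) b (p ^^ n) p)
    (≈-trans (⊗-cong (term-b n k i (ℕₚ.suc-injective e)) ≈-refl)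
      (solve 4 (λ x y v z → x :* y :* v :* z := x :* y :* z :* v) ≈-refl (p ^^ k) p (term n k) p))

  A-factor B-factor : ℕ → PS
  A-factor j = oneS ⊕ a ⊗ p ^^ j
  B-factor j = oneS ⊕ b ⊗ p ^^ j

  finite-b : ∀ n → ∏ n B-factor ≈ diagonal n (λ k i → gauss k i ⊗ term n k)
  finite-b zero    = ≈-sym (≈-trans (⊗-identityʳ (gauss 0 0)) (gauss-0ˡ 0))
  finite-b (suc n) = ≈-sym (begin
    diagonal (suc n) F
      ≈⟨ diagonal-pascal n {F} {λ k i → x ⊗ F′ k i} {F′} left right inner ⟩
    diagonal n (λ k i → x ⊗ F′ k i) ⊕ diagonal n F′
      ≈⟨ ⊕-cong (diagonal-⊗ n x F′) ≈-refl ⟨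
    x ⊗ diagonal n F′ ⊕ diagonal n F′
      ≈⟨ ⊕-cong (⊗-cong ≈-refl (finite-b n)) (finite-b n) ⟨
    x ⊗ ∏ n B-factor ⊕ ∏ n B-factor
      ≈⟨ solve 2 (λ x y → x :* y :+ y := y :* (con 1ℤ :+ x)) ≈-refl x (∏ n B-factor) ⟩
    ∏ n B-factor ⊗ (oneS ⊕ x) ∎)
    where
    open ≈-Reasoning
    x : PS
    x = b ⊗ p ^^ n
    F F′ : ℕ → ℕ → PS
    F k i = gauss k i ⊗ term (suc n) k
    F′ k i = gauss k i ⊗ term n k
    left : F 0 (suc n) ≈ x ⊗ F′ 0 n
    left = ≈-trans (⊗-cong (gauss-0ˡ (suc n)) ≈-refl) (≈-trans (solve 3 (λ o v x → o :* (v :* x) := x :* (o :* v)) ≈-refl oneS (power b n) x)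
      (⊗-cong ≈-refl (⊗-cong (≈-sym (gauss-0ˡ n)) (≈-sym (term-0 n)))))
    right : F (suc n) 0 ≈ F′ n 0
    right = ⊗-cong (≈-trans (gauss-0ʳ (suc n)) (≈-sym (gauss-0ʳ n))) ≈-refl
    inner : ∀ k i → suc (k + i) ≡ n → F (suc k) (suc i) ≈ x ⊗ F′ (suc k) i ⊕ F′ k (suc i)
    inner k i e = begin
      gauss (suc k) (suc i) ⊗ term n k
        ≈⟨ ⊗-cong (gauss-pascal′ k i) ≈-refl ⟩
      (p ^^ suc k ⊗ gauss (suc k) i ⊕ gauss k (suc i)) ⊗ term n k
        ≈⟨ solve 4 (λ y g h t → (y :* g :+ h) :* t := g :* (y :* t) :+ h :* t) ≈-refl (p ^^ suc k) (gauss (suc k) i) (gauss k (suc i)) (term n k) ⟩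
      gauss (suc k) i ⊗ (p ^^ suc k ⊗ term n k) ⊕ F′ k (suc i)
        ≈⟨ ⊕-cong (⊗-cong ≈-refl (term-b n k i e)) ≈-refl ⟨
      gauss (suc k) i ⊗ (term n (suc k) ⊗ x) ⊕ F′ k (suc i)
        ≈⟨ ⊕-cong (solve 3 (λ g t x → g :* (t :* x) := x :* (g :* t)) ≈-refl (gauss (suc k) i) (term n (suc k)) x) ≈-refl ⟩
      x ⊗ F′ (suc k) i ⊕ F′ k (suc i) ∎

  -- The finite form of the triple product, a version of the q-binomial theorem. A factor in b moves
  -- the origin of `term` and uses `gauss-pascal′`; a factor in a leaves it in place and uses
  -- `gauss-pascal`.
  finite : ∀ m n → ∏ n B-factor ⊗ ∏ m A-factor ≈ diagonal (m + n) (λ k i → gauss k i ⊗ term n k)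
  finite zero    n = ≈-trans (⊗-identityʳ (∏ n B-factor)) (finite-b n)
  finite (suc m) n = ≈-sym (begin
    diagonal (suc (m + n)) F
      ≈⟨ diagonal-pascal (m + n) {F} {F} {λ k i → x ⊗ F k i} left right inner ⟩
    diagonal (m + n) F ⊕ diagonal (m + n) (λ k i → x ⊗ F k i)
      ≈⟨ ⊕-cong ≈-refl (diagonal-⊗ (m + n) x F) ⟨
    diagonal (m + n) F ⊕ x ⊗ diagonal (m + n) F
      ≈⟨ ⊕-cong (finite m n) (⊗-cong ≈-refl (finite m n)) ⟨
    ∏ n B-factor ⊗ ∏ m A-factor ⊕ x ⊗ (∏ n B-factor ⊗ ∏ m A-factor)
      ≈⟨ solve 3 (λ x y z → y :* z :+ x :* (y :* z) := y :* (z :* (con 1ℤ :+ x))) ≈-refl x (∏ n B-factor) (∏ m A-factor) ⟩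
    ∏ n B-factor ⊗ (∏ m A-factor ⊗ (oneS ⊕ x)) ∎)
    where
    open ≈-Reasoning
    x : PS
    x = a ⊗ p ^^ m
    F : ℕ → ℕ → PS
    F k i = gauss k i ⊗ term n k
    left : F 0 (suc (m + n)) ≈ F 0 (m + n)
    left = ⊗-cong (≈-trans (gauss-0ˡ (suc (m + n))) (≈-sym (gauss-0ˡ (m + n)))) ≈-refl
    right : F (suc (m + n)) 0 ≈ x ⊗ F (m + n) 0
    right = begin
      gauss (suc (m + n)) 0 ⊗ term n (suc (m + n))
        ≈⟨ ⊗-cong (≈-trans (gauss-0ʳ (suc (m + n))) (≈-sym (gauss-0ʳ (m + n)))) (≈-sym (⊗-identityˡ _)) ⟩
      gauss (m + n) 0 ⊗ (p ^^ 0 ⊗ term n (suc (m + n)))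
        ≈⟨ ⊗-cong ≈-refl (term-a m n (m + n) 0 (ℕₚ.+-identityʳ (m + n))) ⟨
      gauss (m + n) 0 ⊗ (term n (m + n) ⊗ x)
        ≈⟨ solve 3 (λ g t x → g :* (t :* x) := x :* (g :* t)) ≈-refl (gauss (m + n) 0) (term n (m + n)) x ⟩
      x ⊗ F (m + n) 0 ∎
    inner : ∀ k i → suc (k + i) ≡ m + n → F (suc k) (suc i) ≈ F (suc k) i ⊕ x ⊗ F k (suc i)
    inner k i e = begin
      gauss (suc k) (suc i) ⊗ term n (suc k)
        ≈⟨ ⊗-cong (gauss-pascal k i) ≈-refl ⟩
      (gauss (suc k) i ⊕ p ^^ suc i ⊗ gauss k (suc i)) ⊗ term n (suc k)
        ≈⟨ solve 4 (λ y g h t → (g :+ y :* h) :* t := g :* t :+ h :* (y :* t)) ≈-refl (p ^^ suc i) (gauss (suc k) i) (gauss k (suc i)) (term n (suc k)) ⟩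
      F (suc k) i ⊕ gauss k (suc i) ⊗ (p ^^ suc i ⊗ term n (suc k))
        ≈⟨ ⊕-cong ≈-refl (⊗-cong ≈-refl (term-a m n k (suc i) (trans (ℕₚ.+-suc k i) e))) ⟨
      F (suc k) i ⊕ gauss k (suc i) ⊗ (term n k ⊗ x)
        ≈⟨ ⊕-cong ≈-refl (solve 3 (λ g t x → g :* (t :* x) := x :* (g :* t)) ≈-refl (gauss k (suc i)) (term n k) x) ⟩
      F (suc k) i ⊕ x ⊗ F k (suc i) ∎

  order-1 : ∀ {f} → f 0 ≡ 0ℤ → f ≡[ 1 ] zeroS
  order-1 e zero    _         = e
  order-1 e (suc i) (s≤s ())

  power-order : ∀ {x} → x 0 ≡ 0ℤ → ∀ k → power x k ≡[ k ] zeroS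
  power-order {x} x0 zero    i ()
  power-order {x} x0 (suc k) = subst (λ N → power x (suc k) ≡[ N ] zeroS) (ℕₚ.+-comm k 1)
    (⊗-order (power-order x0 k) (order-1 (trans (⊗-0 x (p ^^ k)) (cong (ℤ._* (p ^^ k) 0) x0))))

  ^^-order : ∀ k → p ^^ k ≡[ k ] zeroS
  ^^-order zero    i ()
  ^^-order (suc k) = subst (λ N → p ^^ suc k ≡[ N ] zeroS) (ℕₚ.+-comm k 1) (⊗-order (^^-order k) (order-1 p0))

  one⊕-order : ∀ {N f} → f ≡[ N ] zeroS → oneS ⊕ f ≡[ N ] oneS
  one⊕-order h = mod-trans (⊕-mod mod-refl h) (≈⇒mod (⊕-identityʳ oneS))

  ⊗^^-order : ∀ x k → x ⊗ p ^^ k ≡[ k ] zeroS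
  ⊗^^-order x k = mod-trans (⊗-mod mod-refl (^^-order k)) (≈⇒mod (⊗-zeroʳ x))

  A-Unital : Unital A-factor
  A-Unital j = one⊕-order (⊗^^-order a j)

  B-Unital : Unital B-factor
  B-Unital j = one⊕-order (⊗^^-order b j)

  P-Unital : Unital p-factor
  P-Unital j = one⊕-order λ i i<j → trans (⊖-at (p ^^ suc j) i) (cong -_ (^^-order (suc j) i (ℕₚ.m<n⇒m<1+n i<j)))

  term-diagonal : ∀ d k → term (k + d) k ≈ power b d
  term-diagonal d zero    = term-0 d
  term-diagonal d (suc k) = term-diagonal d k

  term-diagonal′ : ∀ d n → term n (n + d) ≡ power a d
  term-diagonal′ d zero    = refl
  term-diagonal′ d (suc n) = term-diagonal′ d n

  P∞ : PS
  P∞ = ∏∞ p-factor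

  P∞-gauss : ∀ {N} k i → N ≤ k → N ≤ i → P∞ ⊗ gauss k i ≡[ N ] oneS
  P∞-gauss {N} k i N≤k N≤i = mod-trans (⊗-mod (approx N≤k) (⊗-mod (mod-trans (mod-sym (approx N≤k+i)) (approx N≤i)) mod-refl))
    (≈⇒mod (≈-trans (≈-sym (⊗-assoc (P k) (P i) _)) (⊗-recip (PP-0 k i))))
    where
    approx : ∀ {M} → N ≤ M → P∞ ≡[ N ] P M
    approx {M} N≤M = mod-weaken N≤M (Product.fold∞-mod P-Unital M)
    N≤k+i : N ≤ k + i
    N≤k+i = ℕₚ.≤-trans N≤k (ℕₚ.m≤m+n k i)

  -- The Gaussian binomial differs from its limit 1/`P∞` only from q^N on, and t itself starts at
  -- q^d, so the errors multiply.
  limit-term : ∀ {N d} k i t → N ≤ k → N ≤ i → t ≡[ d ] zeroS → P∞ ⊗ (gauss k i ⊗ t) ≡[ N + d ] t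
  limit-term {N} {d} k i t N≤k N≤i ht = mod-trans
    (≈⇒mod (solve 3 (λ z g t → z :* (g :* t) := (z :* g :- con 1ℤ) :* t :+ t) ≈-refl P∞ (gauss k i) t))
    (mod-trans (⊕-mod (⊗-order error ht) mod-refl) (≈⇒mod (⊕-identityˡ t)))
    where
    error : P∞ ⊗ gauss k i ⊕ ⊖ oneS ≡[ N ] zeroS
    error = mod-trans (⊕-mod (P∞-gauss k i N≤k N≤i) mod-refl) (≈⇒mod (⊕-inverseʳ oneS))

  -- At distance d from the centre k = n the smaller of k and i is n - d. The d orders of precision
  -- lost there are supplied by the term, which has order at least d.
  limit-diagonal : ∀ n k i → k + i ≡ n + n → P∞ ⊗ (gauss k i ⊗ term n k) ≡[ n ] term n k
  limit-diagonal n k i e with ℕₚ.≤-total k n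
  ... | inj₁ k≤n with ℕₚ.m≤n⇒∃[o]m+o≡n k≤n
  ...   | d , refl = limit-term k i (term (k + d) k) ℕₚ.≤-refl
            (ℕₚ.≤-trans (ℕₚ.m≤m+n k d) (ℕₚ.≤-trans (ℕₚ.m≤n+m (k + d) d) (ℕₚ.≤-reflexive (sym (ℕₚ.+-cancelˡ-≡ k i _ (trans e (ℕₚ.+-assoc k d (k + d))))))))
            (mod-trans (≈⇒mod (term-diagonal d k)) (power-order b0 d))
  limit-diagonal n k i e | inj₂ n≤k with ℕₚ.m≤n⇒∃[o]m+o≡n n≤k
  ...   | d , refl = subst (λ N → P∞ ⊗ (gauss (n + d) i ⊗ term n (n + d)) ≡[ N ] term n (n + d)) i+d≡n
            (limit-term (n + d) i (term n (n + d)) (ℕₚ.≤-trans (ℕₚ.m≤m+n i d) (ℕₚ.≤-trans (ℕₚ.≤-reflexive i+d≡n) (ℕₚ.m≤m+n n d))) ℕₚ.≤-refl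
              (mod-trans (≈⇒mod (≡⇒≈ (term-diagonal′ d n))) (power-order a0 d)))
    where
    i+d≡n : i + d ≡ n
    i+d≡n = ℕₚ.+-cancelˡ-≡ n (i + d) n (trans (cong (n +_) (ℕₚ.+-comm i d)) (trans (sym (ℕₚ.+-assoc n d i)) e))

  ∑-term : ∀ n m → ∑ (n + m) (term n) ≈ ∑ n (power b ∘ suc) ⊕ ∑ m (power a)
  ∑-term zero    m = ≈-sym (⊕-identityˡ (∑ m (power a)))
  ∑-term (suc n) m = ≈-trans (Sum.fold-head (n + m) (term (suc n))) (≈-trans (⊕-cong ≈-refl (∑-term n m))
    (solve 3 (λ x y z → x :+ (y :+ z) := y :+ x :+ z) ≈-refl (power b (suc n)) (∑ n (power b ∘ suc)) (∑ m (power a))))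

  power-convergent : ∀ {x} → x 0 ≡ 0ℤ → Sum.Convergent (power x)
  power-convergent = power-order

  power-suc-convergent : ∀ {x} → x 0 ≡ 0ℤ → Sum.Convergent (power x ∘ suc)
  power-suc-convergent x0 k = mod-weaken (ℕₚ.n≤1+n k) (power-order x0 (suc k))

  triple-product : ∑∞ (power a) ⊕ ∑∞ (power b ∘ suc) ≈ ∏∞ A-factor ⊗ ∏∞ B-factor ⊗ ∏∞ p-factor
  triple-product = coeffwise λ N → go (suc N) N ℕₚ.≤-refl
    where
    go : ∀ n → ∑∞ (power a) ⊕ ∑∞ (power b ∘ suc) ≡[ n ] ∏∞ A-factor ⊗ ∏∞ B-factor ⊗ ∏∞ p-factor
    go n = mod-sym (mod-trans (⊗-mod (⊗-mod (Product.fold∞-mod A-Unital n) (Product.fold∞-mod B-Unital n)) mod-refl)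
      (mod-trans (≈⇒mod (≈-trans (solve 3 (λ x y z → x :* y :* z := z :* (y :* x)) ≈-refl (∏ n A-factor) (∏ n B-factor) P∞)
        (≈-trans (⊗-cong ≈-refl (finite n n)) (diagonal-⊗ (n + n) P∞ (λ k i → gauss k i ⊗ term n k)))))
      (mod-trans (diagonal-mod (n + n) (limit-diagonal n))
      (mod-trans (≈⇒mod (≈-trans (diagonal-const (n + n) (term n)) (≈-trans (≡⇒≈ (cong (λ k → ∑ k (term n)) (sym (ℕₚ.+-suc n n))))
        (≈-trans (∑-term n (suc n)) (⊕-comm _ _)))))
      (mod-sym (⊕-mod (mod-weaken (ℕₚ.n≤1+n n) (Sum.fold∞-mod (power-convergent a0) (suc n))) (Sum.fold∞-mod (power-suc-convergent b0) n)))))))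

-- Integer powers of invertible series

_^ᶻ_ : PS → ℤ → PS
f ^ᶻ (ℤ.+ n)  = f ^^ n
f ^ᶻ -[1+ n ] = recip f ^^ suc n

^^-cong : ∀ n {f g} → f ≈ g → f ^^ n ≈ g ^^ n
^^-cong zero    p = ≈-refl
^^-cong (suc n) p = ⊗-cong (^^-cong n p) p

^^-⊗ : ∀ n f g → (f ⊗ g) ^^ n ≈ f ^^ n ⊗ g ^^ n
^^-⊗ zero    f g = ≈-sym (⊗-identityˡ oneS)
^^-⊗ (suc n) f g = ≈-trans (⊗-cong (^^-⊗ n f g) ≈-refl) (Product.interchange (f ^^ n) (g ^^ n) f g)

^^-0 : ∀ n {f} → f 0 ≡ 1ℤ → (f ^^ n) 0 ≡ 1ℤ
^^-0 zero    f0 = refl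
^^-0 (suc n) {f} f0 = ⊗-unit {f ^^ n} (^^-0 n f0) f0

^^-hom : ∀ (φ : PS → PS) → φ oneS ≈ oneS → (∀ f g → φ (f ⊗ g) ≈ φ f ⊗ φ g) → ∀ n f → φ (f ^^ n) ≈ φ f ^^ n
^^-hom φ φ-one φ-⊗ zero    f = φ-one
^^-hom φ φ-one φ-⊗ (suc n) f = ≈-trans (φ-⊗ (f ^^ n) f) (⊗-cong (^^-hom φ φ-one φ-⊗ n f) ≈-refl)

recip-⊗ : ∀ {f g} → f 0 ≡ 1ℤ → g 0 ≡ 1ℤ → recip (f ⊗ g) ≈ recip f ⊗ recip g
recip-⊗ {f} {g} f0 g0 = recip-unique (⊗-unit {f} f0 g0) (≈-trans (Product.interchange f g (recip f) (recip g))
  (≈-trans (⊗-cong (⊗-recip f0) (⊗-recip g0)) (⊗-identityˡ oneS)))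

recip-recip : ∀ {f} → f 0 ≡ 1ℤ → recip (recip f) ≈ f
recip-recip {f} f0 = recip-unique (recip-0 f) (≈-trans (⊗-comm (recip f) f) (⊗-recip f0))

recip-oneS : recip oneS ≈ oneS
recip-oneS = recip-unique refl (⊗-identityˡ oneS)

^ᶻ-0 : ∀ e {f} → f 0 ≡ 1ℤ → (f ^ᶻ e) 0 ≡ 1ℤ
^ᶻ-0 (ℤ.+ n)  f0 = ^^-0 n f0
^ᶻ-0 -[1+ n ] {f} f0 = ^^-0 (suc n) (recip-0 f)

^ᶻ-cong : ∀ e {f g} → f 0 ≡ 1ℤ → f ≈ g → f ^ᶻ e ≈ g ^ᶻ e
^ᶻ-cong (ℤ.+ n)  f0 p = ^^-cong n p
^ᶻ-cong -[1+ n ] f0 p = ^^-cong (suc n) (recip-cong f0 p)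

^ᶻ-⊗ : ∀ e {f g} → f 0 ≡ 1ℤ → g 0 ≡ 1ℤ → (f ⊗ g) ^ᶻ e ≈ f ^ᶻ e ⊗ g ^ᶻ e
^ᶻ-⊗ (ℤ.+ n)  {f} {g} f0 g0 = ^^-⊗ n f g
^ᶻ-⊗ -[1+ n ] {f} {g} f0 g0 = ≈-trans (^^-cong (suc n) (recip-⊗ f0 g0)) (^^-⊗ (suc n) (recip f) (recip g))

^ᶻ-recip : ∀ e {f} → f 0 ≡ 1ℤ → recip f ^ᶻ e ≈ f ^ᶻ (- e)
^ᶻ-recip (ℤ.+ zero)    f0 = ≈-refl
^ᶻ-recip (ℤ.+ (suc n)) f0 = ≈-refl
^ᶻ-recip -[1+ n ]      f0 = ^^-cong (suc n) (recip-recip f0)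

^ᶻ-oneS : ∀ e → oneS ^ᶻ e ≈ oneS
^ᶻ-oneS (ℤ.+ n)  = go n
  where
  go : ∀ n → oneS ^^ n ≈ oneS
  go zero    = ≈-refl
  go (suc n) = ≈-trans (⊗-identityʳ (oneS ^^ n)) (go n)
^ᶻ-oneS -[1+ n ] = ≈-trans (^^-cong (suc n) recip-oneS) (^ᶻ-oneS (ℤ.+ (suc n)))

^ᶻ-⊖ : ∀ {f} → f 0 ≡ 1ℤ → ∀ m n → f ^ᶻ (m ℤ.⊖ n) ≈ f ^^ m ⊗ recip f ^^ n
^ᶻ-⊖ {f} f0 m       zero    = ≈-sym (⊗-identityʳ (f ^^ m))
^ᶻ-⊖ {f} f0 zero    (suc n) = ≈-sym (⊗-identityˡ (recip f ^^ suc n))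
^ᶻ-⊖ {f} f0 (suc m) (suc n) = begin
  f ^ᶻ (suc m ℤ.⊖ suc n)                       ≈⟨ ≡⇒≈ (cong (f ^ᶻ_) (ℤₚ.[1+m]⊖[1+n]≡m⊖n m n)) ⟩
  f ^ᶻ (m ℤ.⊖ n)                               ≈⟨ ^ᶻ-⊖ f0 m n ⟩
  f ^^ m ⊗ recip f ^^ n                        ≈⟨ ⊗-identityʳ _ ⟨
  f ^^ m ⊗ recip f ^^ n ⊗ oneS                 ≈⟨ ⊗-cong ≈-refl (⊗-recip f0) ⟨
  f ^^ m ⊗ recip f ^^ n ⊗ (f ⊗ recip f)        ≈⟨ Product.interchange (f ^^ m) (recip f ^^ n) f (recip f) ⟩
  f ^^ m ⊗ f ⊗ (recip f ^^ n ⊗ recip f)        ∎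
  where open ≈-Reasoning

^ᶻ-+ : ∀ {f} → f 0 ≡ 1ℤ → ∀ d e → f ^ᶻ (d ℤ.+ e) ≈ f ^ᶻ d ⊗ f ^ᶻ e
^ᶻ-+ {f} f0 (ℤ.+ m)  (ℤ.+ n)  = ^^-+ f m n
^ᶻ-+ {f} f0 (ℤ.+ m)  -[1+ n ] = ^ᶻ-⊖ f0 m (suc n)
^ᶻ-+ {f} f0 -[1+ m ] (ℤ.+ n)  = ≈-trans (^ᶻ-⊖ f0 n (suc m)) (⊗-comm (f ^^ n) (recip f ^^ suc m))
^ᶻ-+ {f} f0 -[1+ m ] -[1+ n ] = ≈-trans (≡⇒≈ (cong (λ k → recip f ^^ suc k) (sym (ℕₚ.+-suc m n)))) (^^-+ (recip f) (suc m) (suc n))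

^ᶻ-hom : ∀ (φ : PS → PS) → φ oneS ≈ oneS → (∀ f g → φ (f ⊗ g) ≈ φ f ⊗ φ g) →
  ∀ {f} → φ (recip f) ≈ recip (φ f) → ∀ e → φ (f ^ᶻ e) ≈ φ f ^ᶻ e
^ᶻ-hom φ φ-one φ-⊗ {f} h (ℤ.+ n)  = ^^-hom φ φ-one φ-⊗ n f
^ᶻ-hom φ φ-one φ-⊗ {f} h -[1+ n ] = ≈-trans (^^-hom φ φ-one φ-⊗ (suc n) (recip f)) (^^-cong (suc n) h)

-- Polynomials in q and in the symbols (q^a ; q^b)_∞ and their reciprocals. A symbol is a pair
-- (a , b), degenerate symbols denote 1, and a term is a coefficient, an exponent of q and a
-- list of symbols with exponents.

Symbol = ℕ × ℕ
Powers = List (Symbol × ℤ)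
Term   = ℤ × ℕ × Powers
Poly   = List Term

symbol : Symbol → PS
symbol (zero  , b)     = oneS
symbol (suc a , zero)  = oneS
symbol (suc a , suc b) = pochS -1ℤ (suc a) (suc b)

symbol-0 : ∀ s → symbol s 0 ≡ 1ℤ
symbol-0 (zero  , b)     = refl
symbol-0 (suc a , zero)  = refl
symbol-0 (suc a , suc b) = pochS-0 -1ℤ (suc a) (suc b)

⟦_⟧ᵖ : Powers → PS
⟦ [] ⟧ᵖ          = oneS
⟦ (s , e) ∷ l ⟧ᵖ = symbol s ^ᶻ e ⊗ ⟦ l ⟧ᵖ

⟦_⟧ᵗ : Term → PS
⟦ c , k , l ⟧ᵗ = c · (Q k ⊗ ⟦ l ⟧ᵖ)

⟦_⟧ : Poly → PS
⟦ [] ⟧    = zeroS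
⟦ t ∷ p ⟧ = ⟦ t ⟧ᵗ ⊕ ⟦ p ⟧

⟦⟧ᵖ-0 : ∀ l → ⟦ l ⟧ᵖ 0 ≡ 1ℤ
⟦⟧ᵖ-0 []            = refl
⟦⟧ᵖ-0 ((s , e) ∷ l) = ⊗-unit {symbol s ^ᶻ e} (^ᶻ-0 e (symbol-0 s)) (⟦⟧ᵖ-0 l)

sameSymbol : Symbol → Symbol → Bool
sameSymbol (a , b) (c , d) = (a ≡ᵇ c) ∧ (b ≡ᵇ d)

sameSymbol-sound : ∀ s t → T (sameSymbol s t) → s ≡ t
sameSymbol-sound (a , b) (c , d) h with Equivalence.to T-∧ h
... | p , q = cong₂ _,_ (ℕₚ.≡ᵇ⇒≡ a c p) (ℕₚ.≡ᵇ⇒≡ b d q)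

isZero : ℤ → Bool
isZero (ℤ.+ zero) = true
isZero _          = false

isZero-sound : ∀ c → T (isZero c) → c ≡ 0ℤ
isZero-sound (ℤ.+ zero) _ = refl

insert : Symbol → ℤ → Powers → Powers
insert s e []            = (s , e) ∷ []
insert s e ((t , d) ∷ l) = if sameSymbol s t
  then (if isZero (e ℤ.+ d) then l else (s , e ℤ.+ d) ∷ l)
  else (t , d) ∷ insert s e l

insert-sound : ∀ s e l → ⟦ insert s e l ⟧ᵖ ≈ symbol s ^ᶻ e ⊗ ⟦ l ⟧ᵖ
insert-sound s e [] = ≈-refl
insert-sound s e ((t , d) ∷ l) with sameSymbol s t in eq
... | false = ≈-trans (⊗-cong ≈-refl (insert-sound s e l))
  (solve 3 (λ x y z → x :* (y :* z) := y :* (x :* z)) ≈-refl (symbol t ^ᶻ d) (symbol s ^ᶻ e) ⟦ l ⟧ᵖ)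
... | true with sameSymbol-sound s t (subst T (sym eq) tt)
...   | refl with isZero (e ℤ.+ d) in z
...     | false = ≈-trans (⊗-cong (^ᶻ-+ (symbol-0 s) e d) ≈-refl) (⊗-assoc _ _ _)
...     | true  = ≈-trans (≈-sym (⊗-identityˡ ⟦ l ⟧ᵖ)) (≈-trans (⊗-cong (≈-trans
            (≡⇒≈ (cong (symbol s ^ᶻ_) (sym (isZero-sound (e ℤ.+ d) (subst T (sym z) tt)))))
            (^ᶻ-+ (symbol-0 s) e d)) ≈-refl) (⊗-assoc _ _ _))

infixl 8 _⊙_
_⊙_ : Powers → Powers → Powers
[]            ⊙ m = m
((s , e) ∷ l) ⊙ m = insert s e (l ⊙ m)

⊙-sound : ∀ l m → ⟦ l ⊙ m ⟧ᵖ ≈ ⟦ l ⟧ᵖ ⊗ ⟦ m ⟧ᵖ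
⊙-sound []            m = ≈-sym (⊗-identityˡ ⟦ m ⟧ᵖ)
⊙-sound ((s , e) ∷ l) m = ≈-trans (insert-sound s e (l ⊙ m)) (≈-trans (⊗-cong ≈-refl (⊙-sound l m)) (≈-sym (⊗-assoc _ _ _)))

inverse : Powers → Powers
inverse []            = []
inverse ((s , e) ∷ l) = (s , - e) ∷ inverse l

inverse-sound : ∀ l → ⟦ l ⟧ᵖ ⊗ ⟦ inverse l ⟧ᵖ ≈ oneS
inverse-sound []            = ⊗-identityˡ oneS
inverse-sound ((s , e) ∷ l) = ≈-trans (Product.interchange (symbol s ^ᶻ e) ⟦ l ⟧ᵖ (symbol s ^ᶻ (- e)) ⟦ inverse l ⟧ᵖ)
  (≈-trans (⊗-cong (≈-trans (≈-sym (^ᶻ-+ (symbol-0 s) e (- e))) (≡⇒≈ (cong (symbol s ^ᶻ_) (ℤₚ.+-inverseʳ e)))) (inverse-sound l))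
    (⊗-identityˡ oneS))

recip-⟦⟧ᵖ : ∀ l → recip ⟦ l ⟧ᵖ ≈ ⟦ inverse l ⟧ᵖ
recip-⟦⟧ᵖ l = recip-unique (⟦⟧ᵖ-0 l) (inverse-sound l)

trivial : Powers → Bool
trivial []            = true
trivial ((s , e) ∷ l) = isZero e ∧ trivial l

trivial-sound : ∀ l → T (trivial l) → ⟦ l ⟧ᵖ ≈ oneS
trivial-sound []            _ = ≈-refl
trivial-sound ((s , e) ∷ l) h with Equivalence.to T-∧ h
... | p , q with isZero-sound e p
...   | refl = ≈-trans (⊗-identityˡ ⟦ l ⟧ᵖ) (trivial-sound l q)

-- The lists are not sorted, hence the quotient. The inner `⊙ []` first merges repeated symbols of
-- m, because `insert` stops at the first occurrence it meets.
samePowers : Powers → Powers → Bool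
samePowers l m = trivial (l ⊙ (inverse m ⊙ []))

samePowers-sound : ∀ l m → T (samePowers l m) → ⟦ l ⟧ᵖ ≈ ⟦ m ⟧ᵖ
samePowers-sound l m h = ⊗-cancelˡ (⟦⟧ᵖ-0 (inverse m)) (begin
  ⟦ inverse m ⟧ᵖ ⊗ ⟦ l ⟧ᵖ            ≈⟨ ⊗-comm ⟦ inverse m ⟧ᵖ ⟦ l ⟧ᵖ ⟩
  ⟦ l ⟧ᵖ ⊗ ⟦ inverse m ⟧ᵖ            ≈⟨ ⊗-cong ≈-refl (≈-trans (⊙-sound (inverse m) []) (⊗-identityʳ _)) ⟨
  ⟦ l ⟧ᵖ ⊗ ⟦ inverse m ⊙ [] ⟧ᵖ       ≈⟨ ⊙-sound l (inverse m ⊙ []) ⟨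
  ⟦ l ⊙ (inverse m ⊙ []) ⟧ᵖ          ≈⟨ trivial-sound (l ⊙ (inverse m ⊙ [])) h ⟩
  oneS                               ≈⟨ inverse-sound m ⟨
  ⟦ m ⟧ᵖ ⊗ ⟦ inverse m ⟧ᵖ            ≈⟨ ⊗-comm ⟦ m ⟧ᵖ ⟦ inverse m ⟧ᵖ ⟩
  ⟦ inverse m ⟧ᵖ ⊗ ⟦ m ⟧ᵖ            ∎)
  where open ≈-Reasoning

addTerm : Term → Poly → Poly
addTerm t [] = t ∷ []
addTerm (c , k , l) ((d , j , m) ∷ p) =
  if (k ≡ᵇ j) ∧ samePowers l m then (c ℤ.+ d , k , l) ∷ p else (d , j , m) ∷ addTerm (c , k , l) p

addTerm-sound : ∀ t p → ⟦ addTerm t p ⟧ ≈ ⟦ t ⟧ᵗ ⊕ ⟦ p ⟧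
addTerm-sound t [] = ≈-refl
addTerm-sound (c , k , l) ((d , j , m) ∷ p) with (k ≡ᵇ j) ∧ samePowers l m in eq
... | false = ≈-trans (⊕-cong ≈-refl (addTerm-sound (c , k , l) p))
  (solve 3 (λ x y z → x :+ (y :+ z) := y :+ (x :+ z)) ≈-refl ⟦ d , j , m ⟧ᵗ ⟦ c , k , l ⟧ᵗ ⟦ p ⟧)
... | true with Equivalence.to T-∧ (subst T (sym eq) tt)
...   | h , h' with ℕₚ.≡ᵇ⇒≡ k j h
...     | refl = ≈-trans (⊕-cong (≈-trans (·-+ c d (Q k ⊗ ⟦ l ⟧ᵖ)) (⊕-cong ≈-refl
            (·-cong d (⊗-cong ≈-refl (samePowers-sound l m h'))))) ≈-refl) (⊕-assoc _ _ _)

collect : Poly → Poly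
collect []      = []
collect (t ∷ p) = addTerm t (collect p)

collect-sound : ∀ p → ⟦ collect p ⟧ ≈ ⟦ p ⟧
collect-sound []      = ≈-refl
collect-sound (t ∷ p) = ≈-trans (addTerm-sound t (collect p)) (⊕-cong ≈-refl (collect-sound p))

coefficientsZero : Poly → Bool
coefficientsZero []              = true
coefficientsZero ((c , _) ∷ p) = isZero c ∧ coefficientsZero p

coefficientsZero-sound : ∀ p → T (coefficientsZero p) → ⟦ p ⟧ ≈ zeroS
coefficientsZero-sound []                _ = ≈-refl
coefficientsZero-sound ((c , k , l) ∷ p) h with Equivalence.to T-∧ h
... | h₁ , h₂ with isZero-sound c h₁
...   | refl = ≈-trans (⊕-cong (0· _) (coefficientsZero-sound p h₂)) (⊕-identityˡ zeroS)

-- A sufficient test only: relations between different symbols are invisible to it and must already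
-- be part of the combination tested.
vanishes : Poly → Bool
vanishes p = coefficientsZero (collect p)

⟦⟧-++ : ∀ p r → ⟦ p ++ r ⟧ ≈ ⟦ p ⟧ ⊕ ⟦ r ⟧
⟦⟧-++ []      r = ≈-sym (⊕-identityˡ ⟦ r ⟧)
⟦⟧-++ (t ∷ p) r = ≈-trans (⊕-cong ≈-refl (⟦⟧-++ p r)) (≈-sym (⊕-assoc ⟦ t ⟧ᵗ ⟦ p ⟧ ⟦ r ⟧))

mulTerm : Term → Term → Term
mulTerm (c , k , l) (d , j , m) = c ℤ.* d , k + j , l ⊙ m

mulTerm-sound : ∀ t u → ⟦ mulTerm t u ⟧ᵗ ≈ ⟦ t ⟧ᵗ ⊗ ⟦ u ⟧ᵗ
mulTerm-sound (c , k , l) (d , j , m) = begin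
  (c ℤ.* d) · (Q (k + j) ⊗ ⟦ l ⊙ m ⟧ᵖ)
    ≈⟨ ·-cong (c ℤ.* d) (≈-trans (⊗-cong (Q-+ k j) (⊙-sound l m)) (Product.interchange (Q k) (Q j) ⟦ l ⟧ᵖ ⟦ m ⟧ᵖ)) ⟩
  (c ℤ.* d) · (Q k ⊗ ⟦ l ⟧ᵖ ⊗ (Q j ⊗ ⟦ m ⟧ᵖ))
    ≈⟨ ·-· c d _ ⟨
  c · (d · (Q k ⊗ ⟦ l ⟧ᵖ ⊗ (Q j ⊗ ⟦ m ⟧ᵖ)))
    ≈⟨ ·-cong c (⊗-· d _ _) ⟨
  c · (Q k ⊗ ⟦ l ⟧ᵖ ⊗ d · (Q j ⊗ ⟦ m ⟧ᵖ))
    ≈⟨ ·-⊗ c _ _ ⟨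
  c · (Q k ⊗ ⟦ l ⟧ᵖ) ⊗ d · (Q j ⊗ ⟦ m ⟧ᵖ) ∎
  where open ≈-Reasoning

map-mulTerm-sound : ∀ t p → ⟦ map (mulTerm t) p ⟧ ≈ ⟦ t ⟧ᵗ ⊗ ⟦ p ⟧
map-mulTerm-sound t []      = ≈-sym (⊗-zeroʳ ⟦ t ⟧ᵗ)
map-mulTerm-sound t (u ∷ p) = ≈-trans (⊕-cong (mulTerm-sound t u) (map-mulTerm-sound t p)) (≈-sym (⊗-distribˡ ⟦ t ⟧ᵗ ⟦ u ⟧ᵗ ⟦ p ⟧))

infixl 7 _⋆_
_⋆_ : Poly → Poly → Poly
[]      ⋆ r = []
(t ∷ p) ⋆ r = map (mulTerm t) r ++ p ⋆ r

⋆-sound : ∀ p r → ⟦ p ⋆ r ⟧ ≈ ⟦ p ⟧ ⊗ ⟦ r ⟧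
⋆-sound []      r = ≈-sym (⊗-zeroˡ ⟦ r ⟧)
⋆-sound (t ∷ p) r = ≈-trans (⟦⟧-++ (map (mulTerm t) r) (p ⋆ r))
  (≈-trans (⊕-cong (map-mulTerm-sound t r) (⋆-sound p r)) (≈-sym (⊗-distribʳ ⟦ r ⟧ ⟦ t ⟧ᵗ ⟦ p ⟧)))

negate : Poly → Poly
negate = map λ { (c , k , l) → - c , k , l }

negate-sound : ∀ p → ⟦ negate p ⟧ ≈ ⊖ ⟦ p ⟧
negate-sound []                = solve 0 (con 0ℤ := :- con 0ℤ) ≈-refl
negate-sound ((c , k , l) ∷ p) = ≈-trans (⊕-cong (·-⊖ c _) (negate-sound p))
  (solve 2 (λ x y → :- x :+ :- y := :- (x :+ y)) ≈-refl ⟦ c , k , l ⟧ᵗ ⟦ p ⟧)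

infixl 6 _⊞_ _⊟_
_⊞_ _⊟_ : Poly → Poly → Poly
p ⊞ r = p ++ r
p ⊟ r = p ++ negate r

⊟-sound : ∀ p r → ⟦ p ⊟ r ⟧ ≈ ⟦ p ⟧ ⊕ ⊖ ⟦ r ⟧
⊟-sound p r = ≈-trans (⟦⟧-++ p (negate r)) (⊕-cong ≈-refl (negate-sound r))

-- q ↦ q^m

dilatePowers : ℕ → Powers → Powers
dilatePowers m = map λ { ((a , b) , e) → (m * a , m * b) , e }

dilatePoly : ℕ → Poly → Poly
dilatePoly m = map λ { (c , k , l) → c , m * k , dilatePowers m l }

module _ (m : ℕ) .{{_ : NonZero m}} where

  dilate-symbol : ∀ a b → dilate m (symbol (a , b)) ≈ symbol (m * a , m * b)
  dilate-symbol zero    b       rewrite ℕₚ.*-zeroʳ m = dilate-oneS m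
  dilate-symbol (suc a) zero    rewrite ℕₚ.*-zeroʳ m with m * suc a
  ... | zero  = dilate-oneS m
  ... | suc _ = dilate-oneS m
  dilate-symbol (suc a) (suc b) = ≈-trans (dilate-pochS -1ℤ (suc a) (suc b) m) (lemma (m * suc a) (m * suc b)
      {{ℕₚ.m*n≢0 m (suc a)}} {{ℕₚ.m*n≢0 m (suc b)}})
    where
    lemma : ∀ x y .{{_ : NonZero x}} .{{_ : NonZero y}} → pochS -1ℤ x y ≈ symbol (x , y)
    lemma (suc x) (suc y) = ≈-refl

  dilatePowers-sound : ∀ l → dilate m ⟦ l ⟧ᵖ ≈ ⟦ dilatePowers m l ⟧ᵖ
  dilatePowers-sound []                  = dilate-oneS m
  dilatePowers-sound (((a , b) , e) ∷ l) = ≈-trans (dilate-⊗ m (symbol (a , b) ^ᶻ e) ⟦ l ⟧ᵖ) (⊗-cong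
    (≈-trans (^ᶻ-hom (dilate m) (dilate-oneS m) (dilate-⊗ m) (dilate-recip m (symbol-0 (a , b))) e)
      (^ᶻ-cong e (trans (dilate-0 m (symbol (a , b))) (symbol-0 (a , b))) (dilate-symbol a b))) (dilatePowers-sound l))

  dilatePoly-sound : ∀ p → dilate m ⟦ p ⟧ ≈ ⟦ dilatePoly m p ⟧
  dilatePoly-sound []                = dilate-zeroS m
  dilatePoly-sound ((c , k , l) ∷ p) = ≈-trans (dilate-⊕ m ⟦ c , k , l ⟧ᵗ ⟦ p ⟧) (⊕-cong
    (≈-trans (dilate-· m c (Q k ⊗ ⟦ l ⟧ᵖ)) (·-cong c (≈-trans (dilate-⊗ m (Q k) ⟦ l ⟧ᵖ) (⊗-cong (dilate-Q m k) (dilatePowers-sound l)))))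
    (dilatePoly-sound p))

-- q ↦ -q, where (q^a ; q^a)_∞ for odd a is first split into (q^a ; q^2a)_∞ (q^2a ; q^2a)_∞.

even : ℕ → Bool
even zero    = true
even (suc n) = not (even n)

σ-even? : ∀ n → T (even n) → σ n ≡ 1ℤ
σ-odd?  : ∀ n → T (not (even n)) → σ n ≡ -1ℤ
σ-even? zero    _ = refl
σ-even? (suc n) h = cong -_ (σ-odd? n h)
σ-odd?  (suc n) h = cong -_ (σ-even? n (subst T (notnot (even n)) h))
  where
  notnot : ∀ b → not (not b) ≡ b
  notnot true  = refl
  notnot false = refl

sgnSymbol : Symbol → ℤ → Powers
sgnSymbol (a , b) e =
  if even b
  then (if even a then ((a , b) , e) ∷ [] else ((2 * a , 2 * b) , e) ∷ ((a , b) , - e) ∷ [])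
  else ((2 * a , 2 * a) , e) ∷ ((2 * a , 2 * a) , e) ∷ ((2 * a , 2 * a) , e) ∷ ((a , a) , - e) ∷ ((4 * a , 4 * a) , - e) ∷ []

signable : Powers → Bool
signable []                  = true
signable (((a , b) , e) ∷ l) = (if even b then true else (a ≡ᵇ b)) ∧ signable l

sgnPowers : Powers → Powers
sgnPowers []            = []
sgnPowers ((s , e) ∷ l) = sgnSymbol s e ⊙ sgnPowers l

⊗-recip-unique : ∀ {f u g} → u 0 ≡ 1ℤ → f ⊗ u ≈ g → f ≈ g ⊗ recip u
⊗-recip-unique {f} {u} {g} u0 p = ⊗-cancelˡ u0 (begin
  u ⊗ f              ≈⟨ ⊗-comm u f ⟩
  f ⊗ u              ≈⟨ p ⟩
  g                  ≈⟨ ⊗-identityʳ g ⟨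
  g ⊗ oneS           ≈⟨ ⊗-cong ≈-refl (⊗-recip u0) ⟨
  g ⊗ (u ⊗ recip u)  ≈⟨ solve 3 (λ x y z → x :* (y :* z) := y :* (x :* z)) ≈-refl g u (recip u) ⟩
  u ⊗ (g ⊗ recip u)  ∎)
  where open ≈-Reasoning

pochS-split₂ : ∀ c a b .{{_ : NonZero a}} .{{_ : NonZero b}} → pochS c a b ≈ pochS c a (2 * b) ⊗ pochS c (a + b) (2 * b)
pochS-split₂ c a b = ≈-trans (pochS-split c a b 2) (⊗-cong
  (≈-trans (⊗-identityˡ _) (≡⇒≈ (cong (λ x → pochS c x (2 * b)) (trans (cong (a +_) (ℕₚ.*-zeroʳ b)) (ℕₚ.+-identityʳ a)))))
  (≡⇒≈ (cong (λ x → pochS c (a + x) (2 * b)) (ℕₚ.*-identityʳ b))))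

sgn-pochS-even : ∀ a b .{{_ : NonZero a}} .{{_ : NonZero b}} → σ b ≡ 1ℤ → σ a ≡ 1ℤ → sgn (pochS -1ℤ a b) ≈ pochS -1ℤ a b
sgn-pochS-even a b eb ea = ≈-trans (sgn-pochS -1ℤ a b eb) (≡⇒≈ (cong (λ c → pochS (-1ℤ ℤ.* c) a b) ea))

sgn-pochS-odd : ∀ a b .{{_ : NonZero a}} .{{_ : NonZero b}} → σ b ≡ 1ℤ → σ a ≡ -1ℤ →
  sgn (pochS -1ℤ a b) ⊗ pochS -1ℤ a b ≈ pochS -1ℤ (2 * a) (2 * b)
sgn-pochS-odd a b eb oa = ≈-trans (⊗-cong (≈-trans (sgn-pochS -1ℤ a b eb) (≡⇒≈ (cong (λ c → pochS (-1ℤ ℤ.* c) a b) oa))) ≈-refl)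
  (pochS-± a b)

-- Split f_a into odd and even multiples of a: only the odd ones are affected by q ↦ -q, and there
-- `pochS-±` applies. This yields the last branch of `sgnSymbol`.
sgn-euler : ∀ a .{{_ : NonZero a}} → σ a ≡ -1ℤ →
  sgn (pochS -1ℤ a a) ⊗ (pochS -1ℤ a a ⊗ pochS -1ℤ (4 * a) (4 * a)) ≈
  pochS -1ℤ (2 * a) (2 * a) ⊗ (pochS -1ℤ (2 * a) (2 * a) ⊗ pochS -1ℤ (2 * a) (2 * a))
sgn-euler a@(suc a') oa = begin
  sgn (η a) ⊗ (η a ⊗ η (4 * a))
    ≈⟨ ⊗-cong (≈-trans (sgn-cong split) (sgn-⊗ o E)) (⊗-cong split ≈-refl) ⟩
  sgn o ⊗ sgn E ⊗ (o ⊗ E ⊗ η (4 * a))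
    ≈⟨ ⊗-cong (⊗-cong ≈-refl (sgn-pochS-even (2 * a) (2 * a) σ2a σ2a)) ≈-refl ⟩
  sgn o ⊗ E ⊗ (o ⊗ E ⊗ η (4 * a))
    ≈⟨ solve 4 (λ s e o f → s :* e :* (o :* e :* f) := s :* o :* f :* (e :* e)) ≈-refl (sgn o) E o (η (4 * a)) ⟩
  sgn o ⊗ o ⊗ η (4 * a) ⊗ (E ⊗ E)
    ≈⟨ ⊗-cong (⊗-cong (sgn-pochS-odd a (2 * a) σ2a oa) ≈-refl) ≈-refl ⟩
  pochS -1ℤ (2 * a) (2 * (2 * a)) ⊗ η (4 * a) ⊗ (E ⊗ E)
    ≈⟨ ⊗-cong (⊗-cong ≈-refl (≡⇒≈ (cong₂ (pochS -1ℤ) (lemma₁ a) (lemma₂ a)))) ≈-refl ⟨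
  pochS -1ℤ (2 * a) (2 * (2 * a)) ⊗ pochS -1ℤ (2 * a + 2 * a) (2 * (2 * a)) ⊗ (E ⊗ E)
    ≈⟨ ⊗-cong (pochS-split₂ -1ℤ (2 * a) (2 * a)) ≈-refl ⟨
  E ⊗ (E ⊗ E) ∎
  where
  open ≈-Reasoning
  η : ℕ → PS
  η n = pochS -1ℤ n n
  o E : PS
  o = pochS -1ℤ a (2 * a)
  E = η (2 * a)
  split : η a ≈ o ⊗ E
  split = ≈-trans (pochS-split₂ -1ℤ a a) (⊗-cong ≈-refl (≡⇒≈ (cong (λ x → pochS -1ℤ x (2 * a)) (lemma a))))
    where
    lemma : ∀ a → a + a ≡ 2 * a
    lemma = ℕR.solve-∀
  lemma₁ : ∀ a → 2 * a + 2 * a ≡ 4 * a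
  lemma₁ = ℕR.solve-∀
  lemma₂ : ∀ a → 2 * (2 * a) ≡ 4 * a
  lemma₂ = ℕR.solve-∀
  σ2a : σ (2 * a) ≡ 1ℤ
  σ2a = σ-even 2 refl a

private
  ∷[]-sound : ∀ s e → ⟦ (s , e) ∷ [] ⟧ᵖ ≈ symbol s ^ᶻ e
  ∷[]-sound s e = ⊗-identityʳ (symbol s ^ᶻ e)

  quotient-power : ∀ {f g h} e → f 0 ≡ 1ℤ → g 0 ≡ 1ℤ → h 0 ≡ 1ℤ → f ≈ g ⊗ recip h → f ^ᶻ e ≈ g ^ᶻ e ⊗ h ^ᶻ (- e)
  quotient-power {f} {g} {h} e f0 g0 h0 p = ≈-trans (^ᶻ-cong e f0 p)
    (≈-trans (^ᶻ-⊗ e g0 (recip-0 h)) (⊗-cong ≈-refl (^ᶻ-recip e h0)))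

  sgn-0′ : ∀ s → sgn (symbol s) 0 ≡ 1ℤ
  sgn-0′ s = trans (sgn-0 (symbol s)) (symbol-0 s)

  sgn-unit : ∀ e → sgn oneS ^ᶻ e ≈ oneS
  sgn-unit e = ≈-trans (^ᶻ-cong e (sgn-0 oneS) sgn-oneS) (^ᶻ-oneS e)

  unit-powers : ∀ e d → oneS ^ᶻ e ⊗ (oneS ^ᶻ d ⊗ oneS) ≈ oneS
  unit-powers e d = ≈-trans (⊗-cong (^ᶻ-oneS e) (≈-trans (⊗-identityʳ _) (^ᶻ-oneS d))) (⊗-identityˡ oneS)

sgnSymbol-sound : ∀ s e → T (if even (proj₂ s) then true else (proj₁ s ≡ᵇ proj₂ s)) → sgn (symbol s) ^ᶻ e ≈ ⟦ sgnSymbol s e ⟧ᵖ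
sgnSymbol-sound (a , b) e h with even b in eb
sgnSymbol-sound (a , b) e h | true with even a in ea
sgnSymbol-sound (zero , b) e h | true | true = ≈-trans (sgn-unit e) (≈-sym (≈-trans (∷[]-sound (0 , b) e) (^ᶻ-oneS e)))
sgnSymbol-sound (suc a , zero) e h | true | true = ≈-trans (sgn-unit e) (≈-sym (≈-trans (∷[]-sound (suc a , 0) e) (^ᶻ-oneS e)))
sgnSymbol-sound (suc a , suc b) e h | true | true = ≈-trans
  (^ᶻ-cong e (sgn-0′ (suc a , suc b)) (sgn-pochS-even (suc a) (suc b) (σ-even? (suc b) (subst T (sym eb) tt)) (σ-even? (suc a) (subst T (sym ea) tt))))
  (≈-sym (∷[]-sound (suc a , suc b) e))
sgnSymbol-sound (suc a , zero) e h | true | false = ≈-trans (sgn-unit e) (≈-sym (unit-powers e (- e)))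
sgnSymbol-sound (suc a , suc b) e h | true | false = ≈-trans
  (quotient-power e (sgn-0′ s) (symbol-0 s₂) (symbol-0 s)
    (⊗-recip-unique (symbol-0 s) (sgn-pochS-odd (suc a) (suc b) (σ-even? (suc b) (subst T (sym eb) tt))
      (σ-odd? (suc a) (subst T (cong not (sym ea)) tt)))))
  (⊗-cong ≈-refl (≈-sym (∷[]-sound s (- e))))
  where
  s s₂ : Symbol
  s  = suc a , suc b
  s₂ = 2 * suc a , 2 * suc b
sgnSymbol-sound (a , b) e h | false with ℕₚ.≡ᵇ⇒≡ a b h
sgnSymbol-sound (zero , zero) e h | false | refl with eb
... | ()
sgnSymbol-sound (suc a , suc a) e h | false | refl = ≈-trans
  (quotient-power {h = symbol s ⊗ symbol s₄} e (sgn-0′ s) (⊗-unit {symbol s₂} (symbol-0 s₂) E²-0) (⊗-unit {symbol s} (symbol-0 s) (symbol-0 s₄))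
    (⊗-recip-unique (⊗-unit {symbol s} (symbol-0 s) (symbol-0 s₄)) (sgn-euler (suc a) (σ-odd? (suc a) (subst T (cong not (sym eb)) tt)))))
  (≈-trans (⊗-cong (≈-trans (^ᶻ-⊗ e (symbol-0 s₂) E²-0) (⊗-cong ≈-refl (^ᶻ-⊗ e (symbol-0 s₂) (symbol-0 s₂))))
                    (^ᶻ-⊗ (- e) (symbol-0 s) (symbol-0 s₄)))
    (solve 3 (λ x y z → x :* (x :* x) :* (y :* z) := x :* (x :* (x :* (y :* (z :* con 1ℤ))))) ≈-refl
      (symbol s₂ ^ᶻ e) (symbol s ^ᶻ (- e)) (symbol s₄ ^ᶻ (- e))))
  where
  s s₂ s₄ : Symbol
  s  = suc a , suc a
  s₂ = 2 * suc a , 2 * suc a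
  s₄ = 4 * suc a , 4 * suc a
  E²-0 : (symbol s₂ ⊗ symbol s₂) 0 ≡ 1ℤ
  E²-0 = ⊗-unit {symbol s₂} (symbol-0 s₂) (symbol-0 s₂)

sgnPowers-sound : ∀ l → T (signable l) → sgn ⟦ l ⟧ᵖ ≈ ⟦ sgnPowers l ⟧ᵖ
sgnPowers-sound []            _ = sgn-oneS
sgnPowers-sound ((s , e) ∷ l) h with Equivalence.to T-∧ h
... | h₁ , h₂ = ≈-trans (sgn-⊗ (symbol s ^ᶻ e) ⟦ l ⟧ᵖ) (≈-trans (⊗-cong
  (≈-trans (^ᶻ-hom sgn sgn-oneS sgn-⊗ (sgn-recip (symbol-0 s)) e) (sgnSymbol-sound s e h₁)) (sgnPowers-sound l h₂))
  (≈-sym (⊙-sound (sgnSymbol s e) (sgnPowers l))))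

sgnPoly : Poly → Poly
sgnPoly = map λ { (c , k , l) → c ℤ.* σ k , k , sgnPowers l }

signablePoly : Poly → Bool
signablePoly []                = true
signablePoly ((_ , _ , l) ∷ p) = signable l ∧ signablePoly p

sgnPoly-sound : ∀ p → T (signablePoly p) → sgn ⟦ p ⟧ ≈ ⟦ sgnPoly p ⟧
sgnPoly-sound []                _ = sgn-zeroS
sgnPoly-sound ((c , k , l) ∷ p) h with Equivalence.to T-∧ h
... | h₁ , h₂ = ≈-trans (sgn-⊕ ⟦ c , k , l ⟧ᵗ ⟦ p ⟧) (⊕-cong
  (≈-trans (sgn-· c (Q k ⊗ ⟦ l ⟧ᵖ)) (≈-trans (·-cong c (≈-trans (sgn-⊗ (Q k) ⟦ l ⟧ᵖ)
    (≈-trans (⊗-cong (sgn-Q k) (sgnPowers-sound l h₁)) (·-⊗ (σ k) (Q k) ⟦ sgnPowers l ⟧ᵖ)))) (·-· c (σ k) (Q k ⊗ ⟦ sgnPowers l ⟧ᵖ))))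
  (sgnPoly-sound p h₂))

-- Progressions of coefficients of polynomials whose symbols are functions of q^k

module _ (k : ℕ) .{{_ : NonZero k}} where

  contractPowers : Powers → Powers
  contractPowers = map λ { ((a , b) , e) → (a / k , b / k) , e }

  contractible : Powers → Bool
  contractible []                  = true
  contractible (((a , b) , e) ∷ l) = (a % k ≡ᵇ 0) ∧ (b % k ≡ᵇ 0) ∧ contractible l

  contract-sound : ∀ l → T (contractible l) → dilatePowers k (contractPowers l) ≡ l
  contract-sound []                  _ = refl
  contract-sound (((a , b) , e) ∷ l) h with Equivalence.to T-∧ h
  ... | h₁ , h' with Equivalence.to T-∧ h'
  ...   | h₂ , h₃ = cong₂ _∷_ (cong (_, e) (cong₂ _,_ (exact a h₁) (exact b h₂))) (contract-sound l h₃)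
    where
    exact : ∀ n → T (n % k ≡ᵇ 0) → k * (n / k) ≡ n
    exact n p = trans (ℕₚ.*-comm k (n / k)) (sym (trans (m≡m%n+[m/n]*n n k) (cong (_+ n / k * k) (ℕₚ.≡ᵇ⇒≡ (n % k) 0 p))))

  extract : ℕ → Poly → Poly
  extract r []                = []
  extract r ((c , j , l) ∷ p) =
    if j % k ≡ᵇ r then (c , j / k , contractPowers l) ∷ extract r p else extract r p

  contractiblePoly : Poly → Bool
  contractiblePoly []                = true
  contractiblePoly ((_ , _ , l) ∷ p) = contractible l ∧ contractiblePoly p

  U-Q : ∀ r j → r < k → U k r (Q j) ≈ (if j % k ≡ᵇ r then Q (j / k) else zeroS)
  U-Q r j r<k = coeffwise λ n → trans (U-at k r (Q j) n) (trans (Q-indicator j (k * n + r)) (compare n))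
    where
    j≡ : j ≡ k * (j / k) + j % k
    j≡ = trans (m≡m%n+[m/n]*n j k) (trans (ℕₚ.+-comm (j % k) _) (cong (_+ j % k) (ℕₚ.*-comm (j / k) k)))
    compare : ∀ n → (if k * n + r ≡ᵇ j then 1ℤ else 0ℤ) ≡ (if j % k ≡ᵇ r then Q (j / k) else zeroS) n
    compare n with j % k ≡ᵇ r in eq
    ... | false = cong (λ b → if b then 1ℤ else 0ℤ) (≢⇒≡ᵇ-false λ e →
            subst T (trans (cong (_≡ᵇ r) (trans (sym (residue k n r<k)) (cong (_% k) e))) eq) (subst T (sym (≡ᵇ-refl r)) tt))
    ... | true = trans (cong (λ b → if b then 1ℤ else 0ℤ) same) (sym (Q-indicator (j / k) n))
      where
      r≡ : j % k ≡ r
      r≡ = ℕₚ.≡ᵇ⇒≡ (j % k) r (subst T (sym eq) tt)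
      same : (k * n + r ≡ᵇ j) ≡ (n ≡ᵇ j / k)
      same with n ℕₚ.≟ j / k
      ... | yes refl = trans (cong (_≡ᵇ j) (trans (cong (k * (j / k) +_) (sym r≡)) (sym j≡))) (trans (≡ᵇ-refl j) (sym (≡ᵇ-refl (j / k))))
      ... | no n≢ = trans (≢⇒≡ᵇ-false λ e → n≢ (trans (sym (quotient k n r<k)) (cong (_/ k) e))) (sym (≢⇒≡ᵇ-false n≢))

  extract-sound : ∀ r p → r < k → T (contractiblePoly p) → U k r ⟦ p ⟧ ≈ ⟦ extract r p ⟧
  extract-sound r []                r<k _ = U-zeroS k r
  extract-sound r ((c , j , l) ∷ p) r<k h with Equivalence.to T-∧ h
  ... | h₁ , h₂ = ≈-trans (U-⊕ k r ⟦ c , j , l ⟧ᵗ ⟦ p ⟧) (≈-trans (⊕-cong head-sound (extract-sound r p r<k h₂)) (combine (j % k ≡ᵇ r)))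
    where
    l' : Powers
    l' = contractPowers l
    head-sound : U k r ⟦ c , j , l ⟧ᵗ ≈ c · (⟦ l' ⟧ᵖ ⊗ (if j % k ≡ᵇ r then Q (j / k) else zeroS))
    head-sound = ≈-trans (U-· k r c (Q j ⊗ ⟦ l ⟧ᵖ)) (·-cong c (≈-trans (U-cong k r (≈-trans (⊗-comm (Q j) ⟦ l ⟧ᵖ)
        (⊗-cong (≈-trans (≡⇒≈ (cong ⟦_⟧ᵖ (sym (contract-sound l h₁)))) (≈-sym (dilatePowers-sound k l'))) ≈-refl)))
      (≈-trans (U-dilate-⊗ k ⟦ l' ⟧ᵖ (Q j) r<k) (⊗-cong ≈-refl (U-Q r j r<k)))))
    combine : ∀ b → c · (⟦ l' ⟧ᵖ ⊗ (if b then Q (j / k) else zeroS)) ⊕ ⟦ extract r p ⟧ ≈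
      ⟦ if b then (c , j / k , l') ∷ extract r p else extract r p ⟧
    combine true  = ⊕-cong (·-cong c (⊗-comm ⟦ l' ⟧ᵖ (Q (j / k)))) ≈-refl
    combine false = ≈-trans (⊕-cong (≈-trans (·-cong c (⊗-zeroʳ ⟦ l' ⟧ᵖ)) (·-zeroS c)) ≈-refl) (⊕-identityˡ _)

-- Null polynomials and vanishing progressions

record Null (p : Poly) : Set where
  constructor null
  field isNull : ⟦ p ⟧ ≈ zeroS
open Null

≈⇒Null : ∀ p r → ⟦ p ⟧ ≈ ⟦ r ⟧ → Null (p ⊟ r)
≈⇒Null p r h = null (≈-trans (⊟-sound p r) (≈-trans (⊕-cong h ≈-refl) (⊕-inverseʳ ⟦ r ⟧)))

Null⇒≈ : ∀ {p r} → Null (p ⊟ r) → ⟦ p ⟧ ≈ ⟦ r ⟧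
Null⇒≈ {p} {r} (null h) = begin
  ⟦ p ⟧                          ≈⟨ solve 2 (λ x y → x := (x :+ :- y) :+ y) ≈-refl ⟦ p ⟧ ⟦ r ⟧ ⟩
  ⟦ p ⟧ ⊕ ⊖ ⟦ r ⟧ ⊕ ⟦ r ⟧         ≈⟨ ⊕-cong (≈-trans (≈-sym (⊟-sound p r)) h) ≈-refl ⟩
  zeroS ⊕ ⟦ r ⟧                  ≈⟨ ⊕-identityˡ ⟦ r ⟧ ⟩
  ⟦ r ⟧                          ∎
  where open ≈-Reasoning

Null-[] : Null []
Null-[] = null ≈-refl

infixl 6 _⟨+⟩_
infixr 6.5 _⟨*⟩_

_⟨+⟩_ : ∀ {p r} → Null p → Null r → Null (p ⊞ r)
_⟨+⟩_ {p} {r} (null h) (null h') = null (≈-trans (⟦⟧-++ p r) (≈-trans (⊕-cong h h') (⊕-identityˡ zeroS)))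

_⟨*⟩_ : ∀ p {r} → Null r → Null (p ⋆ r)
_⟨*⟩_ p {r} (null h) = null (≈-trans (⋆-sound p r) (≈-trans (⊗-cong ≈-refl h) (⊗-zeroʳ ⟦ p ⟧)))

-- The form of every identity below: r is a combination of null polynomials, and the hidden
-- argument, solved by evaluation, confirms that p has the same normal form.
linear : ∀ {r} p → Null r → {_ : T (vanishes (p ⊟ r))} → Null p
linear {r} p (null h) {v} = null (≈-trans (Null⇒≈ {p} {r} (null (≈-trans (≈-sym (collect-sound (p ⊟ r)))
  (coefficientsZero-sound (collect (p ⊟ r)) v)))) h)

Null-dilate : ∀ m .{{_ : NonZero m}} {p} → Null p → Null (dilatePoly m p)
Null-dilate m {p} (null h) = null (≈-trans (≈-sym (dilatePoly-sound m p)) (≈-trans (dilate-cong m h) (dilate-zeroS m)))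

Null-sgn : ∀ {p} → Null p → {_ : T (signablePoly p)} → Null (sgnPoly p)
Null-sgn {p} (null h) {s} = null (≈-trans (≈-sym (sgnPoly-sound p s)) (≈-trans (sgn-cong h) sgn-zeroS))

Null-extract : ∀ k r .{{_ : NonZero k}} {p} → Null p → {_ : T (r <ᵇ k)} {_ : T (contractiblePoly k p)} → Null (extract k r p)
Null-extract k r {p} (null h) {r<k} {c} =
  null (≈-trans (≈-sym (extract-sound k r p (ℕₚ.<ᵇ⇒< r k r<k) c)) (≈-trans (U-cong k r h) (U-zeroS k r)))

-- `linear` divides neither by integers nor by q; both divisions are sound because a nonzero
-- monomial is not a zero divisor.
Null-cancel : ∀ c .{{_ : ℤ.NonZero c}} k {p} → Null (((c , k , []) ∷ []) ⋆ p) → Null p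
Null-cancel c k {p} (null h) = null (Q-cancel k (≈-trans scaled (≈-sym (⊗-zeroʳ (Q k)))))
  where
  product : ⟦ ((c , k , []) ∷ []) ⋆ p ⟧ ≈ c · (Q k ⊗ ⟦ p ⟧)
  product = ≈-trans (⋆-sound ((c , k , []) ∷ []) p) (≈-trans (⊗-cong (≈-trans (⊕-identityʳ _) (·-cong c (⊗-identityʳ (Q k)))) ≈-refl)
    (·-⊗ c (Q k) ⟦ p ⟧))
  scaled : Q k ⊗ ⟦ p ⟧ ≈ zeroS
  scaled = coeffwise λ n → ℤₚ.*-cancelˡ-≡ c _ _ (trans (sym (·-at c (Q k ⊗ ⟦ p ⟧) n))
    (trans (at (≈-trans (≈-sym product) h) n) (sym (ℤₚ.*-zeroʳ c))))

record Vanish (m r : ℕ) (p : Poly) : Set where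
  constructor vanish
  field coefficient : ∀ n → ⟦ p ⟧ (m * n + r) ≡ 0ℤ
open Vanish

Vanish-zero : ∀ p {m r} {_ : T (vanishes p)} → Vanish m r p
Vanish-zero p {m} {r} {v} = vanish λ n → at (≈-trans (≈-sym (collect-sound p)) (coefficientsZero-sound (collect p) v)) (m * n + r)

Vanish-null : ∀ {p r m s} → Null (p ⊟ r) → Vanish m s r → Vanish m s p
Vanish-null {p} {r} {m} {s} h v = vanish λ n → trans (at (Null⇒≈ {p} {r} h) (m * n + s)) (coefficient v n)

-- Writes m n + r as k (m/k n + r/k) + r % k. Read backwards it is one dissection step: m and r are
-- divided by k and q^k becomes q.
Vanish-extract : ∀ k .{{_ : NonZero k}} {p m r} → Vanish (m / k) (r / k) (extract k (r % k) p) →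
  {_ : T (m % k ≡ᵇ 0)} {_ : T (contractiblePoly k p)} → Vanish m r p
Vanish-extract k {p} {m} {r} v {k∣m} {c} = vanish λ n → trans (cong ⟦ p ⟧ (index n))
  (trans (sym (U-at k (r % k) ⟦ p ⟧ (m / k * n + r / k)))
    (trans (at (extract-sound k (r % k) p (m%n<n r k) c) (m / k * n + r / k)) (coefficient v n)))
  where
  lemma : ∀ k a n b s → a * k * n + (s + b * k) ≡ k * (a * n + b) + s
  lemma = ℕR.solve-∀
  index : ∀ n → m * n + r ≡ k * (m / k * n + r / k) + r % k
  index n = trans (cong₂ (λ x y → x * n + y)
      (trans (m≡m%n+[m/n]*n m k) (cong (_+ m / k * k) (ℕₚ.≡ᵇ⇒≡ (m % k) 0 k∣m))) (m≡m%n+[m/n]*n r k))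
    (lemma k (m / k) n (r / k) (r % k))

Vanish-sub : ∀ m r j k {p} → Vanish m r p → Vanish (m * k) (m * j + r) p
Vanish-sub m r j k {p} v = vanish λ n → trans (cong ⟦ p ⟧ (lemma m k n j r)) (coefficient v (k * n + j))
  where
  lemma : ∀ m k n j r → m * k * n + (m * j + r) ≡ m * (k * n + j) + r
  lemma = ℕR.solve-∀

Vanish-const : ∀ c {m r} → Vanish m (suc r) ((c , 0 , []) ∷ [])
Vanish-const c {m} {r} = vanish λ n → trans (cong ⟦ (c , 0 , []) ∷ [] ⟧ (ℕₚ.+-suc (m * n) r))
  (trans (at (≈-trans (⊕-identityʳ _) (·-cong c (⊗-identityʳ oneS))) (suc (m * n + r)))
    (trans (·-at c oneS (suc (m * n + r))) (ℤₚ.*-zeroʳ c)))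

Vanish-⊞ : ∀ p r {m s} → Vanish m s p → Vanish m s r → Vanish m s (p ⊞ r)
Vanish-⊞ p r {m} {s} v w = vanish λ n → trans (at (⟦⟧-++ p r) (m * n + s))
  (trans (⊕-at ⟦ p ⟧ ⟦ r ⟧ (m * n + s)) (cong₂ ℤ._+_ (coefficient v n) (coefficient w n)))

Vanish-sgn : ∀ {p m r} → Vanish m r p → {_ : T (signablePoly p)} → Vanish m r (sgnPoly p)
Vanish-sgn {p} {m} {r} v {s} = vanish λ n → trans (sym (at (sgnPoly-sound p s) (m * n + r)))
  (trans (sgn-at ⟦ p ⟧ (m * n + r)) (trans (cong (σ (m * n + r) ℤ.*_) (coefficient v n)) (ℤₚ.*-zeroʳ (σ (m * n + r)))))

-- Bilateral theta series  Θ ε r s = Σ_{k∈ℤ} ε^k q^(r k(k+1)/2 + s k(k-1)/2)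

data IsSign : ℤ → Set where
  plus  : IsSign 1ℤ
  minus : IsSign -1ℤ

sign² : ∀ {ε} → IsSign ε → ε ℤ.* ε ≡ 1ℤ
sign² plus  = refl
sign² minus = refl

sign-2j : ∀ {ε} → IsSign ε → ∀ j → ε ℤ.^ (2 * j) ≡ 1ℤ
sign-2j {ε} i j = trans (sym (ℤₚ.^-*-assoc ε 2 j)) (trans (cong (ℤ._^ j) (square i)) (ℤₚ.^-zeroˡ j))
  where
  square : ∀ {ε} → IsSign ε → ε ℤ.^ 2 ≡ 1ℤ
  square plus  = refl
  square minus = refl

sign-3j : ∀ {ε} → IsSign ε → ∀ j → ε ℤ.^ (3 * j) ≡ ε ℤ.^ j
sign-3j {ε} i j = trans (sym (ℤₚ.^-*-assoc ε 3 j)) (cong (ℤ._^ j) (cube i))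
  where
  cube : ∀ {ε} → IsSign ε → ε ℤ.^ 3 ≡ ε
  cube plus  = refl
  cube minus = refl

-- k (k - 1) / 2, the exponent of p in `power`.
tri : ℕ → ℕ
tri zero    = 0
tri (suc k) = tri k + k

k≤tri-suc : ∀ k → k ≤ tri (suc k)
k≤tri-suc k = ℕₚ.m≤n+m k (tri k)

tri-2j : ∀ j → tri (2 * j) ≡ 4 * tri j + j
tri-2j zero    = refl
tri-2j (suc j) = trans (cong tri (ℕₚ.*-suc 2 j)) (trans (cong (λ x → x + 2 * j + suc (2 * j)) (tri-2j j)) (lemma (tri j) j))
  where
  lemma : ∀ t j → 4 * t + j + 2 * j + (1 + 2 * j) ≡ 4 * (t + j) + (1 + j)
  lemma = ℕR.solve-∀

tri-3j : ∀ j → tri (3 * j) ≡ 9 * tri j + 3 * j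
tri-3j zero    = refl
tri-3j (suc j) = trans (cong tri (ℕₚ.*-suc 3 j)) (trans
  (cong (λ x → x + 3 * j + suc (3 * j) + suc (suc (3 * j))) (tri-3j j)) (lemma (tri j) j))
  where
  lemma : ∀ t j → 9 * t + 3 * j + 3 * j + (1 + 3 * j) + (2 + 3 * j) ≡ 9 * (t + j) + 3 * (1 + j)
  lemma = ℕR.solve-∀

mono-⊗ : ∀ c e d f → c · Q e ⊗ d · Q f ≈ (c ℤ.* d) · Q (e + f)
mono-⊗ c e d f = ≈-trans (·-⊗ c (Q e) (d · Q f)) (≈-trans (·-cong c (≈-trans (⊗-· d (Q e) (Q f)) (·-cong d (≈-sym (Q-+ e f)))))
  (·-· c d (Q (e + f))))

mono-≡ : ∀ {c d e f} → c ≡ d → e ≡ f → c · Q e ≈ d · Q f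
mono-≡ refl refl = ≈-refl

mono-order : ∀ c {e N} → N ≤ e → c · Q e ≡[ N ] zeroS
mono-order c {e} N≤e i i<N = trans (·-at c (Q e) i) (trans (cong (c ℤ.*_) (Q-off-diag e i (ℕₚ.<-≤-trans i<N N≤e))) (ℤₚ.*-zeroʳ c))

summand : ℤ → ℕ → ℕ → ℕ → PS
summand ε r t k = (ε ℤ.^ k) · Q (r * k + t * tri k)

Θ : ℤ → ℕ → ℕ → PS
Θ ε r s = ∑∞ (summand ε r (r + s)) ⊕ ∑∞ (summand ε s (r + s) ∘ suc)

summable : ∀ ε r t .{{_ : NonZero r}} → Summable (summand ε r t)
summable ε r t k = mono-order (ε ℤ.^ k) (ℕₚ.≤-trans (ℕₚ.m≤n*m k r) (ℕₚ.m≤m+n (r * k) (t * tri k)))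

summable-suc : ∀ ε s t .{{_ : NonZero t}} → Summable (summand ε s t ∘ suc)
summable-suc ε s t k = mono-order (ε ℤ.^ suc k)
  (ℕₚ.≤-trans (k≤tri-suc k) (ℕₚ.≤-trans (ℕₚ.m≤n*m (tri (suc k)) t) (ℕₚ.m≤n+m (t * tri (suc k)) (s * suc k))))

Q-0 : ∀ r .{{_ : NonZero r}} → Q r 0 ≡ 0ℤ
Q-0 (suc r) = refl

mono-0 : ∀ c r .{{_ : NonZero r}} → (c · Q r) 0 ≡ 0ℤ
mono-0 c r = trans (·-at c (Q r) 0) (trans (cong (c ℤ.*_) (Q-0 r)) (ℤₚ.*-zeroʳ c))

-- The triple product at a = ε q^r and b = ε q^s, where ε² = 1 makes a b equal to q^(r+s).
Θ-product : ∀ {ε} → IsSign ε → ∀ r s .{{_ : NonZero r}} .{{_ : NonZero s}} →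
  Θ ε r s ≈ pochS ε r (r + s) ⊗ pochS ε s (r + s) ⊗ pochS -1ℤ (r + s) (r + s)
Θ-product {ε} i r s = ≈-trans (⊕-cong (Sum.fold∞-cong (λ k → ≈-sym (power≈ r k))) (Sum.fold∞-cong (λ k → ≈-sym (power≈ s (suc k)))))
  (≈-trans TP.triple-product (⊗-cong (⊗-cong (Product.fold∞-cong (factor≈ r)) (Product.fold∞-cong (factor≈ s))) (Product.fold∞-cong pfactor≈)))
  where
  t : ℕ
  t = r + s
  module TP = TripleProduct (ε · Q r) (ε · Q s) (Q t)
    (≈-trans (mono-⊗ ε r ε s) (≈-trans (mono-≡ {e = t} (sign² i) refl) (1· (Q t)))) (mono-0 ε r) (mono-0 ε s)
  Q^^ : ∀ k → Q t ^^ k ≈ Q (t * k)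
  Q^^ zero    = ≡⇒≈ (cong Q (sym (ℕₚ.*-zeroʳ t)))
  Q^^ (suc k) = ≈-trans (⊗-cong (Q^^ k) ≈-refl) (≈-trans (≈-sym (Q-+ (t * k) t))
    (≡⇒≈ (cong Q (trans (ℕₚ.+-comm (t * k) t) (sym (ℕₚ.*-suc t k))))))
  factor≈ : ∀ r j → oneS ⊕ ε · Q r ⊗ Q t ^^ j ≈ factor ε (r + t * j)
  factor≈ r j = ⊕-cong ≈-refl (≈-trans (·-⊗ ε (Q r) (Q t ^^ j)) (·-cong ε (≈-trans (⊗-cong ≈-refl (Q^^ j)) (≈-sym (Q-+ r (t * j))))))
  pfactor≈ : ∀ j → TP.p-factor j ≈ factor -1ℤ (t + t * j)
  pfactor≈ j = ⊕-cong ≈-refl (≈-sym (≈-trans (·-⊖ 1ℤ (Q (t + t * j))) (⊖-cong (≈-trans (1· _)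
    (≈-trans (≡⇒≈ (cong Q (sym (ℕₚ.*-suc t j)))) (≈-sym (Q^^ (suc j))))))))
  power≈ : ∀ r k → TP.power (ε · Q r) k ≈ summand ε r t k
  power≈ r zero    = ≈-trans (≈-sym (1· oneS)) (mono-≡ refl (sym (cong₂ _+_ (ℕₚ.*-zeroʳ r) (ℕₚ.*-zeroʳ t))))
  power≈ r (suc k) = ≈-trans (⊗-cong (power≈ r k) (≈-trans (·-⊗ ε (Q r) (Q t ^^ k)) (·-cong ε (≈-trans (⊗-cong ≈-refl (Q^^ k)) (≈-sym (Q-+ r (t * k)))))))
    (≈-trans (mono-⊗ (ε ℤ.^ k) (r * k + t * tri k) ε (r + t * k)) (mono-≡ (ℤₚ.*-comm (ε ℤ.^ k) ε) (lemma r t k (tri k))))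
    where
    lemma : ∀ r t k x → r * k + t * x + (r + t * k) ≡ r * (1 + k) + t * (x + k)
    lemma = ℕR.solve-∀

-- Dissections of theta series

∑∞-scale : ∀ c e {F} → Summable F → ∑∞ (λ j → c · Q e ⊗ F j) ≈ c · Q e ⊗ ∑∞ F
∑∞-scale c e u = ≈-sym (Sum.fold∞-hom (c · Q e ⊗_) (⊗-zeroʳ (c · Q e)) (⊗-distribˡ (c · Q e)) (⊗-mod mod-refl) u)

∑∞-bisect : ∀ {F} → Summable F → ∑∞ F ≈ ∑∞ (λ j → F (2 * j)) ⊕ ∑∞ (λ j → F (2 * j + 1))
∑∞-bisect {F} u = ≈-trans (Sum.fold∞-split 2 u) (⊕-cong (≈-trans (⊕-identityˡ _)
  (Sum.fold∞-cong λ j → ≡⇒≈ (cong F (ℕₚ.+-identityʳ (2 * j))))) ≈-refl)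

∑∞-trisect : ∀ {F} → Summable F → ∑∞ F ≈ ∑∞ (λ j → F (3 * j)) ⊕ ∑∞ (λ j → F (3 * j + 1)) ⊕ ∑∞ (λ j → F (3 * j + 2))
∑∞-trisect {F} u = ≈-trans (Sum.fold∞-split 3 u) (⊕-cong (⊕-cong (≈-trans (⊕-identityˡ _)
  (Sum.fold∞-cong λ j → ≡⇒≈ (cong F (ℕₚ.+-identityʳ (3 * j))))) ≈-refl) ≈-refl)

module _ {ε} (i : IsSign ε) where

  sign-2j+1 : ∀ j → ε ℤ.^ (2 * j + 1) ≡ ε
  sign-2j+1 j = trans (ℤₚ.^-distribˡ-+-* ε (2 * j) 1) (trans (cong₂ ℤ._*_ (sign-2j i j) (ℤₚ.^-identityʳ ε)) (ℤₚ.*-identityˡ ε))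

  sign-3j+1 : ∀ j → ε ℤ.^ (3 * j + 1) ≡ ε ℤ.* ε ℤ.^ j
  sign-3j+1 j = trans (cong (ε ℤ.^_) (ℕₚ.+-comm (3 * j) 1)) (cong (ε ℤ.*_) (sign-3j i j))

  sign-3j+2 : ∀ j → ε ℤ.^ (3 * j + 2) ≡ ε ℤ.* (ε ℤ.* ε ℤ.^ j)
  sign-3j+2 j = trans (cong (ε ℤ.^_) (ℕₚ.+-comm (3 * j) 2)) (cong (λ x → ε ℤ.* (ε ℤ.* x)) (sign-3j i j))

  1^ : ∀ j → 1ℤ ℤ.^ j ≡ 1ℤ
  1^ = ℤₚ.^-zeroˡ

  summand-2j : ∀ r t j → summand ε r t (2 * j) ≈ summand 1ℤ (2 * r + t) (4 * t) j
  summand-2j r t j = mono-≡ (trans (sign-2j i j) (sym (1^ j))) (trans (cong (λ x → r * (2 * j) + t * x) (tri-2j j)) (lemma r t j (tri j)))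
    where
    lemma : ∀ r t j x → r * (2 * j) + t * (4 * x + j) ≡ (2 * r + t) * j + 4 * t * x
    lemma = ℕR.solve-∀

  summand-2j+1 : ∀ r t j → summand ε r t (2 * j + 1) ≈ ε · Q r ⊗ summand 1ℤ (2 * r + 3 * t) (4 * t) j
  summand-2j+1 r t j = ≈-sym (≈-trans (mono-⊗ ε r (1ℤ ℤ.^ j) _) (mono-≡
    (trans (cong (ε ℤ.*_) (1^ j)) (trans (ℤₚ.*-identityʳ ε) (sym (sign-2j+1 j))))
    (trans (lemma r t j (tri j)) (sym (cong (λ x → r * (2 * j + 1) + t * x)
      (trans (cong tri (ℕₚ.+-comm (2 * j) 1)) (cong (_+ 2 * j) (tri-2j j))))))))
    where
    lemma : ∀ r t j x → r + ((2 * r + 3 * t) * j + 4 * t * x) ≡ r * (2 * j + 1) + t * (4 * x + j + 2 * j)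
    lemma = ℕR.solve-∀

  module _ (r u : ℕ) .{{_ : NonZero r}} where

    private
      s t : ℕ
      s = r + u
      t = r + s

      instance
        t≢0 : NonZero t
        t≢0 = ℕ.>-nonZero (ℕₚ.≤-trans (ℕₚ.n≢0⇒n>0 (ℕ.≢-nonZero⁻¹ r)) (ℕₚ.m≤m+n r s))
        4t≢0 : NonZero (4 * t)
        4t≢0 = ℕₚ.m*n≢0 4 t
        2r+3t≢0 : NonZero (2 * r + 3 * t)
        2r+3t≢0 = ℕ.>-nonZero (ℕₚ.≤-trans (ℕₚ.n≢0⇒n>0 (ℕ.≢-nonZero⁻¹ (3 * t) {{ℕₚ.m*n≢0 3 t}})) (ℕₚ.m≤n+m (3 * t) (2 * r)))

      -- `Θ` with its modulus kept as 4 t instead of the sum of the parameters, so that the pieces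
      -- match as they stand; `retype` converts it.
      Θ′ : ℕ → ℕ → PS
      Θ′ a b = ∑∞ (summand 1ℤ a (4 * t)) ⊕ ∑∞ (summand 1ℤ b (4 * t) ∘ suc)

      suc-2j : ∀ j → summand ε s t (suc (2 * j)) ≈ ε · Q r ⊗ summand 1ℤ u (4 * t) (suc j)
      suc-2j j = ≈-trans (≡⇒≈ (cong (summand ε s t) (ℕₚ.+-comm 1 (2 * j)))) (≈-trans (summand-2j+1 s t j)
        (≈-trans (mono-⊗ ε s (1ℤ ℤ.^ j) _) (≈-trans (mono-≡ (cong (ε ℤ.*_) (trans (1^ j) (sym (1^ (suc j))))) (lemma r u j (tri j)))
          (≈-sym (mono-⊗ ε r (1ℤ ℤ.^ suc j) _)))))
        where
        lemma : ∀ r u j x → r + u + ((2 * (r + u) + 3 * (r + (r + u))) * j + 4 * (r + (r + u)) * x)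
          ≡ r + (u * (1 + j) + 4 * (r + (r + u)) * (x + j))
        lemma = ℕR.solve-∀

      suc-2j+1 : ∀ j → summand ε s t (suc (2 * j + 1)) ≈ summand 1ℤ (2 * s + t) (4 * t) (suc j)
      suc-2j+1 j = ≈-trans (≡⇒≈ (cong (summand ε s t) (trans (cong suc (ℕₚ.+-comm (2 * j) 1)) (sym (ℕₚ.*-suc 2 j))))) (summand-2j s t (suc j))

    Θ-bisect′ : Θ ε r s ≈ Θ′ (2 * r + t) (2 * s + t) ⊕ ε · Q r ⊗ Θ′ (2 * r + 3 * t) u
    Θ-bisect′ = ≈-trans (⊕-cong
      (≈-trans (∑∞-bisect (summable ε r t)) (⊕-cong (Sum.fold∞-cong (summand-2j r t))
        (≈-trans (Sum.fold∞-cong (summand-2j+1 r t)) (∑∞-scale ε r (summable 1ℤ (2 * r + 3 * t) (4 * t))))))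
      (≈-trans (∑∞-bisect (summable-suc ε s t)) (⊕-cong
        (≈-trans (Sum.fold∞-cong suc-2j) (∑∞-scale ε r (summable-suc 1ℤ u (4 * t)))) (Sum.fold∞-cong suc-2j+1))))
      (solve 5 (λ a b c d m → (a :+ m :* b) :+ (m :* c :+ d) := (a :+ d) :+ m :* (b :+ c)) ≈-refl _ _ _ _ (ε · Q r))

    -- Terms are sorted by the parity of the index, and the sign survives only as the factor ε of
    -- the odd ones. One parameter of the odd part is s - r, hence the form s = r + u.
    Θ-bisect : Θ ε r s ≈ Θ 1ℤ (2 * r + t) (2 * s + t) ⊕ ε · Q r ⊗ Θ 1ℤ (2 * r + 3 * t) u
    Θ-bisect = ≈-trans Θ-bisect′ (⊕-cong (retype (2 * r + t) (2 * s + t) (lemma₁ r u))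
      (⊗-cong ≈-refl (retype (2 * r + 3 * t) u (lemma₂ r u))))
      where
      retype : ∀ a b → 4 * t ≡ a + b → Θ′ a b ≈ Θ 1ℤ a b
      retype a b e = ≡⇒≈ (cong (λ x → ∑∞ (summand 1ℤ a x) ⊕ ∑∞ (summand 1ℤ b x ∘ suc)) e)
      lemma₁ : ∀ r u → 4 * (r + (r + u)) ≡ 2 * r + (r + (r + u)) + (2 * (r + u) + (r + (r + u)))
      lemma₁ = ℕR.solve-∀
      lemma₂ : ∀ r u → 4 * (r + (r + u)) ≡ 2 * r + 3 * (r + (r + u)) + u
      lemma₂ = ℕR.solve-∀

  summand-3j : ∀ r t j → summand ε r t (3 * j) ≈ summand ε (3 * r + 3 * t) (9 * t) j
  summand-3j r t j = mono-≡ (sign-3j i j) (trans (cong (λ x → r * (3 * j) + t * x) (tri-3j j)) (lemma r t j (tri j)))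
    where
    lemma : ∀ r t j x → r * (3 * j) + t * (9 * x + 3 * j) ≡ (3 * r + 3 * t) * j + 9 * t * x
    lemma = ℕR.solve-∀

  summand-3j+1 : ∀ r t j → summand ε r t (3 * j + 1) ≈ ε · Q r ⊗ summand ε (3 * r + 6 * t) (9 * t) j
  summand-3j+1 r t j = ≈-sym (≈-trans (mono-⊗ ε r (ε ℤ.^ j) _) (mono-≡ (sym (sign-3j+1 j))
    (trans (lemma r t j (tri j)) (sym (cong (λ x → r * (3 * j + 1) + t * x)
      (trans (cong tri (ℕₚ.+-comm (3 * j) 1)) (cong (_+ 3 * j) (tri-3j j))))))))
    where
    lemma : ∀ r t j x → r + ((3 * r + 6 * t) * j + 9 * t * x) ≡ r * (3 * j + 1) + t * (9 * x + 3 * j + 3 * j)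
    lemma = ℕR.solve-∀

  -- Since 3j + 2 = 3(j + 1) - 1, these terms of the nonnegative half land in the negative half of
  -- the series that carries the factor q^s.
  summand-3j+2 : ∀ r s j → summand ε r (r + s) (3 * j + 2) ≈ ε · Q s ⊗ summand ε (3 * r) (9 * (r + s)) (suc j)
  summand-3j+2 r s j = ≈-sym (≈-trans (mono-⊗ ε s (ε ℤ.^ suc j) _) (mono-≡ (sym (sign-3j+2 j))
    (trans (lemma r s j (tri j)) (sym (cong (λ x → r * (3 * j + 2) + (r + s) * x)
      (trans (cong tri (ℕₚ.+-comm (3 * j) 2)) (cong (λ x → x + 3 * j + suc (3 * j)) (tri-3j j))))))))
    where
    lemma : ∀ r s j x → s + (3 * r * (1 + j) + 9 * (r + s) * (x + j)) ≡ r * (3 * j + 2) + (r + s) * (9 * x + 3 * j + 3 * j + (1 + 3 * j))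
    lemma = ℕR.solve-∀

  module _ (r s : ℕ) .{{_ : NonZero r}} .{{_ : NonZero s}} where

    private
      t : ℕ
      t = r + s

      instance
        t≢0 : NonZero t
        t≢0 = ℕ.>-nonZero (ℕₚ.≤-trans (ℕₚ.n≢0⇒n>0 (ℕ.≢-nonZero⁻¹ r)) (ℕₚ.m≤m+n r s))
        9t≢0 : NonZero (9 * t)
        9t≢0 = ℕₚ.m*n≢0 9 t
        3r+6t≢0 : NonZero (3 * r + 6 * t)
        3r+6t≢0 = ℕ.>-nonZero (ℕₚ.≤-trans (ℕₚ.n≢0⇒n>0 (ℕ.≢-nonZero⁻¹ (6 * t) {{ℕₚ.m*n≢0 6 t}})) (ℕₚ.m≤n+m (6 * t) (3 * r)))
        3s+6t≢0 : NonZero (3 * s + 6 * t)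
        3s+6t≢0 = ℕ.>-nonZero (ℕₚ.≤-trans (ℕₚ.n≢0⇒n>0 (ℕ.≢-nonZero⁻¹ (6 * t) {{ℕₚ.m*n≢0 6 t}})) (ℕₚ.m≤n+m (6 * t) (3 * s)))

      Θ′ : ℕ → ℕ → PS
      Θ′ a b = ∑∞ (summand ε a (9 * t)) ⊕ ∑∞ (summand ε b (9 * t) ∘ suc)

      suc-3j : ∀ j → summand ε s t (suc (3 * j)) ≈ ε · Q s ⊗ summand ε (3 * s + 6 * t) (9 * t) j
      suc-3j j = ≈-trans (≡⇒≈ (cong (summand ε s t) (ℕₚ.+-comm 1 (3 * j)))) (summand-3j+1 s t j)

      suc-3j+1 : ∀ j → summand ε s t (suc (3 * j + 1)) ≈ ε · Q r ⊗ summand ε (3 * s) (9 * t) (suc j)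
      suc-3j+1 j = ≈-trans (≡⇒≈ (cong₂ (λ x y → summand ε s x y) (ℕₚ.+-comm r s) (sym (ℕₚ.+-suc (3 * j) 1))))
        (≈-trans (summand-3j+2 s r j) (⊗-cong ≈-refl (≡⇒≈ (cong (λ x → summand ε (3 * s) (9 * x) (suc j)) (ℕₚ.+-comm s r)))))

      suc-3j+2 : ∀ j → summand ε s t (suc (3 * j + 2)) ≈ summand ε (3 * s + 3 * t) (9 * t) (suc j)
      suc-3j+2 j = ≈-trans (≡⇒≈ (cong (summand ε s t) (trans (cong suc (ℕₚ.+-comm (3 * j) 2)) (sym (ℕₚ.*-suc 3 j))))) (summand-3j s t (suc j))

    -- The index is taken modulo 3 with representatives 0, 1 and -1; the terms of index 1 and -1 are
    -- ε q^r and ε q^s.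
    Θ-trisect : Θ ε r s ≈ Θ ε (3 * r + 3 * t) (3 * s + 3 * t) ⊕ ε · Q r ⊗ Θ ε (3 * r + 6 * t) (3 * s) ⊕ ε · Q s ⊗ Θ ε (3 * s + 6 * t) (3 * r)
    Θ-trisect = ≈-trans (⊕-cong
      (≈-trans (∑∞-trisect (summable ε r t)) (⊕-cong (⊕-cong (Sum.fold∞-cong (summand-3j r t))
        (≈-trans (Sum.fold∞-cong (summand-3j+1 r t)) (∑∞-scale ε r (summable ε (3 * r + 6 * t) (9 * t)))))
        (≈-trans (Sum.fold∞-cong (summand-3j+2 r s)) (∑∞-scale ε s (summable-suc ε (3 * r) (9 * t))))))
      (≈-trans (∑∞-trisect (summable-suc ε s t)) (⊕-cong (⊕-cong
        (≈-trans (Sum.fold∞-cong suc-3j) (∑∞-scale ε s (summable ε (3 * s + 6 * t) (9 * t))))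
        (≈-trans (Sum.fold∞-cong suc-3j+1) (∑∞-scale ε r (summable-suc ε (3 * s) (9 * t))))) (Sum.fold∞-cong suc-3j+2))))
      (≈-trans (solve 8 (λ a b c d e f m n → (a :+ m :* b :+ n :* c) :+ (n :* d :+ m :* e :+ f)
           := (a :+ f) :+ m :* (b :+ e) :+ n :* (d :+ c)) ≈-refl _ _ _ _ _ _ (ε · Q r) (ε · Q s))
        (⊕-cong (⊕-cong (retype (3 * r + 3 * t) (3 * s + 3 * t) (lemma₁ r s)) (⊗-cong ≈-refl (retype (3 * r + 6 * t) (3 * s) (lemma₂ r s))))
          (⊗-cong ≈-refl (retype (3 * s + 6 * t) (3 * r) (lemma₃ r s)))))
      where
      retype : ∀ a b → 9 * t ≡ a + b → Θ′ a b ≈ Θ ε a b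
      retype a b e = ≡⇒≈ (cong (λ x → ∑∞ (summand ε a x) ⊕ ∑∞ (summand ε b x ∘ suc)) e)
      lemma₁ : ∀ r s → 9 * (r + s) ≡ 3 * r + 3 * (r + s) + (3 * s + 3 * (r + s))
      lemma₁ = ℕR.solve-∀
      lemma₂ : ∀ r s → 9 * (r + s) ≡ 3 * r + 6 * (r + s) + 3 * s
      lemma₂ = ℕR.solve-∀
      lemma₃ : ∀ r s → 9 * (r + s) ≡ 3 * s + 6 * (r + s) + 3 * r
      lemma₃ = ℕR.solve-∀

-- Both sides are ψ(q^r): even and odd indices on the left are the two halves of the bilateral
-- series.
∑∞-triangular : ∀ r .{{_ : NonZero r}} → ∑∞ (summand 1ℤ r r) ≈ Θ 1ℤ (3 * r) r
∑∞-triangular r = ≈-trans (∑∞-bisect (summable 1ℤ r r)) (⊕-cong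
  (Sum.fold∞-cong λ j → ≈-trans (summand-2j plus r r j) (≡⇒≈ (cong₂ (λ x y → summand 1ℤ x y j) (lemma₁ r) (lemma₂ r))))
  (Sum.fold∞-cong λ j → ≈-trans (summand-2j+1 plus r r j) (≈-trans (mono-⊗ 1ℤ r (1ℤ ℤ.^ j) _) (mono-≡ refl (lemma₃ r j (tri j))))))
  where
  lemma₁ : ∀ r → 2 * r + r ≡ 3 * r
  lemma₁ = ℕR.solve-∀
  lemma₂ : ∀ r → 4 * r ≡ 3 * r + r
  lemma₂ = ℕR.solve-∀
  lemma₃ : ∀ r j x → r + ((2 * r + 3 * r) * j + 4 * r * x) ≡ r * (1 + j) + (3 * r + r) * (x + j)
  lemma₃ = ℕR.solve-∀

-- The exponent r k (k + 1) / 2 is invariant under k ↦ -1 - k. The triple product does not cover s =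
-- 0, as q^s then has order zero.
Θ-degenerate : ∀ r .{{_ : NonZero r}} → Θ 1ℤ r 0 ≈ Θ 1ℤ (3 * r) r ⊕ Θ 1ℤ (3 * r) r
Θ-degenerate r = ⊕-cong
  (≈-trans (≡⇒≈ (cong (λ x → ∑∞ (summand 1ℤ r x)) (ℕₚ.+-identityʳ r))) (∑∞-triangular r))
  (≈-trans (Sum.fold∞-cong λ k → mono-≡ (trans (ℤₚ.^-zeroˡ (suc k)) (sym (ℤₚ.^-zeroˡ k))) (lemma r k (tri k))) (∑∞-triangular r))
  where
  lemma : ∀ r k x → (r + 0) * (x + k) ≡ r * k + r * x
  lemma = ℕR.solve-∀

-- Theta series and dissections as polynomials in the symbols

infix 7.5 _q^_·_
_q^_·_ : ℤ → ℕ → Powers → Poly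
c q^ k · l = (c , k , l) ∷ []

-- The product side of `Θ-product`; for a positive sign, (-q^r ; q^t) is written as (q^2r ; q^2t) /
-- (q^r ; q^t).
θ-powers : ℤ → ℕ → ℕ → Powers
θ-powers (ℤ.+ _)  r s = ((2 * r , 2 * (r + s)) , 1ℤ) ∷ ((r , r + s) , -1ℤ) ∷ ((2 * s , 2 * (r + s)) , 1ℤ) ∷ ((s , r + s) , -1ℤ)
                        ∷ ((r + s , r + s) , 1ℤ) ∷ []
θ-powers -[1+ _ ] r s = ((r , r + s) , 1ℤ) ∷ ((s , r + s) , 1ℤ) ∷ ((r + s , r + s) , 1ℤ) ∷ []

θ : ℤ → ℕ → ℕ → Poly
θ ε r s = 1ℤ q^ 0 · (θ-powers ε r s)

⟦monomial⟧ : ∀ c k l → ⟦ c q^ k · l ⟧ ≈ c · (Q k ⊗ ⟦ l ⟧ᵖ)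
⟦monomial⟧ c k l = ⊕-identityʳ _

⟦power⟧ : ∀ l → ⟦ 1ℤ q^ 0 · l ⟧ ≈ ⟦ l ⟧ᵖ
⟦power⟧ l = ≈-trans (⟦monomial⟧ 1ℤ 0 l) (≈-trans (1· _) (⊗-identityˡ ⟦ l ⟧ᵖ))

symbol≈pochS : ∀ a b .{{_ : NonZero a}} .{{_ : NonZero b}} → symbol (a , b) ≈ pochS -1ℤ a b
symbol≈pochS (suc a) (suc b) = ≈-refl

symbol⁺ : ∀ a b .{{_ : NonZero a}} .{{_ : NonZero b}} → pochS 1ℤ a b ≈ symbol (2 * a , 2 * b) ⊗ recip (symbol (a , b))
symbol⁺ a b = ⊗-recip-unique (symbol-0 (a , b)) (≈-trans (⊗-cong ≈-refl (symbol≈pochS a b))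
  (≈-trans (pochS-± a b) (≈-sym (symbol≈pochS (2 * a) (2 * b) {{ℕₚ.m*n≢0 2 a}} {{ℕₚ.m*n≢0 2 b}}))))

Θ≈θ : ∀ {ε} → IsSign ε → ∀ r s .{{_ : NonZero r}} .{{_ : NonZero s}} → Θ ε r s ≈ ⟦ θ ε r s ⟧
Θ≈θ {ε} i r s = ≈-trans (Θ-product i r s) (≈-sym (≈-trans (⟦power⟧ (θ-powers ε r s)) (go i)))
  where
  t : ℕ
  t = r + s
  instance
    t≢0 : NonZero t
    t≢0 = ℕ.>-nonZero (ℕₚ.≤-trans (ℕₚ.n≢0⇒n>0 (ℕ.≢-nonZero⁻¹ r)) (ℕₚ.m≤m+n r s))
  go : ∀ {ε} → IsSign ε → ⟦ θ-powers ε r s ⟧ᵖ ≈ pochS ε r t ⊗ pochS ε s t ⊗ pochS -1ℤ t t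
  go minus = ≈-trans (solve 3 (λ x y z → con 1ℤ :* x :* (con 1ℤ :* y :* (con 1ℤ :* z :* con 1ℤ)) := x :* y :* z) ≈-refl
      (symbol (r , t)) (symbol (s , t)) (symbol (t , t)))
    (⊗-cong (⊗-cong (symbol≈pochS r t) (symbol≈pochS s t)) (symbol≈pochS t t))
  go plus = ≈-trans (solve 5 (λ x x' y y' z → con 1ℤ :* x :* (con 1ℤ :* x' :* (con 1ℤ :* y :* (con 1ℤ :* y' :* (con 1ℤ :* z :* con 1ℤ))))
        := x :* x' :* (y :* y') :* z) ≈-refl
      (symbol (2 * r , 2 * t)) (recip (symbol (r , t))) (symbol (2 * s , 2 * t)) (recip (symbol (s , t))) (symbol (t , t)))
    (⊗-cong (⊗-cong (≈-sym (symbol⁺ r t)) (≈-sym (symbol⁺ s t))) (symbol≈pochS t t))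

⟦scaled⟧ : ∀ c k p → ⟦ c q^ k · [] ⋆ p ⟧ ≈ c · Q k ⊗ ⟦ p ⟧
⟦scaled⟧ c k p = ≈-trans (⋆-sound (c q^ k · []) p) (⊗-cong (≈-trans (⟦monomial⟧ c k []) (·-cong c (⊗-identityʳ (Q k)))) ≈-refl)

Θ≈θ-scaled : ∀ {ε} → IsSign ε → ∀ c k r s .{{_ : NonZero r}} .{{_ : NonZero s}} → c · Q k ⊗ Θ ε r s ≈ ⟦ c q^ k · [] ⋆ θ ε r s ⟧
Θ≈θ-scaled {ε} i c k r s = ≈-trans (⊗-cong ≈-refl (Θ≈θ i r s)) (≈-sym (⟦scaled⟧ c k (θ ε r s)))

⟦⟧-⊕ : ∀ {f g} p r → f ≈ ⟦ p ⟧ → g ≈ ⟦ r ⟧ → f ⊕ g ≈ ⟦ p ⊞ r ⟧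
⟦⟧-⊕ p r h h' = ≈-trans (⊕-cong h h') (≈-sym (⟦⟧-++ p r))

θ-bisect : ∀ {ε} → IsSign ε → ∀ r u .{{_ : NonZero r}} .{{_ : NonZero u}} → let s = r + u; t = r + s in
  Null (θ ε r s ⊟ (θ 1ℤ (2 * r + t) (2 * s + t) ⊞ ε q^ r · [] ⋆ θ 1ℤ (2 * r + 3 * t) u))
θ-bisect {ε} i r@(suc _) u@(suc _) = ≈⇒Null (θ ε r s) (θ 1ℤ a b ⊞ ε q^ r · [] ⋆ θ 1ℤ v u)
  (≈-trans (≈-sym (Θ≈θ i r s)) (≈-trans (Θ-bisect i r u)
    (⟦⟧-⊕ (θ 1ℤ a b) (ε q^ r · [] ⋆ θ 1ℤ v u) (Θ≈θ plus a b) (Θ≈θ-scaled plus ε r v u))))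
  where
  s t a b v : ℕ
  s = r + u
  t = r + s
  a = 2 * r + t
  b = 2 * s + t
  v = 2 * r + 3 * t

-- The symmetric case r = s, in which the odd part degenerates to twice a ψ.
θ-bisect-square : ∀ {ε} → IsSign ε → ∀ r .{{_ : NonZero r}} → let s = r + 0; t = r + s; v = 2 * r + 3 * t in
  Null (θ ε r s ⊟ (θ 1ℤ (2 * r + t) (2 * s + t) ⊞ ε q^ r · [] ⋆ (θ 1ℤ (3 * v) v ⊞ θ 1ℤ (3 * v) v)))
θ-bisect-square {ε} i r@(suc _) = ≈⇒Null (θ ε r s) (θ 1ℤ a b ⊞ ε q^ r · [] ⋆ (ψ ⊞ ψ))
  (≈-trans (≈-sym (Θ≈θ i r s)) (≈-trans (Θ-bisect i r 0)
    (⟦⟧-⊕ (θ 1ℤ a b) (ε q^ r · [] ⋆ (ψ ⊞ ψ)) (Θ≈θ plus a b)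
      (≈-trans (⊗-cong ≈-refl (≈-trans (Θ-degenerate v) (⟦⟧-⊕ ψ ψ (Θ≈θ plus (3 * v) v) (Θ≈θ plus (3 * v) v))))
        (≈-sym (⟦scaled⟧ ε r (ψ ⊞ ψ)))))))
  where
  s t a b v : ℕ
  s = r + 0
  t = r + s
  a = 2 * r + t
  b = 2 * s + t
  v = 2 * r + 3 * t
  ψ : Poly
  ψ = θ 1ℤ (3 * v) v

θ-trisect : ∀ {ε} → IsSign ε → ∀ r s .{{_ : NonZero r}} .{{_ : NonZero s}} → let t = r + s in
  Null (θ ε r s ⊟ (θ ε (3 * r + 3 * t) (3 * s + 3 * t) ⊞ ε q^ r · [] ⋆ θ ε (3 * r + 6 * t) (3 * s)
    ⊞ ε q^ s · [] ⋆ θ ε (3 * s + 6 * t) (3 * r)))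
θ-trisect {ε} i r@(suc _) s@(suc _) = ≈⇒Null (θ ε r s) (A ⊞ B ⊞ C)
  (≈-trans (≈-sym (Θ≈θ i r s)) (≈-trans (Θ-trisect i r s)
    (⟦⟧-⊕ (A ⊞ B) C (⟦⟧-⊕ A B (Θ≈θ i (3 * r + 3 * t) (3 * s + 3 * t)) (Θ≈θ-scaled i ε r (3 * r + 6 * t) (3 * s)))
      (Θ≈θ-scaled i ε s (3 * s + 6 * t) (3 * r)))))
  where
  t : ℕ
  t = r + s
  A B C : Poly
  A = θ ε (3 * r + 3 * t) (3 * s + 3 * t)
  B = ε q^ r · [] ⋆ θ ε (3 * r + 6 * t) (3 * s)
  C = ε q^ s · [] ⋆ θ ε (3 * s + 6 * t) (3 * r)

-- Multiplicative relations between the symbols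

infix 4 _≃_
record _≃_ (l m : Powers) : Set where
  constructor equiv
  field value : ⟦ l ⟧ᵖ ≈ ⟦ m ⟧ᵖ
open _≃_

infixl 7 _⟨∙⟩_
_⟨∙⟩_ : ∀ {l m l' m'} → l ≃ m → l' ≃ m' → l ⊙ l' ≃ m ⊙ m'
_⟨∙⟩_ {l} {m} {l'} {m'} (equiv h) (equiv h') = equiv (≈-trans (⊙-sound l l') (≈-trans (⊗-cong h h') (≈-sym (⊙-sound m m'))))

≃-inverse : ∀ {l m} → l ≃ m → inverse l ≃ inverse m
≃-inverse {l} {m} (equiv h) = equiv (≈-trans (≈-sym (recip-⟦⟧ᵖ l)) (≈-trans (recip-cong (⟦⟧ᵖ-0 l) h) (recip-⟦⟧ᵖ m)))

≃-dilate : ∀ k .{{_ : NonZero k}} {l m} → l ≃ m → dilatePowers k l ≃ dilatePowers k m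
≃-dilate k {l} {m} (equiv h) = equiv (≈-trans (≈-sym (dilatePowers-sound k l)) (≈-trans (dilate-cong k h) (dilatePowers-sound k m)))

-- It suffices that a m and b l agree as free monomials, so one product of known relations is the
-- whole certificate.
multiplicative : ∀ a b {l m} → l ≃ m → {_ : T (samePowers (a ⊙ m) (b ⊙ l))} → a ≃ b
multiplicative a b {l} {m} (equiv h) {e} = equiv (⊗-cancelˡ (⟦⟧ᵖ-0 m) (begin
  ⟦ m ⟧ᵖ ⊗ ⟦ a ⟧ᵖ  ≈⟨ ⊗-comm ⟦ m ⟧ᵖ ⟦ a ⟧ᵖ ⟩
  ⟦ a ⟧ᵖ ⊗ ⟦ m ⟧ᵖ  ≈⟨ ⊙-sound a m ⟨
  ⟦ a ⊙ m ⟧ᵖ       ≈⟨ samePowers-sound (a ⊙ m) (b ⊙ l) e ⟩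
  ⟦ b ⊙ l ⟧ᵖ       ≈⟨ ⊙-sound b l ⟩
  ⟦ b ⟧ᵖ ⊗ ⟦ l ⟧ᵖ  ≈⟨ ⊗-cong ≈-refl h ⟩
  ⟦ b ⟧ᵖ ⊗ ⟦ m ⟧ᵖ  ≈⟨ ⊗-comm ⟦ b ⟧ᵖ ⟦ m ⟧ᵖ ⟩
  ⟦ m ⟧ᵖ ⊗ ⟦ b ⟧ᵖ  ∎))
  where open ≈-Reasoning

⟪_⟫ : Powers → Poly
⟪ l ⟫ = 1ℤ q^ 0 · l

≃⇒Null : ∀ {l m} → l ≃ m → Null (⟪ l ⟫ ⊟ ⟪ m ⟫)
≃⇒Null {l} {m} (equiv h) = ≈⇒Null ⟪ l ⟫ ⟪ m ⟫ (≈-trans (⟦power⟧ l) (≈-trans h (≈-sym (⟦power⟧ m))))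

productPowers : ℕ → (ℕ → Symbol) → Powers
productPowers zero    f = []
productPowers (suc d) f = (f d , 1ℤ) ∷ productPowers d f

symbol-split : ∀ d a b .{{_ : NonZero d}} .{{_ : NonZero a}} .{{_ : NonZero b}} →
  ((a , b) , 1ℤ) ∷ [] ≃ productPowers d (λ i → a + b * i , d * b)
symbol-split d a b = equiv (≈-trans (solve 1 (λ x → con 1ℤ :* x :* con 1ℤ := x) ≈-refl (symbol (a , b)))
    (≈-trans (symbol≈pochS a b) (≈-trans (pochS-split -1ℤ a b d) (≈-trans (Product.fold-cong d λ i → ≈-sym (symbol≈pochS (a + b * i) (d * b) {{a+bi≢0 i}} {{ℕₚ.m*n≢0 d b}}))
      (≈-sym (go d))))))
  where
  f : ℕ → Symbol
  f i = a + b * i , d * b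
  a+bi≢0 : ∀ i → NonZero (a + b * i)
  a+bi≢0 i = ℕ.>-nonZero (ℕₚ.≤-trans (ℕₚ.n≢0⇒n>0 (ℕ.≢-nonZero⁻¹ a)) (ℕₚ.m≤m+n a (b * i)))
  go : ∀ n → ⟦ productPowers n f ⟧ᵖ ≈ ∏ n (symbol ∘ f)
  go zero    = ≈-refl
  go (suc n) = ≈-trans (⊗-cong (⊗-identityˡ (symbol (f n))) (go n)) (⊗-comm (symbol (f n)) (∏ n (symbol ∘ f)))

-- Eta quotients

infixl 8 _×η_^_ _÷η_^_
_×η_^_ _÷η_^_ : Powers → ℕ → ℕ → Powers
l ×η d ^ n = insert (d , d) (ℤ.+ n) l
l ÷η d ^ n = insert (d , d) (- (ℤ.+ n)) l

-- At d = 1, in Ramanujan's notation: φ(q), φ(-q), ψ(q), A(q) = f(q, q²), B(q) = f(q, q⁵) and E(q) =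
-- f(-q, -q⁵) = B(-q).
φ⁺ φ⁻ ψ A B E : ℕ → Powers
φ⁺ d = [] ×η 2 * d ^ 5 ÷η d ^ 2 ÷η 4 * d ^ 2
φ⁻ d = [] ×η d ^ 2 ÷η 2 * d ^ 1
ψ  d = [] ×η 2 * d ^ 2 ÷η d ^ 1
A  d = [] ×η 2 * d ^ 1 ×η 3 * d ^ 2 ÷η d ^ 1 ÷η 6 * d ^ 1
B  d = [] ×η 2 * d ^ 2 ×η 3 * d ^ 1 ×η 12 * d ^ 1 ÷η d ^ 1 ÷η 4 * d ^ 1 ÷η 6 * d ^ 1
E  d = [] ×η d ^ 1 ×η 6 * d ^ 2 ÷η 2 * d ^ 1 ÷η 3 * d ^ 1

minusOne : Poly
minusOne = -1ℤ q^ 0 · []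

η₁-split : ((1 , 1) , 1ℤ) ∷ [] ≃ productPowers 2 (λ i → 1 + 1 * i , 2)
η₁-split = symbol-split 2 1 1

odd-split : ((1 , 2) , 1ℤ) ∷ [] ≃ productPowers 3 (λ i → 1 + 2 * i , 6)
odd-split = symbol-split 3 1 2

θ⁻₁₂ : θ-powers -1ℤ 1 2 ≃ [] ×η 1 ^ 1
θ⁻₁₂ = multiplicative _ _ (≃-inverse (symbol-split 3 1 1))

θ⁺₁₂ : θ-powers 1ℤ 1 2 ≃ A 1
θ⁺₁₂ = multiplicative _ _ (≃-inverse (symbol-split 3 2 2) ⟨∙⟩ symbol-split 3 1 1)

-- Inclusion and exclusion over the primes 2 and 3, since 1 and 5 are the residues prime to 6.
coprime₆ : ((1 , 6) , 1ℤ) ∷ ((5 , 6) , 1ℤ) ∷ [] ≃ [] ×η 1 ^ 1 ×η 6 ^ 1 ÷η 2 ^ 1 ÷η 3 ^ 1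
coprime₆ = multiplicative _ _ (≃-inverse odd-split ⟨∙⟩ ≃-inverse η₁-split ⟨∙⟩ ≃-dilate 3 η₁-split)

θ⁺₁₅ : θ-powers 1ℤ 1 5 ≃ B 1
θ⁺₁₅ = multiplicative _ _ (≃-inverse coprime₆ ⟨∙⟩ ≃-dilate 2 coprime₆)

θ⁻₁₅ : θ-powers -1ℤ 1 5 ≃ E 1
θ⁻₁₅ = multiplicative _ _ coprime₆

θ⁻₁₁ : θ-powers -1ℤ 1 1 ≃ φ⁻ 1
θ⁻₁₁ = multiplicative _ _ (≃-inverse η₁-split ⟨∙⟩ ≃-inverse η₁-split)

θ⁺₁₁ : θ-powers 1ℤ 1 1 ≃ φ⁺ 1
θ⁺₁₁ = multiplicative _ _ (η₁-split ⟨∙⟩ η₁-split ⟨∙⟩ ≃-inverse (≃-dilate 2 η₁-split) ⟨∙⟩ ≃-inverse (≃-dilate 2 η₁-split))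

θ⁺₁₃ : θ-powers 1ℤ 1 3 ≃ ψ 1
θ⁺₁₃ = multiplicative _ _ (symbol-split 2 1 2 ⟨∙⟩ ≃-inverse (≃-dilate 2 (symbol-split 2 1 2)) ⟨∙⟩ η₁-split ⟨∙⟩ ≃-inverse (≃-dilate 2 η₁-split))

X̂ Ŷ : Powers
X̂ = θ-powers -1ℤ 1 11
Ŷ = θ-powers -1ℤ 5 7

-- The classes 1, 5, 7 and 11 modulo 12 are together those prime to 6, so `coprime₆` applies to the
-- product.
X̂Ŷ : X̂ ⊙ Ŷ ≃ [] ×η 1 ^ 1 ×η 6 ^ 1 ×η 12 ^ 2 ÷η 2 ^ 1 ÷η 3 ^ 1
X̂Ŷ = multiplicative _ _ (coprime₆ ⟨∙⟩ ≃-inverse (symbol-split 2 1 6) ⟨∙⟩ ≃-inverse (symbol-split 2 5 6))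

-- Dissections of single theta functions

euler-bisect : Null (⟪ [] ×η 1 ^ 1 ⟫ ⊟ (θ 1ℤ 5 7 ⊟ 1ℤ q^ 1 · [] ⋆ θ 1ℤ 11 1))
euler-bisect = linear _ (minusOne ⟨*⟩ ≃⇒Null θ⁻₁₂ ⟨+⟩ θ-bisect minus 1 1)

A-bisect : Null (⟪ A 1 ⟫ ⊟ (θ 1ℤ 5 7 ⊞ 1ℤ q^ 1 · [] ⋆ θ 1ℤ 11 1))
A-bisect = linear _ (minusOne ⟨*⟩ ≃⇒Null θ⁺₁₂ ⟨+⟩ θ-bisect plus 1 1)

B-bisect : Null (⟪ B 1 ⟫ ⊟ (⟪ A 8 ⟫ ⊞ 1ℤ q^ 1 · (B 4)))
B-bisect = linear _ (minusOne ⟨*⟩ ≃⇒Null θ⁺₁₅ ⟨+⟩ θ-bisect plus 1 4 ⟨+⟩ ≃⇒Null (≃-dilate 8 θ⁺₁₂)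
  ⟨+⟩ (1ℤ q^ 1 · []) ⟨*⟩ ≃⇒Null (≃-dilate 4 θ⁺₁₅))

φ-bisect : Null (⟪ φ⁻ 1 ⟫ ⊟ (⟪ φ⁺ 4 ⟫ ⊟ ℤ.+ 2 q^ 1 · (ψ 8)))
φ-bisect = linear _ (minusOne ⟨*⟩ ≃⇒Null θ⁻₁₁ ⟨+⟩ θ-bisect-square minus 1 ⟨+⟩ ≃⇒Null (≃-dilate 4 θ⁺₁₁)
  ⟨+⟩ (-[1+ 1 ] q^ 1 · []) ⟨*⟩ ≃⇒Null (≃-dilate 8 θ⁺₁₃))

-- The components of index 0 and -1 modulo 3 are the two halves of A(q³) and recombine by `A-bisect`
-- at q³.
ψ-trisect : Null (⟪ ψ 1 ⟫ ⊟ (⟪ A 3 ⟫ ⊞ 1ℤ q^ 1 · (ψ 9)))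
ψ-trisect = linear _ (minusOne ⟨*⟩ ≃⇒Null θ⁺₁₃ ⟨+⟩ θ-trisect plus 1 3 ⟨+⟩ minusOne ⟨*⟩ Null-dilate 3 A-bisect
  ⟨+⟩ (1ℤ q^ 1 · []) ⟨*⟩ ≃⇒Null (≃-dilate 9 θ⁺₁₃))

-- The components of index 1 and -1 coincide by symmetry, whence the factor 2.
φ-trisect : Null (⟪ φ⁻ 1 ⟫ ⊟ (⟪ φ⁻ 9 ⟫ ⊟ ℤ.+ 2 q^ 1 · (E 3)))
φ-trisect = linear _ (minusOne ⟨*⟩ ≃⇒Null θ⁻₁₁ ⟨+⟩ θ-trisect minus 1 1 ⟨+⟩ ≃⇒Null (≃-dilate 9 θ⁻₁₁)
  ⟨+⟩ (-[1+ 1 ] q^ 1 · []) ⟨*⟩ ≃⇒Null (≃-dilate 3 θ⁻₁₅))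

-- Identities of level dividing 48

negative : Poly → Poly
negative p = minusOne ⋆ p

E-bisect : Null (⟪ E 1 ⟫ ⊟ (⟪ A 8 ⟫ ⊟ 1ℤ q^ 1 · (B 4)))
E-bisect = linear _ (Null-sgn B-bisect)

-- B(q) B(-q) as a difference of squares. All of it is a series in q², so q² can be replaced by q,
-- and f_1 f_3 appears.
BE-bisect : Null (⟪ [] ×η 2 ^ 1 ×η 6 ^ 1 ×η 12 ^ 1 ÷η 4 ^ 1 ⟫ ⊟ (⟪ A 8 ⊙ A 8 ⟫ ⊟ 1ℤ q^ 2 · (B 4 ⊙ B 4)))
BE-bisect = linear _ (⟪ E 1 ⟫ ⟨*⟩ B-bisect ⟨+⟩ (⟪ A 8 ⟫ ⊞ 1ℤ q^ 1 · (B 4)) ⟨*⟩ E-bisect)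

η₁η₃-bisect : Null (⟪ [] ×η 1 ^ 1 ×η 3 ^ 1 ×η 6 ^ 1 ÷η 2 ^ 1 ⟫ ⊟ (⟪ A 4 ⊙ A 4 ⟫ ⊟ 1ℤ q^ 1 · (B 2 ⊙ B 2)))
η₁η₃-bisect = linear _ (Null-extract 2 0 BE-bisect)

-- q ↦ -q takes f_1 f_3 to an eta quotient in q² divided by f_1 f_3, so the dissection of the
-- reciprocal comes from that of the product.
1/η₁η₃-bisect : Null (⟪ [] ×η 2 ^ 2 ×η 6 ^ 4 ÷η 1 ^ 1 ÷η 3 ^ 1 ÷η 4 ^ 1 ÷η 12 ^ 1 ⟫ ⊟ (⟪ A 4 ⊙ A 4 ⟫ ⊞ 1ℤ q^ 1 · (B 2 ⊙ B 2)))
1/η₁η₃-bisect = linear _ (Null-sgn η₁η₃-bisect)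

-- The even part A(q⁸)² + q² B(q⁴)² is the preceding dissection at q², so each part is a single eta
-- quotient.
B²-bisect : Null (⟪ B 1 ⊙ B 1 ⟫ ⊟ (⟪ [] ×η 4 ^ 2 ×η 12 ^ 4 ÷η 2 ^ 1 ÷η 6 ^ 1 ÷η 8 ^ 1 ÷η 24 ^ 1 ⟫
  ⊞ ℤ.+ 2 q^ 1 · ([] ×η 8 ^ 1 ×η 12 ^ 1 ×η 24 ^ 1 ÷η 4 ^ 1)))
B²-bisect = linear _ ((⟪ B 1 ⟫ ⊞ ⟪ A 8 ⟫ ⊞ 1ℤ q^ 1 · (B 4)) ⟨*⟩ B-bisect ⟨+⟩ minusOne ⟨*⟩ Null-dilate 2 1/η₁η₃-bisect)

ratio-square : Null (⟪ [] ×η 3 ^ 2 ÷η 1 ^ 2 ⟫ ⊟ (⟪ [] ×η 4 ^ 4 ×η 6 ^ 1 ×η 12 ^ 2 ÷η 2 ^ 5 ÷η 8 ^ 1 ÷η 24 ^ 1 ⟫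
  ⊞ ℤ.+ 2 q^ 1 · ([] ×η 4 ^ 1 ×η 6 ^ 2 ×η 8 ^ 1 ×η 24 ^ 1 ÷η 2 ^ 4 ÷η 12 ^ 1)))
ratio-square = linear _ (⟪ [] ×η 4 ^ 2 ×η 6 ^ 2 ÷η 2 ^ 4 ÷η 12 ^ 2 ⟫ ⟨*⟩ B²-bisect)

-- The prefactor times the even part of φ(-q³) B(q); the prefactor times the whole product is the
-- eta quotient dissected below.
cubic-even : Poly
cubic-even = ⟪ [] ×η 4 ^ 2 ×η 6 ^ 2 ÷η 2 ^ 2 ÷η 12 ^ 4 ⟫ ⋆ (⟪ φ⁺ 12 ⊙ A 8 ⟫ ⊟ ℤ.+ 2 q^ 4 · (ψ 24 ⊙ B 4))

-- The odd part collapses because φ(q^12) B(q^4) - 2q² ψ(q^24) A(q^8) = E(q²)².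
cubic-bisect : Null (⟪ [] ×η 3 ^ 3 ×η 4 ^ 1 ÷η 1 ^ 1 ÷η 12 ^ 3 ⟫ ⊟ (cubic-even ⊞ 1ℤ q^ 1 · []))
cubic-bisect = linear _ (c ⋆ ⟪ B 1 ⟫ ⟨*⟩ Null-dilate 3 φ-bisect
  ⟨+⟩ c ⋆ (⟪ φ⁺ 12 ⟫ ⊟ ℤ.+ 2 q^ 3 · (ψ 24)) ⟨*⟩ B-bisect
  ⟨+⟩ c ⋆ -1ℤ q^ 1 · [] ⟨*⟩ Null-dilate 2 (Null-sgn B²-bisect))
  where
  c : Poly
  c = ⟪ [] ×η 4 ^ 2 ×η 6 ^ 2 ÷η 2 ^ 2 ÷η 12 ^ 4 ⟫

-- T̂ = q t with t as in the header; the first four turn out to be T̂ - q, T̂ + 3q, T̂ + q and T̂ - 3q.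
u* v* u v T̂ : Powers
u* = [] ×η 1 ^ 1 ×η 4 ^ 2 ×η 6 ^ 9 ÷η 2 ^ 3 ÷η 3 ^ 3 ÷η 12 ^ 6
v* = [] ×η 2 ^ 7 ×η 3 ^ 1 ÷η 1 ^ 3 ÷η 4 ^ 2 ÷η 6 ^ 1 ÷η 12 ^ 2
u  = [] ×η 3 ^ 3 ×η 4 ^ 1 ÷η 1 ^ 1 ÷η 12 ^ 3
v  = [] ×η 1 ^ 3 ×η 4 ^ 1 ×η 6 ^ 2 ÷η 2 ^ 2 ÷η 3 ^ 1 ÷η 12 ^ 3
T̂  = [] ×η 4 ^ 4 ×η 6 ^ 2 ÷η 2 ^ 2 ÷η 12 ^ 4

q : ℕ → Poly
q k = 1ℤ q^ k · []

Y+qX : Null (sgnPoly ⟪ [] ×η 1 ^ 1 ⟫ ⊟ (⟪ Ŷ ⟫ ⊞ 1ℤ q^ 1 · X̂))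
Y+qX = linear _ (Null-sgn euler-bisect)

Y-qX : Null (sgnPoly ⟪ A 1 ⟫ ⊟ (⟪ Ŷ ⟫ ⊟ 1ℤ q^ 1 · X̂))
Y-qX = linear _ (Null-sgn A-bisect)

1/XY : Powers
1/XY = [] ×η 2 ^ 1 ×η 3 ^ 1 ÷η 1 ^ 1 ÷η 6 ^ 1 ÷η 12 ^ 2

-- `v*` and `u*` are the squares of `Ŷ` + q `X̂` and `Ŷ` - q `X̂`, divided by `X̂` `Ŷ`.
v*-u* : Null (⟪ v* ⟫ ⊟ (⟪ u* ⟫ ⊞ ℤ.+ 4 q^ 1 · []))
v*-u* = linear _ (⟪ 1/XY ⟫ ⋆ (sgnPoly ⟪ [] ×η 1 ^ 1 ⟫ ⊞ ⟪ Ŷ ⟫ ⊞ 1ℤ q^ 1 · X̂) ⟨*⟩ Y+qX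
  ⟨+⟩ negative (⟪ 1/XY ⟫ ⋆ (sgnPoly ⟪ A 1 ⟫ ⊞ ⟪ Ŷ ⟫ ⊟ 1ℤ q^ 1 · X̂)) ⟨*⟩ Y-qX
  ⟨+⟩ ℤ.+ 4 q^ 1 · 1/XY ⟨*⟩ ≃⇒Null X̂Ŷ)

u*-bisect : Null (⟪ u* ⟫ ⊟ (cubic-even ⊟ q 1))
u*-bisect = linear _ (Null-sgn cubic-bisect)

-- u* v* is an even multiple of (η₁η₃)⁻², whose odd part is known.
cubic-even≈T : Null (cubic-even ⊟ ⟪ T̂ ⟫)
-- With e = `cubic-even`, the odd part of (e - q)(e + 3q) is 2q e, and that of c s² is 2q c A(q⁴)²
-- B(q²)² = 2q `T̂`. Subtracting the image under q ↦ -q doubles both, hence the factor 4q.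
cubic-even≈T = Null-cancel (ℤ.+ 4) 1 (linear _ (product ⟨+⟩ minusOne ⟨*⟩ Null-sgn product))
  where
  c : Poly
  c = ⟪ [] ×η 4 ^ 2 ÷η 12 ^ 6 ⟫
  s : Poly
  s = ⟪ A 4 ⊙ A 4 ⟫ ⊞ 1ℤ q^ 1 · (B 2 ⊙ B 2)
  product : Null ((cubic-even ⊟ q 1) ⋆ (cubic-even ⊞ ℤ.+ 3 q^ 1 · []) ⊟ c ⋆ s ⋆ s)
  product = linear _ (negative ⟪ v* ⟫ ⟨*⟩ u*-bisect
    ⟨+⟩ negative (cubic-even ⊟ q 1) ⟨*⟩ (v*-u* ⟨+⟩ u*-bisect)
    ⟨+⟩ c ⋆ (⟪ [] ×η 2 ^ 2 ×η 6 ^ 4 ÷η 1 ^ 1 ÷η 3 ^ 1 ÷η 4 ^ 1 ÷η 12 ^ 1 ⟫ ⊞ s) ⟨*⟩ 1/η₁η₃-bisect)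

T-q : Null (⟪ u* ⟫ ⊟ (⟪ T̂ ⟫ ⊟ q 1))
T-q = linear _ (u*-bisect ⟨+⟩ cubic-even≈T)

T+3q : Null (⟪ v* ⟫ ⊟ (⟪ T̂ ⟫ ⊞ ℤ.+ 3 q^ 1 · []))
T+3q = linear _ (v*-u* ⟨+⟩ T-q)

T+q : Null (⟪ u ⟫ ⊟ (⟪ T̂ ⟫ ⊞ q 1))
T+q = linear _ (Null-sgn T-q)

T-3q : Null (⟪ v ⟫ ⊟ (⟪ T̂ ⟫ ⊟ ℤ.+ 3 q^ 1 · []))
T-3q = linear _ (Null-sgn T+3q)

-- `ρ` = Y/X is q/x, free of a pole, and `Ĝ` is ψ(q) ψ(q³) / ψ(q⁶)². The common factor f_1 of the
-- theta series cancels.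
ρ ρ⁻¹ Ĝ : Powers
ρ   = Ŷ ⊙ inverse X̂
ρ⁻¹ = inverse ρ
Ĝ   = [] ×η 2 ^ 2 ×η 6 ^ 4 ÷η 1 ^ 1 ÷η 3 ^ 1 ÷η 12 ^ 4

-- Expanding the square in `u*` gives `u*` = `ρ` + q²/`ρ` - 2q, while `u*` = `T̂` - q.
ρ-plus : Null (⟪ ρ ⟫ ⊞ 1ℤ q^ 2 · ρ⁻¹ ⊟ (⟪ T̂ ⟫ ⊞ q 1))
ρ-plus = linear _ (negative (⟪ inverse (X̂ ⊙ Ŷ) ⟫ ⋆ (sgnPoly ⟪ A 1 ⟫ ⊞ ⟪ Ŷ ⟫ ⊟ 1ℤ q^ 1 · X̂)) ⟨*⟩ Y-qX
  ⟨+⟩ negative (⟪ inverse (X̂ ⊙ Ŷ) ⊙ u* ⟫) ⟨*⟩ ≃⇒Null X̂Ŷ ⟨+⟩ T-q)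

-- The left side is (`Ŷ` - q `X̂`)(`Ŷ` + q `X̂`) / (`X̂` `Ŷ`), and every factor of it is an eta
-- quotient.
ρ-minus : Null (⟪ ρ ⟫ ⊟ 1ℤ q^ 2 · ρ⁻¹ ⊟ ⟪ Ĝ ⟫)
ρ-minus = linear _ (negative (⟪ inverse (X̂ ⊙ Ŷ) ⟫ ⋆ sgnPoly ⟪ [] ×η 1 ^ 1 ⟫) ⟨*⟩ Y-qX
  ⟨+⟩ negative (⟪ inverse (X̂ ⊙ Ŷ) ⟫ ⋆ (⟪ Ŷ ⟫ ⊟ 1ℤ q^ 1 · X̂)) ⟨*⟩ Y+qX
  ⟨+⟩ negative (⟪ inverse (X̂ ⊙ Ŷ) ⊙ Ĝ ⟫) ⟨*⟩ ≃⇒Null X̂Ŷ)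

-- Dissections of φ, ψ and `Ĝ` used for the claims

φ⁺-trisect : Null (⟪ φ⁺ 1 ⟫ ⊟ (⟪ φ⁺ 9 ⟫ ⊞ ℤ.+ 2 q^ 1 · (B 3)))
φ⁺-trisect = linear _ (Null-sgn φ-trisect)

-- φ(q) φ(-q) = φ(-q²)² dissects the right side as a difference of squares; then q² becomes q and q
-- becomes -q.
φ⁺-square : Null (⟪ φ⁺ 1 ⊙ φ⁺ 1 ⟫ ⊟ (⟪ φ⁺ 2 ⊙ φ⁺ 2 ⟫ ⊞ ℤ.+ 4 q^ 1 · (ψ 4 ⊙ ψ 4)))
φ⁺-square = linear _ (Null-sgn (Null-extract 2 0 square))
  where
  square : Null (⟪ φ⁻ 2 ⊙ φ⁻ 2 ⟫ ⊟ (⟪ φ⁺ 4 ⊙ φ⁺ 4 ⟫ ⊟ ℤ.+ 4 q^ 2 · (ψ 8 ⊙ ψ 8)))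
  square = linear _ (⟪ φ⁺ 1 ⟫ ⟨*⟩ φ-bisect ⟨+⟩ (⟪ φ⁺ 4 ⟫ ⊟ ℤ.+ 2 q^ 1 · (ψ 8)) ⟨*⟩ Null-sgn φ-bisect)

ψ/ψ₃ : Powers
ψ/ψ₃ = ψ 1 ⊙ inverse (ψ 3)

-- Triangular numbers are never 2 modulo 3, and division by ψ(q³) respects residues modulo 3.
ψ/ψ₃-vanish : Vanish 3 2 ⟪ ψ/ψ₃ ⟫
ψ/ψ₃-vanish = Vanish-null {r = ⟪ inverse (ψ 3) ⟫ ⋆ (⟪ A 3 ⟫ ⊞ 1ℤ q^ 1 · (ψ 9))} (linear _ (⟪ inverse (ψ 3) ⟫ ⟨*⟩ ψ-trisect))
  (Vanish-extract 3 (Vanish-zero _))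

G-bisected : Poly
G-bisected = ⟪ [] ×η 4 ^ 1 ÷η 12 ^ 3 ⟫ ⋆ (⟪ A 4 ⊙ A 4 ⟫ ⊞ 1ℤ q^ 1 · (B 2 ⊙ B 2))

G-bisect : Null (⟪ Ĝ ⟫ ⊟ G-bisected)
G-bisect = linear _ (⟪ [] ×η 4 ^ 1 ÷η 12 ^ 3 ⟫ ⟨*⟩ 1/η₁η₃-bisect)

G-trisected : Poly
G-trisected = ⟪ ψ 3 ⊙ inverse (ψ 6 ⊙ ψ 6) ⟫ ⋆ (⟪ A 3 ⟫ ⊞ 1ℤ q^ 1 · (ψ 9))

G-trisect : Null (⟪ Ĝ ⟫ ⊟ G-trisected)
G-trisect = linear _ (⟪ ψ 3 ⊙ inverse (ψ 6 ⊙ ψ 6) ⟫ ⟨*⟩ ψ-trisect)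

-- Claims (i)-(iii)

ρ-plus-vanish : Vanish 2 3 (⟪ ρ ⟫ ⊞ 1ℤ q^ 2 · ρ⁻¹)
-- `T̂` is a series in q², so q is the only odd term, and it lies below the start 3.
ρ-plus-vanish = Vanish-null ρ-plus (Vanish-extract 2 (Vanish-const 1ℤ))

-- The even part of `G-bisected` is a series in q⁴.
ρ-minus-vanish₄ : Vanish 4 2 (⟪ ρ ⟫ ⊟ 1ℤ q^ 2 · ρ⁻¹)
ρ-minus-vanish₄ = Vanish-null {r = G-bisected} (linear _ (ρ-minus ⟨+⟩ G-bisect))
  (Vanish-extract 2 (Vanish-extract 2 (Vanish-zero _)))

ρ-minus-vanish₃ : Vanish 3 2 (⟪ ρ ⟫ ⊟ 1ℤ q^ 2 · ρ⁻¹)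
ρ-minus-vanish₃ = Vanish-null {r = G-trisected} (linear _ (ρ-minus ⟨+⟩ G-trisect)) (Vanish-extract 3 (Vanish-zero _))

-- Claims (iv) and (v)

ρ² ρ⁻² : Powers
ρ²  = ρ ⊙ ρ
ρ⁻² = inverse ρ²

ρ²-minus-bisected : Poly
ρ²-minus-bisected = (⟪ T̂ ⟫ ⊞ q 1) ⋆ G-bisected

ρ²-minus : Null (⟪ ρ² ⟫ ⊟ 1ℤ q^ 4 · ρ⁻² ⊟ ρ²-minus-bisected)
ρ²-minus = linear _ ((⟪ ρ ⟫ ⊞ 1ℤ q^ 2 · ρ⁻¹) ⟨*⟩ (ρ-minus ⟨+⟩ G-bisect) ⟨+⟩ G-bisected ⟨*⟩ ρ-plus)

φψ² : Powers
φψ² = φ⁺ 1 ⊙ ψ 1 ⊙ ψ 1 ×η 3 ^ 4 ×η 12 ^ 2 ÷η 6 ^ 9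

φψ²-vanish : Vanish 6 3 ⟪ φψ² ⟫
φψ²-vanish = Vanish-null {r = c ⋆ (⟪ φ⁺ 9 ⟫ ⊞ ℤ.+ 2 q^ 1 · (B 3)) ⋆ ψ′ ⋆ ψ′}
  (linear _ (c ⋆ ⟪ ψ 1 ⊙ ψ 1 ⟫ ⟨*⟩ φ⁺-trisect ⟨+⟩ c ⋆ (⟪ φ⁺ 9 ⟫ ⊞ ℤ.+ 2 q^ 1 · (B 3)) ⋆ (⟪ ψ 1 ⟫ ⊞ ψ′) ⟨*⟩ ψ-trisect))
  -- In the component of residue 0 the odd terms -2q a A(q⁴)² B(q²)² and b `T̂` cancel, here with a
  -- and b read as series.
  (Vanish-extract 3 (Vanish-null {r = a ⋆ s ⋆ s ⊞ b ⋆ (⟪ T̂ ⟫ ⊟ ℤ.+ 3 q^ 1 · [])}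
    (linear _ (a ⋆ (⟪ [] ×η 1 ^ 1 ×η 3 ^ 1 ×η 6 ^ 1 ÷η 2 ^ 1 ⟫ ⊞ s) ⟨*⟩ η₁η₃-bisect ⟨+⟩ b ⟨*⟩ T-3q))
    (Vanish-extract 2 (Vanish-zero _))))
  where
  c ψ′ a b s : Poly
  c  = ⟪ [] ×η 3 ^ 4 ×η 12 ^ 2 ÷η 6 ^ 9 ⟫
  ψ′ = ⟪ A 3 ⟫ ⊞ 1ℤ q^ 1 · (ψ 9)
  a  = ⟪ [] ×η 4 ^ 2 ×η 6 ^ 1 ÷η 2 ^ 5 ÷η 12 ^ 2 ⟫
  b  = ℤ.+ 2 q^ 1 · ([] ×η 6 ^ 1 ×η 12 ^ 4 ÷η 2 ^ 5)
  s  = ⟪ A 4 ⊙ A 4 ⟫ ⊟ 1ℤ q^ 1 · (B 2 ⊙ B 2)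

ψ₂/ψ₆ : Powers
ψ₂/ψ₆ = [] ×η 4 ^ 2 ×η 6 ^ 1 ÷η 2 ^ 1 ÷η 12 ^ 2

ρ²-vanish₁₂ : Vanish 12 7 (⟪ ρ² ⟫ ⊟ 1ℤ q^ 4 · ρ⁻²)
-- After q² becomes q, the odd part is `φψ²` + `ψ₂/ψ₆`, and the second summand is even.
ρ²-vanish₁₂ = Vanish-null ρ²-minus (Vanish-extract 2 (Vanish-null {r = ⟪ φψ² ⟫ ⊞ ⟪ ψ₂/ψ₆ ⟫} (linear _ Null-[])
  (Vanish-⊞ ⟪ φψ² ⟫ ⟪ ψ₂/ψ₆ ⟫ φψ²-vanish (Vanish-sub 2 1 1 3 (Vanish-extract 2 (Vanish-zero _))))))

qφ : Poly
qφ = 1ℤ q^ 1 · (φ⁺ 1 ×η 3 ^ 2 ×η 12 ^ 2 ÷η 6 ^ 5)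

-- `qφ` is q φ(q) / φ(q³), and squares are never 2 modulo 3.
qφ-vanish : Vanish 3 0 qφ
qφ-vanish = Vanish-null {r = c ⋆ (⟪ φ⁺ 9 ⟫ ⊞ ℤ.+ 2 q^ 1 · (B 3))} (linear _ (c ⟨*⟩ φ⁺-trisect)) (Vanish-extract 3 (Vanish-zero _))
  where
  c : Poly
  c = 1ℤ q^ 1 · ([] ×η 3 ^ 2 ×η 12 ^ 2 ÷η 6 ^ 5)

ratio-square-bisected : Poly
ratio-square-bisected = ⟪ [] ×η 4 ^ 4 ×η 6 ^ 1 ×η 12 ^ 2 ÷η 2 ^ 5 ÷η 8 ^ 1 ÷η 24 ^ 1 ⟫
  ⊞ ℤ.+ 2 q^ 1 · ([] ×η 4 ^ 1 ×η 6 ^ 2 ×η 8 ^ 1 ×η 24 ^ 1 ÷η 2 ^ 4 ÷η 12 ^ 1)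

-- f_2³ = ψ(q²) φ(-q²)², and the terms of residue 1 cancel because A(q) E(q) = ψ(q³) φ(-q³). This
-- agrees with Jacobi's series for f_2³, whose exponents are k (k + 1).
η₂³-vanish : Vanish 3 1 (ℤ.+ 2 q^ 0 · ([] ×η 2 ^ 3 ×η 6 ^ 3 ÷η 3 ^ 6))
η₂³-vanish = Vanish-null {r = c ⋆ ψ′ ⋆ φ′ ⋆ φ′}
  (linear _ (c ⋆ ⟪ φ⁻ 2 ⊙ φ⁻ 2 ⟫ ⟨*⟩ Null-dilate 2 ψ-trisect ⟨+⟩ c ⋆ ψ′ ⋆ (⟪ φ⁻ 2 ⟫ ⊞ φ′) ⟨*⟩ Null-dilate 2 φ-trisect))
  (Vanish-extract 3 (Vanish-zero _))
  where
  c ψ′ φ′ : Poly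
  c  = ℤ.+ 2 q^ 0 · ([] ×η 6 ^ 3 ÷η 3 ^ 6)
  ψ′ = ⟪ A 6 ⟫ ⊞ 1ℤ q^ 2 · (ψ 18)
  φ′ = ⟪ φ⁻ 18 ⟫ ⊟ ℤ.+ 2 q^ 2 · (E 6)

ρ²-vanish₂₄ : Vanish 24 12 (⟪ ρ² ⟫ ⊟ 1ℤ q^ 4 · ρ⁻²)
ρ²-vanish₂₄ = Vanish-null ρ²-minus (Vanish-extract 2 (Vanish-null {r = ⟪ first ⟫ ⊞ qφ} (linear _ Null-[])
  (Vanish-⊞ ⟪ first ⟫ qφ first-vanish (Vanish-sub 3 0 2 4 qφ-vanish))))
  where
  first : Powers
  first = [] ×η 2 ^ 3 ×η 3 ^ 2 ×η 4 ^ 2 ÷η 1 ^ 2 ÷η 6 ^ 3 ÷η 12 ^ 2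
  c d s : Poly
  c = ⟪ [] ×η 2 ^ 3 ×η 4 ^ 2 ÷η 6 ^ 3 ÷η 12 ^ 2 ⟫
  d = ⟪ [] ×η 2 ^ 2 ×η 4 ^ 1 ×η 12 ^ 1 ÷η 6 ^ 8 ⟫
  s = ⟪ A 4 ⊙ A 4 ⟫ ⊞ 1ℤ q^ 1 · (B 2 ⊙ B 2)
  first-vanish : Vanish 12 6 ⟪ first ⟫
  -- The even part is an even multiple of (f_1 f_3)^-2, whose odd part is a single eta quotient; it
  -- reduces to f_2³ times a series in q³.
  first-vanish = Vanish-null {r = c ⋆ ratio-square-bisected} (linear _ (c ⟨*⟩ ratio-square))
    (Vanish-extract 2 (Vanish-null {r = d ⋆ s ⋆ s}
      (linear _ (d ⋆ (⟪ [] ×η 2 ^ 2 ×η 6 ^ 4 ÷η 1 ^ 1 ÷η 3 ^ 1 ÷η 4 ^ 1 ÷η 12 ^ 1 ⟫ ⊞ s) ⟨*⟩ 1/η₁η₃-bisect))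
      (Vanish-extract 2 (Vanish-null {r = ℤ.+ 2 q^ 0 · ([] ×η 2 ^ 3 ×η 6 ^ 3 ÷η 3 ^ 6)} (linear _ Null-[]) η₂³-vanish))))

-- Claims (xi)-(xvi)

κ κ⁻¹ κ² κ⁻² : Powers
κ   = dilatePowers 3 ρ ⊙ inverse ρ
κ⁻¹ = inverse κ
κ²  = κ ⊙ κ
κ⁻² = inverse κ²

-- Components of the 3-dissections: `T̂` = μ + 2q² ω + q⁴/`T̂` and `Ĝ` = ν + q `Ĝ`/`T̂`, where all
-- series on the right are taken at q³.
μ ν ω : Powers
μ = A 2 ⊙ A 2 ⊙ inverse (ψ 2 ⊙ ψ 2)
ν = A 1 ⊙ ψ 1 ⊙ inverse (ψ 2 ⊙ ψ 2)
ω = A 2 ⊙ ψ 6 ⊙ inverse (ψ 2 ⊙ ψ 2)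

κ-plus-trisected κ-minus-trisected : Poly
κ-plus-trisected  = ⟪ dilatePowers 3 (ω ⊙ u) ⟫ ⊟ 1ℤ q^ 1 · (dilatePowers 3 μ) ⊞ ℤ.+ 2 q^ 5 · (dilatePowers 3 (inverse T̂))
κ-minus-trisected = ⟪ dilatePowers 3 (ω ⊙ Ĝ) ⟫ ⊟ 1ℤ q^ 1 · (dilatePowers 3 ν)

T-trisected : Poly
T-trisected = ⟪ inverse (ψ 6 ⊙ ψ 6) ⟫ ⋆ (⟪ A 6 ⟫ ⊞ 1ℤ q^ 2 · (ψ 18)) ⋆ (⟪ A 6 ⟫ ⊞ 1ℤ q^ 2 · (ψ 18))

T-trisect : Null (⟪ T̂ ⟫ ⊟ T-trisected)
T-trisect = linear _ (⟪ inverse (ψ 6 ⊙ ψ 6) ⟫ ⋆ (⟪ ψ 2 ⟫ ⊞ ⟪ A 6 ⟫ ⊞ 1ℤ q^ 2 · (ψ 18)) ⟨*⟩ Null-dilate 2 ψ-trisect)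

S S₃ G₃ T+q₁ T+q₃ G₁ : Poly
S    = ⟪ ρ ⟫ ⊞ 1ℤ q^ 2 · ρ⁻¹
S₃   = dilatePoly 3 S
G₁   = ⟪ ρ ⟫ ⊟ 1ℤ q^ 2 · ρ⁻¹
G₃   = dilatePoly 3 G₁
T+q₁ = T-trisected ⊞ q 1
T+q₃ = dilatePoly 3 (⟪ T̂ ⟫ ⊞ q 1)

ρ-plus-trisect : Null (S ⊟ T+q₁)
ρ-plus-trisect = linear _ (ρ-plus ⟨+⟩ T-trisect)

ρ-minus-trisect : Null (G₁ ⊟ G-trisected)
ρ-minus-trisect = linear _ (ρ-minus ⟨+⟩ G-trisect)

-- 2q² (κ + q⁴/κ) = S(q) S(q³) - G(q) G(q³), and similarly for the difference.
κ-plus : Null (⟪ κ ⟫ ⊞ 1ℤ q^ 4 · κ⁻¹ ⊟ κ-plus-trisected)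
κ-plus = Null-cancel (ℤ.+ 2) 2 (linear _ (expanded
    ⟨+⟩ -[1+ 1 ] q^ 2 · (dilatePowers 3 ω) ⟨*⟩ Null-dilate 3 T+q
    ⟨+⟩ Null-dilate 3 middle ⟨+⟩ q 1 ⟨*⟩ Null-dilate 3 last))
  where
  expanded : Null (ℤ.+ 2 q^ 2 · [] ⋆ (⟪ κ ⟫ ⊞ 1ℤ q^ 4 · κ⁻¹) ⊟ (T+q₁ ⋆ T+q₃ ⊟ G-trisected ⋆ ⟪ dilatePowers 3 Ĝ ⟫))
  expanded = linear _ (S₃ ⟨*⟩ ρ-plus-trisect ⟨+⟩ T+q₁ ⟨*⟩ Null-dilate 3 ρ-plus
    ⟨+⟩ negative G₃ ⟨*⟩ ρ-minus-trisect ⟨+⟩ negative G-trisected ⟨*⟩ Null-dilate 3 ρ-minus)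
  -- Residue 0 modulo 3. As monomials ν `Ĝ` = μ `v*`, and `v*` = `T̂` + 3q.
  middle : Null (⟪ μ ⟫ ⋆ (⟪ T̂ ⟫ ⊞ q 1) ⊟ ⟪ ν ⊙ Ĝ ⟫ ⊞ ℤ.+ 2 q^ 1 · μ)
  middle = linear _ (negative ⟪ μ ⟫ ⟨*⟩ T+3q)
  -- Residue 1. Here `Ĝ`² = `u*` `v*`, and (`T̂` + q)² - (`T̂` - q)(`T̂` + 3q) = 4q².
  last : Null ((⟪ T̂ ⟫ ⊞ q 1) ⋆ (1ℤ q^ 1 · (inverse T̂) ⊞ q 0) ⊟ ⟪ Ĝ ⊙ Ĝ ⊙ inverse T̂ ⟫ ⊟ ℤ.+ 4 q^ 2 · (inverse T̂))
  last = linear _ (negative ⟪ inverse T̂ ⟫ ⋆ ⟪ u* ⟫ ⟨*⟩ T+3q ⟨+⟩ negative ⟪ inverse T̂ ⟫ ⋆ (⟪ T̂ ⟫ ⊞ ℤ.+ 3 q^ 1 · []) ⟨*⟩ T-q)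

κ-minus : Null (⟪ κ ⟫ ⊟ 1ℤ q^ 4 · κ⁻¹ ⊟ κ-minus-trisected)
κ-minus = Null-cancel (ℤ.+ 2) 2 (linear _ (expanded ⟨+⟩ Null-dilate 3 middle))
  where
  expanded : Null (ℤ.+ 2 q^ 2 · [] ⋆ (⟪ κ ⟫ ⊟ 1ℤ q^ 4 · κ⁻¹) ⊟ (T+q₁ ⋆ ⟪ dilatePowers 3 Ĝ ⟫ ⊟ G-trisected ⋆ T+q₃))
  expanded = linear _ (G₃ ⟨*⟩ ρ-plus-trisect ⟨+⟩ T+q₁ ⟨*⟩ Null-dilate 3 ρ-minus
    ⟨+⟩ negative S₃ ⟨*⟩ ρ-minus-trisect ⟨+⟩ negative G-trisected ⟨*⟩ Null-dilate 3 ρ-plus)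
  -- Residue 0, by μ `Ĝ` = ν `u*`. The component of residue 1 cancels identically, so
  -- `κ-minus-trisected` has no component of residue 2 after division by 2q².
  middle : Null (⟪ μ ⊙ Ĝ ⟫ ⊟ ⟪ ν ⟫ ⋆ (⟪ T̂ ⟫ ⊞ q 1) ⊞ ℤ.+ 2 q^ 1 · ν)
  middle = linear _ (⟪ ν ⟫ ⟨*⟩ T-q)

-- ν is an even multiple of f_3² / f_1², and its even part is f_12² / (f_8 f_24), a series in q⁴.
ν-vanish : Vanish 4 2 ⟪ ν ⟫
ν-vanish = Vanish-null {r = c ⋆ ratio-square-bisected} (linear _ (c ⟨*⟩ ratio-square))
  (Vanish-extract 2 (Vanish-extract 2 (Vanish-zero _)))
  where
  c : Poly
  c = ⟪ [] ×η 2 ^ 5 ÷η 4 ^ 4 ÷η 6 ^ 1 ⟫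

κ-minus-vanish₃ : Vanish 3 5 (⟪ κ ⟫ ⊟ 1ℤ q^ 4 · κ⁻¹)
κ-minus-vanish₃ = Vanish-null {r = κ-minus-trisected} κ-minus (Vanish-extract 3 (Vanish-zero _))

-- The component of residue 2 modulo 3 is 2q⁵ / `T̂`(q³), which has odd exponents only.
κ-plus-vanish₀ : Vanish 6 8 (⟪ κ ⟫ ⊞ 1ℤ q^ 4 · κ⁻¹)
κ-plus-vanish₀ = Vanish-null {r = κ-plus-trisected} κ-plus (Vanish-extract 3 (Vanish-extract 2 (Vanish-zero _)))

κ-plus-vanish₂ : Vanish 6 4 (⟪ κ ⟫ ⊞ 1ℤ q^ 4 · κ⁻¹)
κ-plus-vanish₂ = Vanish-null {r = κ-plus-trisected} κ-plus (Vanish-extract 3 (Vanish-null {r = negative ⟪ μ ⟫} (linear _ Null-[])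
  (Vanish-extract 2 (Vanish-zero _))))

Vanish-scale : ∀ c p {m r} → Vanish m r p → Vanish m r (c q^ 0 · [] ⋆ p)
Vanish-scale c p {m} {r} v = vanish λ n → trans (at (scaled c p) (m * n + r))
  (trans (·-at c ⟦ p ⟧ (m * n + r)) (trans (cong (c ℤ.*_) (Vanish.coefficient v n)) (ℤₚ.*-zeroʳ c)))
  where
  scaled : ∀ c p → ⟦ c q^ 0 · [] ⋆ p ⟧ ≈ c · ⟦ p ⟧
  scaled c p = ≈-trans (⟦scaled⟧ c 0 p) (≈-trans (·-⊗ c oneS ⟦ p ⟧) (·-cong c (⊗-identityˡ ⟦ p ⟧)))

κ-minus-vanish₁₂ : Vanish 12 7 (⟪ κ ⟫ ⊟ 1ℤ q^ 4 · κ⁻¹)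
κ-minus-vanish₁₂ = Vanish-null {r = κ-minus-trisected} κ-minus (Vanish-extract 3 (Vanish-null {r = negative ⟪ ν ⟫} (linear _ Null-[]) (Vanish-scale -1ℤ ⟪ ν ⟫ ν-vanish)))

κ²-minus : Null (⟪ κ² ⟫ ⊟ 1ℤ q^ 8 · κ⁻² ⊟ κ-minus-trisected ⋆ κ-plus-trisected)
κ²-minus = linear _ ((⟪ κ ⟫ ⊞ 1ℤ q^ 4 · κ⁻¹) ⟨*⟩ κ-minus ⟨+⟩ κ-minus-trisected ⟨*⟩ κ-plus)

η₁η₃-bisected 1/η₁η₃-bisected : Poly
η₁η₃-bisected   = ⟪ [] ×η 2 ^ 1 ÷η 6 ^ 1 ⟫ ⋆ (⟪ A 4 ⊙ A 4 ⟫ ⊟ 1ℤ q^ 1 · (B 2 ⊙ B 2))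
1/η₁η₃-bisected = ⟪ [] ×η 4 ^ 1 ×η 12 ^ 1 ÷η 2 ^ 2 ÷η 6 ^ 4 ⟫ ⋆ (⟪ A 4 ⊙ A 4 ⟫ ⊞ 1ℤ q^ 1 · (B 2 ⊙ B 2))

η₁η₃ : Null (⟪ [] ×η 1 ^ 1 ×η 3 ^ 1 ⟫ ⊟ η₁η₃-bisected)
η₁η₃ = linear _ (⟪ [] ×η 2 ^ 1 ÷η 6 ^ 1 ⟫ ⟨*⟩ η₁η₃-bisect)

1/η₁η₃ : Null (⟪ [] ÷η 1 ^ 1 ÷η 3 ^ 1 ⟫ ⊟ 1/η₁η₃-bisected)
1/η₁η₃ = linear _ (⟪ [] ×η 4 ^ 1 ×η 12 ^ 1 ÷η 2 ^ 2 ÷η 6 ^ 4 ⟫ ⟨*⟩ 1/η₁η₃-bisect)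

κ²-vanish₂₄ : Vanish 24 14 (⟪ κ² ⟫ ⊟ 1ℤ q^ 8 · κ⁻²)
κ²-vanish₂₄ = Vanish-null {r = κ-minus-trisected ⋆ κ-plus-trisected} κ²-minus (Vanish-extract 3
  -- The component of residue 2 is μ ν + 2q ω `Ĝ`/`T̂`: even multiples of f_3² / f_1² and of q /
  -- (f_1 f_3).
  (Vanish-null {r = c₁ ⋆ ratio-square-bisected ⊞ c₂ ⋆ 1/η₁η₃-bisected} (linear _ (c₁ ⟨*⟩ ratio-square ⟨+⟩ c₂ ⟨*⟩ 1/η₁η₃))
  (Vanish-extract 2
    (Vanish-null {r = d₁ ⋆ φ₃ ⋆ φ₃ ⊞ d₂ ⋆ η₁η₃-bisected}
      (linear _ (d₁ ⋆ (⟪ φ⁻ 3 ⟫ ⊞ φ₃) ⟨*⟩ Null-dilate 3 φ-bisect ⟨+⟩ d₂ ⟨*⟩ η₁η₃))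
    (Vanish-extract 2
      -- φ(q⁶)² + 4q³ ψ(q¹²)² recombines to φ(q³)². What remains is an even multiple of (f_1 f_3)^-2
      -- minus `e₂` `v*`, and the odd parts of the two cancel.
      (Vanish-null {r = e₁ ⋆ 1/η₁η₃-bisected ⋆ 1/η₁η₃-bisected ⊟ e₂ ⋆ (⟪ T̂ ⟫ ⊞ ℤ.+ 3 q^ 1 · [])}
        (linear _ (negative ⟪ [] ×η 3 ^ 2 ÷η 1 ^ 2 ÷η 2 ^ 1 ÷η 6 ^ 1 ⟫ ⟨*⟩ Null-dilate 3 φ⁺-square
          ⟨+⟩ e₁ ⋆ (⟪ [] ÷η 1 ^ 1 ÷η 3 ^ 1 ⟫ ⊞ 1/η₁η₃-bisected) ⟨*⟩ 1/η₁η₃ ⟨+⟩ negative e₂ ⟨*⟩ T+3q))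
      (Vanish-extract 2 (Vanish-zero _))))))))
  where
  c₁ c₂ d₁ d₂ e₁ e₂ φ₃ : Poly
  c₁ = ⟪ [] ×η 2 ^ 5 ×η 6 ^ 3 ÷η 4 ^ 6 ÷η 12 ^ 2 ⟫
  c₂ = ℤ.+ 2 q^ 1 · ([] ×η 2 ^ 5 ×η 6 ^ 3 ×η 12 ^ 1 ÷η 4 ^ 7)
  d₁ = ⟪ [] ×η 6 ^ 2 ÷η 2 ^ 2 ÷η 4 ^ 1 ÷η 12 ^ 1 ⟫
  d₂ = ℤ.+ 2 q^ 1 · ([] ×η 12 ^ 2 ÷η 2 ^ 2 ÷η 4 ^ 2)
  e₁ = ⟪ [] ×η 6 ^ 9 ÷η 2 ^ 1 ÷η 12 ^ 4 ⟫
  e₂ = ℤ.+ 2 q^ 1 · ([] ×η 6 ^ 1 ×η 12 ^ 4 ÷η 2 ^ 5)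
  φ₃ = ⟪ φ⁺ 12 ⟫ ⊟ ℤ.+ 2 q^ 3 · (ψ 24)

κ²-vanish₃₆ : Vanish 36 25 (⟪ κ² ⟫ ⊟ 1ℤ q^ 8 · κ⁻²)
κ²-vanish₃₆ = Vanish-null {r = κ-minus-trisected ⋆ κ-plus-trisected} κ²-minus (Vanish-extract 3
  -- The component of residue 1 is -ω (μ `Ĝ` + ν `u`). As μ `Ĝ` = ν `u*` and `u` + `u*` = 2 `T̂`, it
  -- is -2 `T̂` ω ν.
  (Vanish-null {r = c ⋆ ratio-square-bisected}
    (linear _ (negative ⟪ ω ⊙ ν ⟫ ⟨*⟩ (T+q ⟨+⟩ T-q) ⟨+⟩ c ⟨*⟩ ratio-square))
  (Vanish-extract 2
    -- The even part is an even multiple of `u`, so `T+q` applies; the even part of the result is -2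
    -- ψ(q) / ψ(q³) at q².
    (Vanish-null {r = d ⋆ (⟪ T̂ ⟫ ⊞ q 1)} (linear _ (d ⟨*⟩ T+q))
    (Vanish-extract 2
      (Vanish-null {r = -[1+ 1 ] q^ 0 · [] ⋆ ⟪ ψ/ψ₃ ⟫} (linear _ Null-[]) (Vanish-scale -[1+ 1 ] ⟪ ψ/ψ₃ ⟫ ψ/ψ₃-vanish)))))))
  where
  c d : Poly
  c = -[1+ 1 ] q^ 0 · (T̂ ⊙ ω ×η 2 ^ 5 ÷η 4 ^ 4 ÷η 6 ^ 1)
  d = -[1+ 1 ] q^ 0 · ([] ×η 2 ^ 1 ×η 12 ^ 2 ÷η 4 ^ 2 ÷η 6 ^ 1)

-- Claims (xvii)-(xxii)

λ₂ λ₂⁻¹ λ₂² τ τ⁻¹ : Powers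
λ₂   = dilatePowers 2 ρ ⊙ inverse ρ
λ₂⁻¹ = inverse λ₂
λ₂²  = λ₂ ⊙ λ₂
τ    = ρ ⊙ dilatePowers 2 ρ
τ⁻¹  = inverse τ

-- ρ(q²) = ρ(q) ρ(-q) is built into the normal form of ρ(-q).
λ₂-plus : Null (⟪ λ₂ ⟫ ⊞ 1ℤ q^ 2 · λ₂⁻¹ ⊟ (⟪ T̂ ⟫ ⊟ q 1))
λ₂-plus = linear _ (Null-sgn ρ-plus)

λ₂-minus : Null (⟪ λ₂ ⟫ ⊟ 1ℤ q^ 2 · λ₂⁻¹ ⊟ sgnPoly G-bisected)
λ₂-minus = linear _ (Null-sgn ρ-minus ⟨+⟩ Null-sgn G-bisect)

-- The product of `ρ` + q²/`ρ` with its value at q² is τ + q⁶/τ plus q² times the sum in `λ₂-plus`.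
-- The terms q² `T̂` cancel and leave 2q³.
τ-plus : Null (⟪ τ ⟫ ⊞ 1ℤ q^ 6 · τ⁻¹ ⊟ ((⟪ T̂ ⟫ ⊞ q 1) ⋆ ⟪ dilatePowers 2 T̂ ⟫ ⊞ ℤ.+ 2 q^ 3 · []))
τ-plus = linear _ (dilatePoly 2 (⟪ ρ ⟫ ⊞ 1ℤ q^ 2 · ρ⁻¹) ⟨*⟩ ρ-plus ⟨+⟩ (⟪ T̂ ⟫ ⊞ q 1) ⟨*⟩ Null-dilate 2 ρ-plus
  ⟨+⟩ negative (q 2) ⟨*⟩ λ₂-plus)

τ-minus-bisected : Poly
τ-minus-bisected = (⟪ T̂ ⟫ ⊞ q 1) ⋆ ⟪ dilatePowers 2 Ĝ ⟫ ⊟ q 2 ⋆ sgnPoly G-bisected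

τ-minus : Null (⟪ τ ⟫ ⊟ 1ℤ q^ 6 · τ⁻¹ ⊟ τ-minus-bisected)
τ-minus = linear _ (dilatePoly 2 (⟪ ρ ⟫ ⊟ 1ℤ q^ 2 · ρ⁻¹) ⟨*⟩ ρ-plus ⟨+⟩ (⟪ T̂ ⟫ ⊞ q 1) ⟨*⟩ Null-dilate 2 ρ-minus
  ⟨+⟩ negative (q 2) ⟨*⟩ λ₂-minus)

τ-plus-vanish : Vanish 4 7 (⟪ τ ⟫ ⊞ 1ℤ q^ 6 · τ⁻¹)
τ-plus-vanish = Vanish-null {r = (⟪ T̂ ⟫ ⊞ q 1) ⋆ ⟪ dilatePowers 2 T̂ ⟫ ⊞ ℤ.+ 2 q^ 3 · []} τ-plus
  -- The odd part is q `T̂`(q²) + 2q³ and `T̂`(q²) is a series in q⁴, so only the exponent 3 occurs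
  -- in residue 3 modulo 4, below the start 7.
  (Vanish-extract 2 (Vanish-extract 2 (Vanish-const (ℤ.+ 2))))

τ-minus-vanish₁₂ : Vanish 12 10 (⟪ τ ⟫ ⊟ 1ℤ q^ 6 · τ⁻¹)
τ-minus-vanish₁₂ = Vanish-null {r = τ-minus-bisected} τ-minus (Vanish-extract 2
  -- With q² replaced by q, the even part of `τ-minus-bisected` is `ψ₂/ψ₆` (`v*` - q).
  (Vanish-null {r = ⟪ ψ₂/ψ₆ ⟫ ⋆ (⟪ T̂ ⟫ ⊞ ℤ.+ 2 q^ 1 · [])} (linear _ (⟪ ψ₂/ψ₆ ⟫ ⟨*⟩ T+3q))
    (Vanish-extract 2 (Vanish-null {r = ℤ.+ 2 q^ 0 · [] ⋆ ⟪ ψ/ψ₃ ⟫} (linear _ Null-[])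
      (Vanish-scale (ℤ.+ 2) ⟪ ψ/ψ₃ ⟫ ψ/ψ₃-vanish)))))

-- The component of residue 0 of ψ(q)³ is A(q³)³ + q³ ψ(q⁹)³. Extracting even exponents from `u`
-- `u*` = `T̂`² - q² gives A(q)³ + q ψ(q³)³ = ψ(q)⁴ / ψ(q³), so `ψ/ψ₃` returns.
ψ³/ψ₃³-vanish : Vanish 9 6 ⟪ ψ/ψ₃ ⊙ ψ/ψ₃ ⊙ ψ/ψ₃ ⟫
ψ³/ψ₃³-vanish = Vanish-null {r = c ⋆ ψ′ ⋆ ψ′ ⋆ ψ′}
  (linear _ (c ⋆ (⟪ ψ 1 ⊙ ψ 1 ⟫ ⊞ ⟪ ψ 1 ⟫ ⋆ ψ′ ⊞ ψ′ ⋆ ψ′) ⟨*⟩ ψ-trisect))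
  (Vanish-extract 3 (Vanish-null {r = ⟪ ψ/ψ₃ ⟫} (linear _ (⟪ [] ×η 1 ^ 3 ×η 6 ^ 6 ÷η 2 ^ 6 ÷η 3 ^ 3 ⟫ ⟨*⟩ Null-extract 2 0 square))
    ψ/ψ₃-vanish))
  where
  c ψ′ : Poly
  c  = ⟪ inverse (ψ 3 ⊙ ψ 3 ⊙ ψ 3) ⟫
  ψ′ = ⟪ A 3 ⟫ ⊞ 1ℤ q^ 1 · (ψ 9)
  square : Null (⟪ u ⊙ u* ⟫ ⊟ (⟪ T̂ ⊙ T̂ ⟫ ⊟ q 2))
  square = linear _ (⟪ u* ⟫ ⟨*⟩ T+q ⟨+⟩ (⟪ T̂ ⟫ ⊞ q 1) ⟨*⟩ T-q)

τ-minus-vanish₃₆ : Vanish 36 24 (⟪ τ ⟫ ⊟ 1ℤ q^ 6 · τ⁻¹)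
τ-minus-vanish₃₆ = Vanish-null {r = τ-minus-bisected} τ-minus (Vanish-extract 2
  (Vanish-null {r = ⟪ ψ₂/ψ₆ ⟫ ⋆ (⟪ T̂ ⟫ ⊞ ℤ.+ 2 q^ 1 · [])} (linear _ (⟪ ψ₂/ψ₆ ⟫ ⟨*⟩ T+3q))
    (Vanish-extract 2 (Vanish-null {r = ⟪ ψ/ψ₃ ⊙ ψ/ψ₃ ⊙ ψ/ψ₃ ⟫} (linear _ Null-[]) ψ³/ψ₃³-vanish))))

G-vanish : Vanish 12 6 ⟪ Ĝ ⟫
G-vanish = Vanish-null {r = G-trisected} G-trisect (Vanish-extract 3 (Vanish-null {r = ⟪ ν ⟫} (linear _ Null-[]) ν-vanish))

τ-minus-vanish₂₄ : Vanish 24 13 (⟪ τ ⟫ ⊟ 1ℤ q^ 6 · τ⁻¹)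
τ-minus-vanish₂₄ = Vanish-null {r = τ-minus-bisected} τ-minus (Vanish-extract 2
  -- The odd part, divided by q and with q² replaced by q, is `Ĝ` + `qφ`; the two summands vanish
  -- separately.
  (Vanish-null {r = ⟪ Ĝ ⟫ ⊞ qφ} (linear _ Null-[]) (Vanish-⊞ ⟪ Ĝ ⟫ qφ G-vanish (Vanish-sub 3 0 2 4 qφ-vanish))))

-- The series of the theorem as monomials

record _represents_ (l : Powers) (f : PS) : Set where
  constructor representation
  field series≈ : f ≈ ⟦ l ⟧ᵖ
open _represents_

poch-rep : ∀ a b → (((suc a , suc b) , 1ℤ) ∷ []) represents (poch (suc a) (suc b))
poch-rep a b = representation (≈-trans (poch≈pochS (suc a) (suc b))
  (solve 1 (λ x → x := con 1ℤ :* x :* con 1ℤ) ≈-refl (pochS -1ℤ (suc a) (suc b))))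

infixl 8 _⊛-rep_
_⊛-rep_ : ∀ {l m f g} → l represents f → m represents g → (l ⊙ m) represents (f ⊛ g)
_⊛-rep_ {l} {m} {f} {g} (representation h) (representation k) =
  representation (≈-trans (≈-sym (⊗≈⊛ f g)) (≈-trans (⊗-cong h k) (≈-sym (⊙-sound l m))))

inv-rep : ∀ {l f} → l represents f → inverse l represents inv f
inv-rep {l} {f} (representation h) = representation (≈-trans (≈-sym (recip≈inv f))
  (≈-trans (recip-cong (trans (at h 0) (⟦⟧ᵖ-0 l)) h) (recip-⟦⟧ᵖ l)))

dil-rep : ∀ k .{{_ : NonZero k}} {l f} → l represents f → dilatePowers k l represents dil k f
dil-rep k {l} {f} (representation h) = representation (≈-trans (≈-sym (dilate≈dil k f))
  (≈-trans (dilate-cong k h) (dilatePowers-sound k l)))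

powers : ℕ → Powers → Powers
powers zero    l = []
powers (suc k) l = powers k l ⊙ l

powS-rep : ∀ k {l f} → l represents f → powers k l represents powS k f
powS-rep zero    h = representation ≈-refl
powS-rep (suc k) h = powS-rep k h ⊛-rep h

qq-rep : ([] ×η 1 ^ 1) represents qq
qq-rep = poch-rep 0 0

X-rep : _ represents X
X-rep = poch-rep 0 11 ⊛-rep poch-rep 10 11 ⊛-rep poch-rep 11 11 ⊛-rep inv-rep qq-rep

Y-rep : _ represents Y
Y-rep = poch-rep 4 11 ⊛-rep poch-rep 6 11 ⊛-rep poch-rep 11 11 ⊛-rep inv-rep qq-rep

ξ₁-rep : ∀ k → _ represents ξ₁ k
ξ₁-rep k = powS-rep k Y-rep ⊛-rep inv-rep (powS-rep k X-rep)

ξ-rep : ∀ m .{{_ : NonZero m}} k → _ represents ξ m k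
ξ-rep m k = powS-rep k X-rep ⊛-rep powS-rep k (dil-rep m Y-rep) ⊛-rep
  inv-rep (powS-rep k Y-rep ⊛-rep powS-rep k (dil-rep m X-rep))

ξ₄-rep : _ represents ξ₄
ξ₄-rep = Y-rep ⊛-rep dil-rep 2 Y-rep ⊛-rep inv-rep (X-rep ⊛-rep dil-rep 2 X-rep)

simplify : ∀ {l f} m → l represents f → {_ : T (samePowers l m)} → m represents f
simplify {l} m (representation h) {e} = representation (≈-trans h (samePowers-sound l m e))

ρ-rep : ρ represents ξ₁ 1
ρ-rep = simplify ρ (ξ₁-rep 1)

ρ²-rep : ρ² represents ξ₁ 2
ρ²-rep = simplify ρ² (ξ₁-rep 2)

λ₂-rep : λ₂ represents ξ 2 1
λ₂-rep = simplify λ₂ (ξ-rep 2 1)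

λ₂²-rep : λ₂² represents ξ 2 2
λ₂²-rep = simplify λ₂² (ξ-rep 2 2)

κ-rep : κ represents ξ 3 1
κ-rep = simplify κ (ξ-rep 3 1)

κ²-rep : κ² represents ξ 3 2
κ²-rep = simplify κ² (ξ-rep 3 2)

τ-rep : τ represents ξ₄
τ-rep = simplify τ ξ₄-rep

-- The coefficients of l and of q^c / l along a progression; the index s = r + c is kept
-- separate so that no conversion between the two forms of a coefficient is needed.
module _ {l f} (R : l represents f) (c : ℕ) where

  private
    p : Poly
    p = 1ℤ q^ c · (inverse l)

    shifted : ∀ {m s r} n → s ≡ r + c → ⟦ p ⟧ (m * n + s) ≡ (f ′) (m * n + r)
    shifted {m} {r = r} n refl = trans (at (≈-trans (⟦monomial⟧ 1ℤ c (inverse l)) (1· _)) (m * n + (r + c)))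
      (trans (cong (Q c ⊗ ⟦ inverse l ⟧ᵖ) (sym (ℕₚ.+-assoc (m * n) r c)))
        (trans (Q-⊗-+ c ⟦ inverse l ⟧ᵖ (m * n + r)) (sym (at (series≈ (inv-rep R)) (m * n + r)))))

    series : ∀ n → ⟦ ⟪ l ⟫ ⟧ n ≡ f n
    series n = trans (at (⟦power⟧ l) n) (sym (at (series≈ R) n))

  agree : ∀ m s r → s ≡ r + c → Vanish m s (⟪ l ⟫ ⊟ p) → ∀ n → f (m * n + s) ≡ (f ′) (m * n + r)
  agree m s r e v n = ℤₚ.i-j≡0⇒i≡j _ _ (begin
    f (m * n + s) ℤ.- (f ′) (m * n + r)
      ≡⟨ cong₂ ℤ._-_ (series (m * n + s)) (shifted {m} {s} {r} n e) ⟨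
    ⟦ ⟪ l ⟫ ⟧ (m * n + s) ℤ.- ⟦ p ⟧ (m * n + s)
      ≡⟨ cong (λ x → ⟦ ⟪ l ⟫ ⟧ (m * n + s) ℤ.+ x) (⊖-at ⟦ p ⟧ (m * n + s)) ⟨
    ⟦ ⟪ l ⟫ ⟧ (m * n + s) ℤ.+ (⊖ ⟦ p ⟧) (m * n + s)
      ≡⟨ ⊕-at ⟦ ⟪ l ⟫ ⟧ (⊖ ⟦ p ⟧) (m * n + s) ⟨
    (⟦ ⟪ l ⟫ ⟧ ⊕ ⊖ ⟦ p ⟧) (m * n + s)
      ≡⟨ at (⊟-sound ⟪ l ⟫ p) (m * n + s) ⟨
    ⟦ ⟪ l ⟫ ⊟ p ⟧ (m * n + s)
      ≡⟨ Vanish.coefficient v n ⟩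
    0ℤ ∎)
    where open ≡-Reasoning

  oppose : ∀ m s r → s ≡ r + c → Vanish m s (⟪ l ⟫ ⊞ p) → ∀ n → f (m * n + s) ≡ - (f ′) (m * n + r)
  oppose m s r e v n = ℤₚ.i-j≡0⇒i≡j _ _ (begin
    f (m * n + s) ℤ.- - (f ′) (m * n + r)
      ≡⟨ cong (λ x → f (m * n + s) ℤ.+ x) (ℤₚ.neg-involutive ((f ′) (m * n + r))) ⟩
    f (m * n + s) ℤ.+ (f ′) (m * n + r)
      ≡⟨ cong₂ ℤ._+_ (series (m * n + s)) (shifted {m} {s} {r} n e) ⟨
    ⟦ ⟪ l ⟫ ⟧ (m * n + s) ℤ.+ ⟦ p ⟧ (m * n + s)
      ≡⟨ ⊕-at ⟦ ⟪ l ⟫ ⟧ ⟦ p ⟧ (m * n + s) ⟨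
    (⟦ ⟪ l ⟫ ⟧ ⊕ ⟦ p ⟧) (m * n + s)
      ≡⟨ at (⟦⟧-++ ⟪ l ⟫ p) (m * n + s) ⟨
    ⟦ ⟪ l ⟫ ⊞ p ⟧ (m * n + s)
      ≡⟨ Vanish.coefficient v n ⟩
    0ℤ ∎)
    where open ≡-Reasoning

  agree₀ : ∀ m → Vanish m c (⟪ l ⟫ ⊟ p) → ∀ n → f (m * n + c) ≡ (f ′) (m * n)
  agree₀ m v n = trans (agree m c 0 refl v n) (cong (f ′) (ℕₚ.+-identityʳ (m * n)))

  oppose₀ : ∀ m → Vanish m c (⟪ l ⟫ ⊞ p) → ∀ n → f (m * n + c) ≡ - (f ′) (m * n)
  oppose₀ m v n = trans (oppose m c 0 refl v n) (cong (λ k → - (f ′) k) (ℕₚ.+-identityʳ (m * n)))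

Vanish-by : ∀ {p} r {m s} → Vanish m s r → {_ : T (vanishes (p ⊟ r ⊟ []))} → Vanish m s p
Vanish-by {p} r v {e} = Vanish-null {p} {r} (linear (p ⊟ r) Null-[] {e}) v

-- Claims (vi)-(x) are claims (i)-(v) after q ↦ -q.
private
  ρ⁺ ρ⁻ ρ²⁻ : Poly
  ρ⁺  = ⟪ ρ ⟫ ⊞ 1ℤ q^ 2 · ρ⁻¹
  ρ⁻  = ⟪ ρ ⟫ ⊟ 1ℤ q^ 2 · ρ⁻¹
  ρ²⁻ = ⟪ ρ² ⟫ ⊟ 1ℤ q^ 4 · ρ⁻²

theorem1p6 : (n : ℕ) →
    (ξ₁ 1 (2 * n + 3) ≡ - ((ξ₁ 1) ′) (2 * n + 1))
  × (ξ₁ 1 (4 * n + 2) ≡ ((ξ₁ 1) ′) (4 * n))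
  × (ξ₁ 1 (6 * n + 2) ≡ ((ξ₁ 1) ′) (6 * n))
  × (ξ₁ 2 (12 * n + 7) ≡ ((ξ₁ 2) ′) (12 * n + 3))
  × (ξ₁ 2 (24 * n + 12) ≡ ((ξ₁ 2) ′) (24 * n + 8))
  × (ξ 2 1 (2 * n + 3) ≡ - ((ξ 2 1) ′) (2 * n + 1))
  × (ξ 2 1 (4 * n + 2) ≡ ((ξ 2 1) ′) (4 * n))
  × (ξ 2 1 (12 * n + 8) ≡ ((ξ 2 1) ′) (12 * n + 6))
  × (ξ 2 2 (12 * n + 7) ≡ ((ξ 2 2) ′) (12 * n + 3))
  × (ξ 2 2 (24 * n + 12) ≡ ((ξ 2 2) ′) (24 * n + 8))
  × (ξ 3 1 (3 * n + 5) ≡ ((ξ 3 1) ′) (3 * n + 1))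
  × (ξ 3 1 (6 * n + 8) ≡ - ((ξ 3 1) ′) (6 * n + 4))
  × (ξ 3 1 (6 * n + 4) ≡ - ((ξ 3 1) ′) (6 * n))
  × (ξ 3 1 (12 * n + 7) ≡ ((ξ 3 1) ′) (12 * n + 3))
  × (ξ 3 2 (24 * n + 14) ≡ ((ξ 3 2) ′) (24 * n + 6))
  × (ξ 3 2 (36 * n + 25) ≡ ((ξ 3 2) ′) (36 * n + 17))
  × (ξ₄ (12 * n + 15) ≡ - (ξ₄ ′) (12 * n + 9))
  × (ξ₄ (12 * n + 7) ≡ - (ξ₄ ′) (12 * n + 1))
  × (ξ₄ (12 * n + 10) ≡ (ξ₄ ′) (12 * n + 4))
  × (ξ₄ (12 * n + 11) ≡ - (ξ₄ ′) (12 * n + 5))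
  × (ξ₄ (24 * n + 13) ≡ (ξ₄ ′) (24 * n + 7))
  × (ξ₄ (36 * n + 24) ≡ (ξ₄ ′) (36 * n + 18))
theorem1p6 n =
    oppose  ρ-rep   2 2 3 1 refl ρ-plus-vanish n
  , agree₀  ρ-rep   2 4 ρ-minus-vanish₄ n
  , agree₀  ρ-rep   2 6 (Vanish-sub 3 2 0 2 ρ-minus-vanish₃) n
  , agree   ρ²-rep  4 12 7 3 refl ρ²-vanish₁₂ n
  , agree   ρ²-rep  4 24 12 8 refl ρ²-vanish₂₄ n
  , oppose  λ₂-rep  2 2 3 1 refl (Vanish-by (sgnPoly ρ⁺) (Vanish-sgn {ρ⁺} ρ-plus-vanish)) n
  , agree₀  λ₂-rep  2 4 (Vanish-by (sgnPoly ρ⁻) (Vanish-sgn {ρ⁻} ρ-minus-vanish₄)) n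
  , agree   λ₂-rep  2 12 8 6 refl (Vanish-by (sgnPoly ρ⁻) (Vanish-sgn {ρ⁻} (Vanish-sub 3 2 2 4 ρ-minus-vanish₃))) n
  , agree   λ₂²-rep 4 12 7 3 refl (Vanish-by (sgnPoly ρ²⁻) (Vanish-sgn {ρ²⁻} ρ²-vanish₁₂)) n
  , agree   λ₂²-rep 4 24 12 8 refl (Vanish-by (sgnPoly ρ²⁻) (Vanish-sgn {ρ²⁻} ρ²-vanish₂₄)) n
  , agree   κ-rep   4 3 5 1 refl κ-minus-vanish₃ n
  , oppose  κ-rep   4 6 8 4 refl κ-plus-vanish₀ n
  , oppose₀ κ-rep   4 6 κ-plus-vanish₂ n
  , agree   κ-rep   4 12 7 3 refl κ-minus-vanish₁₂ n
  , agree   κ²-rep  8 24 14 6 refl κ²-vanish₂₄ n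
  , agree   κ²-rep  8 36 25 17 refl κ²-vanish₃₆ n
  , oppose  τ-rep   6 12 15 9 refl (Vanish-sub 4 7 2 3 τ-plus-vanish) n
  , oppose  τ-rep   6 12 7 1 refl (Vanish-sub 4 7 0 3 τ-plus-vanish) n
  , agree   τ-rep   6 12 10 4 refl τ-minus-vanish₁₂ n
  , oppose  τ-rep   6 12 11 5 refl (Vanish-sub 4 7 1 3 τ-plus-vanish) n
  , agree   τ-rep   6 24 13 7 refl τ-minus-vanish₂₄ n
  , agree   τ-rep   6 36 24 18 refl τ-minus-vanish₃₆ n
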